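{- For each integer $n \ge 1$, the bivariate polynomial \[ \sum_{\sigma \in H(5) \cap S_n} s^{\mathrm{des}(\sigma)} t^{\mathrm{ides}(\sigma)} \] is gamma-positive (as a bivariate palindromic polynomial of darga $n-1$); here $H(5)$ is the substitution closure of the set of all simple permutations of length at most $5$.
   Context: For $\pi \in S_n$ (written in one-line notation), $\mathrm{des}(\pi)=|\{i\in\{1,\dots,n-1\} : \pi(i)>\pi(i+1)\}|$ and $\mathrm{ides}(\pi)=\mathrm{des}(\pi^{ -1})$. A block of a permutation $a_1\ldots a_n$ is a nonempty contiguous sequence of entries $a_i a_{i+1}\ldots a_{i+k}$ whose values also form a contiguous sequence of integers. Singletons and the whole permutation are trivial blocks; all other blocks are proper. A permutation is simple if it has no proper blocks (so $1$, $12$, $21$ are simple). $\mathrm{Simp}_{\le n}$ is the set of all simple permutations of length at most $n$. Inflation: for $\pi\in S_k$ and $\alpha_i\in S_{n_i}$ $(1\le i\le k)$, with $n_1,\dots,n_k$ positive integers of sum $n$, $\pi[\alpha_1,\dots,\alpha_k]\in S_n$ is the permutation obtained by replacing the $i$-th entry of $\pi$ by a block order-isomorphic to $\alpha_i$ on the values $\{s_i+1,\dots,s_i+n_i\}$, where $s_i=\sum_{j:\,\pi(j)<\pi(i)} n_j$ (so the relative order of the blocks is that of $\pi$). For example $2413[213,21,132,1]=546\,98\,132\,7$. For sets of permutations $\mathcal A,\mathcal B$, $\mathcal A[\mathcal B]=\{\alpha[\beta_1,\dots,\beta_k] : \alpha\in\mathcal A \text{ of length } k,\ \beta_1,\dots,\beta_k\in\mathcal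 B\}$. A set $C$ of permutations is substitution-closed if $C=C[C]$; the substitution closure $\langle C\rangle$ is the smallest substitution-closed set of permutations containing $C$. $H(n)=\langle \mathrm{Simp}_{\le n}\rangle$. A bivariate polynomial $f(s,t)$ is palindromic of darga $n-1$ if $f(s,t)=(st)^{n-1}f(1/s,1/t)$ and $f(s,t)=f(t,s)$. These polynomials form a vector space with basis (the bivariate gamma basis) $\{(st)^i(s+t)^j(1+st)^{n-1-j-2i} : i,j\ge 0,\ 2i+j\le n-1\}$. Such a polynomial is gamma-positive if all its coefficients in this basis are nonnegative. -}

module Defs where

open import Algebra.Properties.CommutativeMonoid.Sum as Sum using ()
open import Data.Bool.Base using (if_then_else_)
open import Data.Fin.Base using (Fin; zero; suc; toℕ; inject₁)
import Data.Fin.Properties as Fin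
open import Data.Fin.Permutation
  using (Permutation′; _⟨$⟩ʳ_; _≈_; flip) renaming (id to idₚ)
open import Data.List.Base using (List; length; filter; allFin; foldr)
import Data.List.Membership.Setoid as Membership
import Data.List.Relation.Unary.Unique.Setoid as Unique
open import Data.Nat.Base using (ℕ; zero; suc; _+_; _*_; _∸_; _≤_; _<_; _/_)
open import Data.Nat.Properties using (+-0-commutativeMonoid)
import Data.Nat.Properties as ℕ
open import Data.Product.Base using (Σ; ∃; ∃₂; _×_; _,_)
open import Data.Rational.Base as ℚ using (ℚ; 0ℚ; 1ℚ)
import Data.Rational.Properties as ℚ
open import Data.Sum.Base using (_⊎_)
open import Function.Bundles using (_⇔_; mk⇔; Equivalence)
open import Level using (Level; 0ℓ) renaming (suc to lsuc)
open import Relation.Binary.Bundles using (Setoid)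
open import Relation.Binary.PropositionalEquality.Core
  using (_≡_; _≢_; refl; sym; trans)
open import Relation.Nullary.Decidable.Core using (does; _×-dec_)
open import Relation.Nullary.Negation.Core using (¬_)
open import Relation.Unary using (Pred)

open Sum +-0-commutativeMonoid using () renaming (sum to sumℕ)
open Sum ℚ.+-0-commutativeMonoid using (sum-syntax; sum⁺-syntax)

private
  variable
    k n : ℕ

------------------------------------------------------------------------
-- Permutations.  Positions and values are 0-based: σ ⟨$⟩ʳ i is the i-th
-- entry of the one-line notation of σ, and flip σ is the inverse of σ.

Sₙ : ℕ → Setoid 0ℓ 0ℓ
Sₙ n = record
  { Carrier       = Permutation′ n
  ; _≈_           = _≈_
  ; isEquivalence = record
    { refl  = λ _ → refl
    ; sym   = λ p i → sym (p i)
    ; trans = λ p q i → trans (p i) (q i)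
    }
  }

des : Permutation′ n → ℕ
des {zero}  σ = 0
des {suc m} σ =
  length (filter (λ i → (σ ⟨$⟩ʳ suc i) Fin.<? (σ ⟨$⟩ʳ inject₁ i)) (allFin m))

ides : Permutation′ n → ℕ
ides σ = des (flip σ)

-- Every permutation has positive length, so a set of permutations is a
-- subset of the union of the Sₙ with n ≥ 1.  Membership must not depend
-- on how the underlying bijection is presented.

record PermSet : Set₁ where
  field
    mem      : ∀ n → Pred (Permutation′ n) 0ℓ
    positive : ∀ {n σ} → mem n σ → 1 ≤ n
    resp     : ∀ {n} {σ τ : Permutation′ n} → σ ≈ τ → mem n σ → mem n τ

open PermSet public

------------------------------------------------------------------------
-- Blocks and simple permutations

infix 4 _∈[_,_⟩

_∈[_,_⟩ : Fin n → ℕ → ℕ → Set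
x ∈[ lo , hi ⟩ = lo ≤ toℕ x × toℕ x < hi

-- The entries in positions i, …, j - 1 form a block.

record IsBlock (σ : Permutation′ n) (i j : ℕ) : Set where
  field
    nonempty : i < j
    inside   : j ≤ n
    interval : ∃₂ λ v w → ∀ (y : Fin n) →
               (∃ λ p → p ∈[ i , j ⟩ × σ ⟨$⟩ʳ p ≡ y) ⇔ y ∈[ v , w ⟩

IsTrivial : ℕ → ℕ → ℕ → Set
IsTrivial n i j = j ≡ suc i ⊎ (i ≡ 0 × j ≡ n)

IsProperBlock : Permutation′ n → ℕ → ℕ → Set
IsProperBlock {n} σ i j = IsBlock σ i j × ¬ IsTrivial n i j

IsSimple : Permutation′ n → Set
IsSimple σ = ∀ i j → ¬ IsProperBlock σ i j

private
  block-resp : {σ τ : Permutation′ n} → σ ≈ τ →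
               ∀ {i j} → IsBlock τ i j → IsBlock σ i j
  block-resp σ≈τ b = record
    { nonempty = nonempty
    ; inside   = inside
    ; interval = let v , w , h = interval in v , w , λ y → mk⇔
        (λ (p , r , e) → Equivalence.to (h y) (p , r , trans (sym (σ≈τ p)) e))
        (λ r → let p , r′ , e = Equivalence.from (h y) r
               in p , r′ , trans (σ≈τ p) e)
    }
    where open IsBlock b

Simp≤ : ℕ → PermSet
Simp≤ N = record
  { mem      = λ n σ → 1 ≤ n × n ≤ N × IsSimple σ
  ; positive = λ (1≤n , _) → 1≤n
  ; resp     = λ σ≈τ (1≤n , n≤N , s) →
      1≤n , n≤N , λ i j (b , nt) → s i j (block-resp σ≈τ b , nt)
  }

------------------------------------------------------------------------
-- Inflation and substitution closure

-- The sum of the m j over those j with π(j) < π(i).  For the identity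
-- this is the position at which the i-th block starts.

offset : Permutation′ k → (Fin k → ℕ) → Fin k → ℕ
offset π m i =
  sumℕ λ j → if does ((π ⟨$⟩ʳ j) Fin.<? (π ⟨$⟩ʳ i)) then m j else 0

-- σ = π[α₁,…,α_k], as the graph of the inflation operation: entry p of
-- the i-th block sits at position offset idₚ m i + p.

record IsInflation (π : Permutation′ k) {m : Fin k → ℕ}
                   (α : ∀ i → Permutation′ (m i))
                   (σ : Permutation′ n) : Set where
  field
    total   : n ≡ sumℕ m
    entries : ∀ i (p : Fin (m i)) (q : Fin n) →
              toℕ q ≡ offset idₚ m i + toℕ p →
              toℕ (σ ⟨$⟩ʳ q) ≡ offset π m i + toℕ (α i ⟨$⟩ʳ p)

_[_] : PermSet → PermSet → ∀ n → Pred (Permutation′ n) 0ℓ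
(A [ B ]) n σ =
  Σ ℕ λ k → Σ (Permutation′ k) λ α →
  Σ (Fin k → ℕ) λ m → Σ (∀ i → Permutation′ (m i)) λ β →
  mem A k α × (∀ i → mem B (m i) (β i)) × IsInflation α β σ

SubstitutionClosed : PermSet → Set
SubstitutionClosed C = ∀ n (σ : Permutation′ n) → mem C n σ ⇔ (C [ C ]) n σ

_⊆_ : PermSet → PermSet → Set
C ⊆ D = ∀ n (σ : Permutation′ n) → mem C n σ → mem D n σ

-- The smallest substitution-closed set containing C, as the intersection
-- of all such sets.

⟨_⟩ : PermSet → ∀ n → Pred (Permutation′ n) (lsuc 0ℓ)
⟨ C ⟩ n σ = ∀ (D : PermSet) → SubstitutionClosed D → C ⊆ D → mem D n σ

H : ℕ → ∀ n → Pred (Permutation′ n) (lsuc 0ℓ)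
H N = ⟨ Simp≤ N ⟩

------------------------------------------------------------------------
-- Bivariate polynomials, as coefficient arrays: f a b is the coefficient
-- of s^a t^b.  Finite support is not recorded in the type; IsPalindromic
-- includes it.

Poly : Set
Poly = ℕ → ℕ → ℚ

infix  4 _≗ₚ_
infixl 6 _+ₚ_
infixl 7 _*ₚ_ _·ₚ_
infixr 8 _^ₚ_

_≗ₚ_ : Poly → Poly → Set
f ≗ₚ g = ∀ a b → f a b ≡ g a b

mono : ℕ → ℕ → Poly
mono i j a b = if does ((a ℕ.≟ i) ×-dec (b ℕ.≟ j)) then 1ℚ else 0ℚ

0ₚ 1ₚ s t : Poly
0ₚ _ _ = 0ℚ
1ₚ = mono 0 0
s  = mono 1 0
t  = mono 0 1

_+ₚ_ _*ₚ_ : Poly → Poly → Poly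
(f +ₚ g) a b = f a b ℚ.+ g a b
(f *ₚ g) a b =
  ∑[ i ≤ a ] ∑[ j ≤ b ] (f (toℕ i) (toℕ j) ℚ.* g (a ∸ toℕ i) (b ∸ toℕ j))

_·ₚ_ : ℚ → Poly → Poly
(c ·ₚ f) a b = c ℚ.* f a b

_^ₚ_ : Poly → ℕ → Poly
f ^ₚ zero  = 1ₚ
f ^ₚ suc e = f *ₚ f ^ₚ e

∑ₚ≤ : ℕ → (ℕ → Poly) → Poly
∑ₚ≤ N F a b = ∑[ i ≤ N ] F (toℕ i) a b

-- f(s,t) = (st)^d f(1/s,1/t) and f(s,t) = f(t,s), coefficientwise.  The
-- first equation, between Laurent polynomials, forces f to vanish outside
-- exponents 0, …, d.

record IsPalindromic (d : ℕ) (f : Poly) : Set where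
  field
    bounded   : ∀ a b → d < a ⊎ d < b → f a b ≡ 0ℚ
    reversal  : ∀ a b → a ≤ d → b ≤ d → f a b ≡ f (d ∸ a) (d ∸ b)
    symmetric : ∀ a b → f a b ≡ f b a

gammaBasis : (d i j : ℕ) → Poly
gammaBasis d i j =
  (s *ₚ t) ^ₚ i *ₚ (s +ₚ t) ^ₚ j *ₚ (1ₚ +ₚ s *ₚ t) ^ₚ (d ∸ j ∸ 2 * i)

-- The double sum below ranges over exactly the i, j ≥ 0 with 2i + j ≤ d.

record IsGammaPositive (d : ℕ) (f : Poly) : Set where
  field
    palindromic : IsPalindromic d f
    γ           : ℕ → ℕ → ℚ
    expansion   : f ≗ₚ ∑ₚ≤ (d / 2) λ i → ∑ₚ≤ (d ∸ 2 * i) λ j →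
                       γ i j ·ₚ gammaBasis d i j
    nonnegative : ∀ i j → 2 * i + j ≤ d → 0ℚ ℚ.≤ γ i j

------------------------------------------------------------------------
-- Sums over finite sets of permutations

-- L lists each element of P exactly once (up to equality of permutations).

record Lists {ℓ : Level} (L : List (Permutation′ n))
             (P : Pred (Permutation′ n) ℓ) : Set ℓ where
  open Membership (Sₙ n) using (_∈_)
  field
    unique : Unique.Unique (Sₙ n) L
    member : ∀ σ → σ ∈ L ⇔ P σ

desIdesPoly : List (Permutation′ n) → Poly
desIdesPoly = foldr (λ σ f → mono (des σ) (ides σ) +ₚ f) 0ₚ

-- f is the sum of s^des(σ) t^ides(σ) over the σ in P.  Membership in P
-- need not be decidable by definition, so the enumeration of P is part of
-- the data; any two enumerations give the same polynomial.

IsDesIdesSum : {ℓ : Level} → Pred (Permutation′ n) ℓ → Poly → Set ℓ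
IsDesIdesSum {n} P f =
  Σ (List (Permutation′ n)) λ L → Lists L P × f ≗ₚ desIdesPoly L

{-# OPTIONS --safe #-}
module Submission where

-- Index permutations by deg = size - 1, let z mark deg, and let F, X, A, M be
-- the generating functions of H(5) and of its members that are a point or an
-- inflation of a simple permutation of length 4 or 5 (X), a sum ⊕ (A), or a
-- skew sum ⊖ (M).  Substitution decompositions are unique once the first
-- summand of a (skew) sum is indecomposable, and des, ides are additive, so
-- with u = st
--   A = z (X + M) F,   M = u z (X + A) F,
--   X = 1 + u (s + t) z³ F⁴ + 6 u² z⁴ F⁵,   F = X + A + M.
-- Substituting A and M into each other removes the one-sided terms:
--   F = X + (1 + u) z X F + u z² (X + F) F F,
-- where every coefficient is built from u, s + t and 1 + u, of the right degree.

open import Defs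
open import Algebra.Bundles using (CommutativeRing; CommutativeSemiring)
import Algebra.Properties.CommutativeMonoid.Sum as BigSum
import Algebra.Properties.CommutativeSemigroup as CommutativeSemigroupProperties
import Algebra.Properties.Semiring.Exp as Exp
open import Algebra.Structures using (IsCommutativeSemiring)
open import Data.Bool.Base using (true; false; if_then_else_; _∧_; T)
open import Data.Empty using (⊥; ⊥-elim)
open import Data.Fin.Base as Fin using (Fin; zero; suc; toℕ; fromℕ<; inject₁)
open import Data.Fin.Patterns
open import Data.Fin.Permutation
  using (Permutation′; _⟨$⟩ʳ_; _⟨$⟩ˡ_; _≈_; permutation; inverseˡ; inverseʳ; flip; reverse)
  renaming (id to idₚ)
import Data.Fin.Properties as Fin
open import Data.List.Base as List
  using (List; []; _∷_; [_]; _++_; map; foldr; length; filter; cartesianProductWith)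
open import Data.List.Membership.Propositional using (_∈_; find)
open import Data.List.Membership.Propositional.Properties
  using (∈-++⁺ˡ; ∈-++⁺ʳ; ∈-++⁻; ∈-cartesianProductWith⁺; ∈-cartesianProductWith⁻)
open import Data.List.Relation.Unary.All as All using (All; []; _∷_)
import Data.List.Relation.Unary.All.Properties as All
open import Data.List.Relation.Unary.AllPairs as AllPairs using (AllPairs; []; _∷_)
import Data.List.Relation.Unary.AllPairs.Properties as AllPairs
open import Data.List.Relation.Unary.Any as Any using (Any; here; there)
open import Data.Nat.Base
  using (ℕ; zero; suc; pred; _+_; _*_; _∸_; _/_; _≤_; _<_; _≮_; _≡ᵇ_; _<ᵇ_
        ; z≤n; s≤s; z<s; s<s; s≤s⁻¹; s<s⁻¹)
open import Data.Nat.DivMod using (m*n/n≡m; /-monoˡ-≤)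
import Data.Nat.Properties as ℕ
open import Data.Product.Base using (Σ; _×_; _,_; ∃; ∃₂; proj₁; proj₂)
open import Data.Rational.Base as ℚ using (ℚ; 0ℚ; 1ℚ)
import Data.Rational.Properties as ℚ
open import Data.Sum.Base as Sum using (_⊎_; inj₁; inj₂)
open import Data.Vec.Base using (Vec; []; _∷_; lookup; tabulate)
import Data.Vec.Functional as Vector
open import Data.Vec.Properties using (lookup∘tabulate)
open import Function.Base using (_∘_; id)
open import Function.Bundles using (Equivalence; mk⇔)
open import Level using (0ℓ)
open import Relation.Binary.Definitions using (tri<; tri≈; tri>)
open import Relation.Binary.PropositionalEquality.Core
  using (_≡_; _≢_; refl; sym; trans; cong; cong₂; subst; subst₂)
open import Relation.Binary.PropositionalEquality.Properties
  using (module ≡-Reasoning)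
import Relation.Binary.Reasoning.Setoid as SetoidReasoning
open import Relation.Nullary.Decidable
  using (Dec; does; yes; no; _×-dec_; _⊎-dec_; _→-dec_; ¬?; True; toWitness; from-yes; map′)
open import Relation.Nullary.Negation.Core using (¬_)
open import Relation.Unary using (Pred; Decidable)

-- The equations determine F only implicitly, and H(5) is an intersection over all
-- substitution-closed sets. Both are made finite by bounding the height of decomposition trees:
-- level g + 1 of the enumeration is built from level g, every equation becomes a recursion between
-- consecutive levels, and a permutation of length n + 1 is reached at level n + 1, since each
-- branching has at least two nonempty blocks. The elimination of A and M is forced. A sum brings
-- the factor 1 and a skew sum the factor u, each with one z, and neither is palindromic of darga 1,
-- although 1 + u is. So gamma-positivity is proved for X and F only, two levels at a time. It also
-- depends on which simple permutations exist: 2413 and 3142 have the weights st² and s²t,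
-- gamma-positive only in sum, and all six of length 5 have the weight s²t². Permutations are
-- compared through the relative order of their values at absolute positions, because identities
-- between nested inflations would bring in transports between sizes.

-- Formal power series over a commutative semiring

module PowerSeries (R : CommutativeSemiring 0ℓ 0ℓ) where

  private
    module R = CommutativeSemiring R
    open CommutativeSemigroupProperties R.+-commutativeSemigroup
      using (interchange; x∙yz≈y∙xz)
    open SetoidReasoning R.setoid

  Series : Set
  Series = ℕ → R.Carrier

  infix  4 _≋_
  infixl 6 _⊞_
  infixl 7 _⊠_
  infixr 7 _·_

  _≋_ : Series → Series → Set
  f ≋ g = ∀ n → f n R.≈ g n

  _⊞_ : Series → Series → Series
  (f ⊞ g) n = f n R.+ g n

  -- Unrolled along the left factor rather than summed over `Fin`: `convolve` on lists recurses in
  -- the same way, so that `gf-convolve` is a direct induction.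
  _⊠_ : Series → Series → Series
  (f ⊠ g) zero    = f 0 R.* g 0
  (f ⊠ g) (suc n) = f 0 R.* g (suc n) R.+ ((f ∘ suc) ⊠ g) n

  _·_ : R.Carrier → Series → Series
  (c · f) n = c R.* f n

  𝟘 𝟙 : Series
  𝟘 _ = R.0#
  𝟙 zero    = R.1#
  𝟙 (suc _) = R.0#

  shift : Series → Series
  shift f zero    = R.0#
  shift f (suc n) = f n

  ⊞-cong : ∀ {f f′ g g′} → f ≋ f′ → g ≋ g′ → f ⊞ g ≋ f′ ⊞ g′
  ⊞-cong p q n = R.+-cong (p n) (q n)

  ⊠-cong : ∀ {f f′ g g′} → f ≋ f′ → g ≋ g′ → f ⊠ g ≋ f′ ⊠ g′
  ⊠-cong p q zero    = R.*-cong (p 0) (q 0)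
  ⊠-cong p q (suc n) =
    R.+-cong (R.*-cong (p 0) (q (suc n))) (⊠-cong (p ∘ suc) q n)

  ·-cong : ∀ {c f f′} → f ≋ f′ → c · f ≋ c · f′
  ·-cong p n = R.*-congˡ (p n)

  shift-cong : ∀ {f f′} → f ≋ f′ → shift f ≋ shift f′
  shift-cong p zero    = R.refl
  shift-cong p (suc n) = p n

  zeroˡ : ∀ g → 𝟘 ⊠ g ≋ 𝟘
  zeroˡ g zero    = R.zeroˡ _
  zeroˡ g (suc n) = R.trans (R.+-cong (R.zeroˡ _) (zeroˡ g n)) (R.+-identityˡ _)

  identityˡ : ∀ g → 𝟙 ⊠ g ≋ g
  identityˡ g zero    = R.*-identityˡ _
  identityˡ g (suc n) =
    R.trans (R.+-cong (R.*-identityˡ _) (zeroˡ g n)) (R.+-identityʳ _)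

  distribʳ : ∀ h f g → (f ⊞ g) ⊠ h ≋ f ⊠ h ⊞ g ⊠ h
  distribʳ h f g zero    = R.distribʳ _ _ _
  distribʳ h f g (suc n) = R.trans
    (R.+-cong (R.distribʳ _ _ _) (distribʳ h (f ∘ suc) (g ∘ suc) n))
    (interchange _ _ _ _)

  ·-⊠-assoc : ∀ c f g → (c · f) ⊠ g ≋ c · (f ⊠ g)
  ·-⊠-assoc c f g zero    = R.*-assoc _ _ _
  ·-⊠-assoc c f g (suc n) = R.trans
    (R.+-cong (R.*-assoc _ _ _) (·-⊠-assoc c (f ∘ suc) g n))
    (R.sym (R.distribˡ _ _ _))

  shift-⊠ : ∀ f g → shift f ⊠ g ≋ shift (f ⊠ g)
  shift-⊠ f g zero    = R.zeroˡ _
  shift-⊠ f g (suc n) = R.trans (R.+-congʳ (R.zeroˡ _)) (R.+-identityˡ _)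

  shift-· : ∀ c f → shift (c · f) ≋ c · shift f
  shift-· c f zero    = R.sym (R.zeroʳ _)
  shift-· c f (suc n) = R.refl

  -- The mirror image of the defining recursion, peeling the right factor; commutativity follows by
  -- playing one against the other.
  ⊠-suc : ∀ f g n → (f ⊠ g) (suc n) R.≈ f (suc n) R.* g 0 R.+ (f ⊠ (g ∘ suc)) n
  ⊠-suc f g zero    = R.+-comm _ _
  ⊠-suc f g (suc n) = R.trans
    (R.+-congˡ (⊠-suc (f ∘ suc) g n))
    (x∙yz≈y∙xz _ _ _)

  ⊠-comm : ∀ f g → f ⊠ g ≋ g ⊠ f
  ⊠-comm f g zero    = R.*-comm _ _
  ⊠-comm f g (suc n) = R.trans
    (R.+-cong (R.*-comm _ _) (⊠-comm (f ∘ suc) g n))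
    (R.sym (⊠-suc g f n))

  ⊠-assoc : ∀ f g h → (f ⊠ g) ⊠ h ≋ f ⊠ (g ⊠ h)
  ⊠-assoc f g h zero    = R.*-assoc _ _ _
  ⊠-assoc f g h (suc n) = begin
    f 0 R.* g 0 R.* h (suc n) R.+ (((f ⊠ g) ∘ suc) ⊠ h) n
      ≈⟨ R.+-cong (R.*-assoc _ _ _) (distribʳ h (f 0 · (g ∘ suc)) ((f ∘ suc) ⊠ g) n) ⟩
    f 0 R.* (g 0 R.* h (suc n)) R.+
      (((f 0 · (g ∘ suc)) ⊠ h) n R.+ (((f ∘ suc) ⊠ g) ⊠ h) n)
      ≈⟨ R.+-congˡ (R.+-cong (·-⊠-assoc (f 0) (g ∘ suc) h n) (⊠-assoc (f ∘ suc) g h n)) ⟩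
    f 0 R.* (g 0 R.* h (suc n)) R.+
      (f 0 R.* ((g ∘ suc) ⊠ h) n R.+ ((f ∘ suc) ⊠ (g ⊠ h)) n)
      ≈⟨ R.+-assoc _ _ _ ⟨
    f 0 R.* (g 0 R.* h (suc n)) R.+ f 0 R.* ((g ∘ suc) ⊠ h) n R.+
      ((f ∘ suc) ⊠ (g ⊠ h)) n
      ≈⟨ R.+-congʳ (R.distribˡ _ _ _) ⟨
    f 0 R.* (g ⊠ h) (suc n) R.+ ((f ∘ suc) ⊠ (g ⊠ h)) n ∎

  private
    expand : ∀ a b Y P E →
             a · shift ((Y ⊞ b · shift P) ⊠ E) ≋
             a · shift (Y ⊠ E) ⊞ (a R.* b) · shift (shift (P ⊠ E))
    expand a b Y P E zero    =
      R.trans (R.sym (R.+-identityʳ _)) (R.+-congˡ (R.sym (R.zeroʳ _)))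
    expand a b Y P E (suc n) = begin
      a R.* ((Y ⊞ b · shift P) ⊠ E) n
        ≈⟨ R.*-congˡ (distribʳ E Y (b · shift P) n) ⟩
      a R.* ((Y ⊠ E) n R.+ ((b · shift P) ⊠ E) n)
        ≈⟨ R.*-congˡ (R.+-congˡ (·-⊠-assoc b (shift P) E n)) ⟩
      a R.* ((Y ⊠ E) n R.+ b R.* (shift P ⊠ E) n)
        ≈⟨ R.*-congˡ (R.+-congˡ (R.*-congˡ (shift-⊠ P E n))) ⟩
      a R.* ((Y ⊠ E) n R.+ b R.* shift (P ⊠ E) n)
        ≈⟨ R.distribˡ _ _ _ ⟩
      a R.* (Y ⊠ E) n R.+ a R.* (b R.* shift (P ⊠ E) n)
        ≈⟨ R.+-congˡ (R.*-assoc _ _ _) ⟨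
      a R.* (Y ⊠ E) n R.+ a R.* b R.* shift (P ⊠ E) n ∎

  shift-⊞ : ∀ f g → shift f ⊞ shift g ≋ shift (f ⊞ g)
  shift-⊞ f g zero    = R.+-identityˡ _
  shift-⊞ f g (suc n) = R.refl

  -- The elimination step. With a = 1, b = u and Y, E in the roles of X, F, the two summands are the
  -- equations for A and M with the opposite class substituted once. Each inner term then carries
  -- both factors, so a and b survive only as a + b and ab.
  alternate-⊞ : ∀ a b Y P Q E →
    a · shift ((Y ⊞ b · shift P) ⊠ E) ⊞ b · shift ((Y ⊞ a · shift Q) ⊠ E) ≋
    (a R.+ b) · shift (Y ⊠ E) ⊞ (a R.* b) · shift (shift ((P ⊞ Q) ⊠ E))
  alternate-⊞ a b Y P Q E n = begin
    (a · shift ((Y ⊞ b · shift P) ⊠ E)) n R.+ (b · shift ((Y ⊞ a · shift Q) ⊠ E)) n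
      ≈⟨ R.+-cong (expand a b Y P E n) (expand b a Y Q E n) ⟩
    (a R.* y R.+ a R.* b R.* shift (shift (P ⊠ E)) n) R.+
      (b R.* y R.+ b R.* a R.* shift (shift (Q ⊠ E)) n)
      ≈⟨ interchange _ _ _ _ ⟩
    (a R.* y R.+ b R.* y) R.+
      (a R.* b R.* shift (shift (P ⊠ E)) n R.+ b R.* a R.* shift (shift (Q ⊠ E)) n)
      ≈⟨ R.+-cong (R.sym (R.distribʳ _ _ _)) (R.+-congˡ (R.*-congʳ (R.*-comm b a))) ⟩
    (a R.+ b) R.* y R.+
      (a R.* b R.* shift (shift (P ⊠ E)) n R.+ a R.* b R.* shift (shift (Q ⊠ E)) n)
      ≈⟨ R.+-congˡ (R.distribˡ _ _ _) ⟨
    (a R.+ b) R.* y R.+ a R.* b R.* (shift (shift (P ⊠ E)) n R.+ shift (shift (Q ⊠ E)) n)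
      ≈⟨ R.+-congˡ (R.*-congˡ (shift-⊞ _ _ n)) ⟩
    (a R.+ b) R.* y R.+ a R.* b R.* shift (shift (P ⊠ E) ⊞ shift (Q ⊠ E)) n
      ≈⟨ R.+-congˡ (R.*-congˡ (shift-cong (shift-⊞ (P ⊠ E) (Q ⊠ E)) n)) ⟩
    (a R.+ b) R.* y R.+ a R.* b R.* shift (shift (P ⊠ E ⊞ Q ⊠ E)) n
      ≈⟨ R.+-congˡ (R.*-congˡ (shift-cong (shift-cong (distribʳ E P Q)) n)) ⟨
    (a R.+ b) R.* y R.+ a R.* b R.* shift (shift ((P ⊞ Q) ⊠ E)) n ∎
    where y = shift (Y ⊠ E) n

  private
    isCommutativeSemiring : IsCommutativeSemiring _≋_ _⊞_ _⊠_ 𝟘 𝟙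
    isCommutativeSemiring = record
      { isSemiring = record
        { isSemiringWithoutAnnihilatingZero = record
          { +-isCommutativeMonoid = record
            { isMonoid = record
              { isSemigroup = record
                { isMagma = record
                  { isEquivalence = record
                    { refl  = λ _ → R.refl
                    ; sym   = λ p n → R.sym (p n)
                    ; trans = λ p q n → R.trans (p n) (q n)
                    }
                  ; ∙-cong = ⊞-cong
                  }
                ; assoc = λ f g h n → R.+-assoc _ _ _
                }
              ; identity = (λ f n → R.+-identityˡ _) , (λ f n → R.+-identityʳ _)
              }
            ; comm = λ f g n → R.+-comm _ _
            }
          ; *-cong = ⊠-cong
          ; *-assoc = ⊠-assoc
          ; *-identity =
              identityˡ , λ f n → R.trans (⊠-comm f 𝟙 n) (identityˡ f n)
          ; distrib =
              (λ f g h n → R.trans (⊠-comm f (g ⊞ h) n)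
                (R.trans (distribʳ f g h n)
                  (R.+-cong (⊠-comm g f n) (⊠-comm h f n))))
            , distribʳ
          }
        ; zero = zeroˡ , λ f n → R.trans (⊠-comm f 𝟘 n) (zeroˡ f n)
        }
      ; *-comm = ⊠-comm
      }

  semiring : CommutativeSemiring 0ℓ 0ℓ
  semiring = record { isCommutativeSemiring = isCommutativeSemiring }

-- After two layers the carrier is `Poly` itself, by unfolding: series in s whose coefficients are
-- series in t. The third layer adds z.
module ℚ[t] =
  PowerSeries (CommutativeRing.commutativeSemiring ℚ.+-*-commutativeRing)
module ℚ[s,t] = PowerSeries ℚ[t].semiring
module Z = PowerSeries ℚ[s,t].semiring

open CommutativeSemiring ℚ[s,t].semiring using () renaming
  ( +-cong to +ₚ-cong; +-assoc to +ₚ-assoc; +-comm to +ₚ-comm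
  ; +-identityˡ to +ₚ-identityˡ; +-identityʳ to +ₚ-identityʳ
  ; *-identityʳ to *ₚ-identityʳ; distribˡ to distribˡₚ; zeroʳ to zeroʳₚ
  ; refl to ≗-refl; sym to ≗-sym; trans to ≗-trans; setoid to ≗-setoid)
open ℚ[s,t] using () renaming
  ( _⊠_ to infixl 7 _⊗_; ⊠-cong to ⊗-cong; ⊠-assoc to ⊗-assoc
  ; zeroˡ to zeroˡₚ; distribʳ to distribʳₚ)
open Exp (CommutativeSemiring.semiring ℚ[s,t].semiring)
  using (_^_; ^-homo-*)
open Z using (Series; _≋_; _⊞_; _⊠_; _·_; 𝟘; 𝟙; shift)
open BigSum ℚ.+-0-commutativeMonoid using (sum; sum-cong-≗; sum-replicate-zero; ∑-distrib-+)
open BigSum ℕ.+-0-commutativeMonoid using () renaming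
  ( sum to sumℕ; sum-cong-≗ to sumℕ-cong; sum-permute to sumℕ-permute; ∑-distrib-+ to sumℕ-+)

private
  variable
    A C E : Set
    k n : ℕ

-- Bivariate polynomials and the gamma basis

∑-single : ∀ N i (F : ℕ → ℚ) → i ≤ N → (∀ j → j ≢ i → F j ≡ 0ℚ) →
           sum {suc N} (F ∘ toℕ) ≡ F i
∑-single N zero F _ z = trans
  (cong (F 0 ℚ.+_) (trans (sum-cong-≗ {N} (λ j → z (suc (toℕ j)) λ ())) (sum-replicate-zero N)))
  (ℚ.+-identityʳ _)
∑-single (suc N) (suc i) F (s≤s i≤N) z = trans
  (cong₂ ℚ._+_ (z 0 λ ()) (∑-single N i (F ∘ suc) i≤N (λ j ne → z (suc j) (ne ∘ cong pred))))
  (ℚ.+-identityˡ _)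

private
  convolution : ∀ b (f g : ℕ → ℚ) →
          sum {suc b} (λ j → f (toℕ j) ℚ.* g (b ∸ toℕ j)) ≡ ℚ[t]._⊠_ f g b
  convolution zero    f g = ℚ.+-identityʳ _
  convolution (suc b) f g = cong (f 0 ℚ.* g (suc b) ℚ.+_) (convolution b (f ∘ suc) g)

-- `_*ₚ_` is the double sum of the definitions; the recursive product is the one that carries the
-- semiring laws.
*ₚ≗⊗ : ∀ f g → f *ₚ g ≗ₚ f ⊗ g
*ₚ≗⊗ f g zero    b = trans (ℚ.+-identityʳ _) (convolution b (f 0) (g 0))
*ₚ≗⊗ f g (suc a) b =
  cong₂ ℚ._+_ (convolution b (f 0) (g (suc a))) (*ₚ≗⊗ (f ∘ suc) g a b)

*ₚ-cong : ∀ {f f′ g g′} → f ≗ₚ f′ → g ≗ₚ g′ → f *ₚ g ≗ₚ f′ ⊗ g′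
*ₚ-cong {f} {f′} {g} {g′} p q = ≗-trans {f *ₚ g} {f ⊗ g} {f′ ⊗ g′} (*ₚ≗⊗ f g) (⊗-cong p q)

^ₚ≗^ : ∀ {f f′} → f ≗ₚ f′ → 1ₚ ≗ₚ ℚ[s,t].𝟙 → ∀ e → f ^ₚ e ≗ₚ f′ ^ e
^ₚ≗^ p q zero    = q
^ₚ≗^ p q (suc e) = *ₚ-cong p (^ₚ≗^ p q e)

shiftₛ shiftₜ : Poly → Poly
shiftₛ     = ℚ[s,t].shift
shiftₜ f a = ℚ[t].shift (f a)

shiftₜ-cong : ∀ {f g} → f ≗ₚ g → shiftₜ f ≗ₚ shiftₜ g
shiftₜ-cong p a = ℚ[t].shift-cong (p a)

shiftₜ-⊗ : ∀ f g → shiftₜ f ⊗ g ≗ₚ shiftₜ (f ⊗ g)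
shiftₜ-⊗ f g zero    b       = ℚ[t].shift-⊠ (f 0) (g 0) b
shiftₜ-⊗ f g (suc a) zero    = cong₂ ℚ._+_
  (ℚ[t].shift-⊠ (f 0) (g (suc a)) 0) (shiftₜ-⊗ (f ∘ suc) g a 0)
shiftₜ-⊗ f g (suc a) (suc b) = cong₂ ℚ._+_
  (ℚ[t].shift-⊠ (f 0) (g (suc a)) (suc b)) (shiftₜ-⊗ (f ∘ suc) g a (suc b))

1ₚ≗𝟙 : 1ₚ ≗ₚ ℚ[s,t].𝟙
1ₚ≗𝟙 zero    zero    = refl
1ₚ≗𝟙 zero    (suc b) = refl
1ₚ≗𝟙 (suc a) b       = refl

mono-sucₛ : ∀ i j → mono (suc i) j ≗ₚ shiftₛ (mono i j)
mono-sucₛ i j zero    b = refl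
mono-sucₛ i j (suc a) b = refl

mono-sucₜ : ∀ i j → mono i (suc j) ≗ₚ shiftₜ (mono i j)
mono-sucₜ i j a (suc b) = refl
mono-sucₜ i j a zero with a ≡ᵇ i
... | true  = refl
... | false = refl

mono-diagonal : ∀ i j → mono i j i j ≡ 1ℚ
mono-diagonal zero    zero    = refl
mono-diagonal zero    (suc j) = mono-diagonal zero j
mono-diagonal (suc i) j       = mono-diagonal i j

mono-off-diagonal : ∀ i j a b → a ≢ i ⊎ b ≢ j → mono i j a b ≡ 0ℚ
mono-off-diagonal (suc i) j       (suc a) b       ne         =
  mono-off-diagonal i j a b (Sum.map₁ (_∘ cong suc) ne)
mono-off-diagonal (suc i) j       zero    b       ne         = refl
mono-off-diagonal zero    j       (suc a) b       ne         = refl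
mono-off-diagonal zero    zero    zero    zero    (inj₁ 0≢0) = ⊥-elim (0≢0 refl)
mono-off-diagonal zero    zero    zero    zero    (inj₂ 0≢0) = ⊥-elim (0≢0 refl)
mono-off-diagonal zero    zero    zero    (suc b) ne         = refl
mono-off-diagonal zero    (suc j) zero    zero    ne         = refl
mono-off-diagonal zero    (suc j) zero    (suc b) ne         =
  mono-off-diagonal zero j zero b (Sum.map₂ (_∘ cong suc) ne)

0≤mono : ∀ i j a b → 0ℚ ℚ.≤ mono i j a b
0≤mono i j a b with (a ≡ᵇ i) ∧ (b ≡ᵇ j)
... | true  = ℚ.nonNegative⁻¹ 1ℚ
... | false = ℚ.≤-refl

module ≗-Reasoning where
  open import Relation.Binary.Reasoning.Setoid ≗-setoid public

mono-⊗ : ∀ i j k l → mono i j ⊗ mono k l ≗ₚ mono (i + k) (j + l)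
mono-⊗ (suc i) j k l = begin
  mono (suc i) j ⊗ mono k l       ≈⟨ ⊗-cong (mono-sucₛ i j) (≗-refl {mono k l}) ⟩
  shiftₛ (mono i j) ⊗ mono k l    ≈⟨ ℚ[s,t].shift-⊠ (mono i j) (mono k l) ⟩
  shiftₛ (mono i j ⊗ mono k l)    ≈⟨ ℚ[s,t].shift-cong (mono-⊗ i j k l) ⟩
  shiftₛ (mono (i + k) (j + l))   ≈⟨ mono-sucₛ (i + k) (j + l) ⟨
  mono (suc i + k) (j + l)        ∎
  where open ≗-Reasoning
mono-⊗ zero (suc j) k l = begin
  mono 0 (suc j) ⊗ mono k l       ≈⟨ ⊗-cong (mono-sucₜ 0 j) (≗-refl {mono k l}) ⟩
  shiftₜ (mono 0 j) ⊗ mono k l    ≈⟨ shiftₜ-⊗ (mono 0 j) (mono k l) ⟩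
  shiftₜ (mono 0 j ⊗ mono k l)    ≈⟨ shiftₜ-cong (mono-⊗ 0 j k l) ⟩
  shiftₜ (mono k (j + l))         ≈⟨ mono-sucₜ k (j + l) ⟨
  mono k (suc j + l)              ∎
  where open ≗-Reasoning
mono-⊗ zero zero k l = begin
  mono 0 0 ⊗ mono k l    ≈⟨ ⊗-cong 1ₚ≗𝟙 (≗-refl {mono k l}) ⟩
  ℚ[s,t].𝟙 ⊗ mono k l    ≈⟨ ℚ[s,t].identityˡ (mono k l) ⟩
  mono k l               ∎
  where open ≗-Reasoning

s⊗ : ∀ f → s ⊗ f ≗ₚ shiftₛ f
s⊗ f = begin
  s ⊗ f                    ≈⟨ ⊗-cong (mono-sucₛ 0 0) (≗-refl {f}) ⟩
  shiftₛ (mono 0 0) ⊗ f    ≈⟨ ℚ[s,t].shift-⊠ 1ₚ f ⟩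
  shiftₛ (1ₚ ⊗ f)          ≈⟨ ℚ[s,t].shift-cong (⊗-cong 1ₚ≗𝟙 (≗-refl {f})) ⟩
  shiftₛ (ℚ[s,t].𝟙 ⊗ f)    ≈⟨ ℚ[s,t].shift-cong (ℚ[s,t].identityˡ f) ⟩
  shiftₛ f                 ∎
  where open ≗-Reasoning

t⊗ : ∀ f → t ⊗ f ≗ₚ shiftₜ f
t⊗ f = begin
  t ⊗ f                    ≈⟨ ⊗-cong (mono-sucₜ 0 0) (≗-refl {f}) ⟩
  shiftₜ (mono 0 0) ⊗ f    ≈⟨ shiftₜ-⊗ 1ₚ f ⟩
  shiftₜ (1ₚ ⊗ f)          ≈⟨ shiftₜ-cong (⊗-cong 1ₚ≗𝟙 (≗-refl {f})) ⟩
  shiftₜ (ℚ[s,t].𝟙 ⊗ f)    ≈⟨ shiftₜ-cong (ℚ[s,t].identityˡ f) ⟩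
  shiftₜ f                 ∎
  where open ≗-Reasoning

-- The factors of the gamma basis, palindromic of darga 2, 1 and 1. As a monomial, u agrees by
-- computation with the weight of 21, and w with the joint weight of 12 and 21.
u v w : Poly
u = mono 1 1
v = s +ₚ t
w = 1ₚ +ₚ u

u⊗ : ∀ f → u ⊗ f ≗ₚ shiftₛ (shiftₜ f)
u⊗ f = begin
  u ⊗ f               ≈⟨ ⊗-cong (mono-⊗ 1 0 0 1) (≗-refl {f}) ⟨
  (s ⊗ t) ⊗ f         ≈⟨ ⊗-assoc s t f ⟩
  s ⊗ (t ⊗ f)         ≈⟨ s⊗ (t ⊗ f) ⟩
  shiftₛ (t ⊗ f)      ≈⟨ ℚ[s,t].shift-cong (t⊗ f) ⟩
  shiftₛ (shiftₜ f)   ∎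
  where open ≗-Reasoning

v⊗ : ∀ f → v ⊗ f ≗ₚ shiftₛ f +ₚ shiftₜ f
v⊗ f = begin
  v ⊗ f                    ≈⟨ ℚ[s,t].distribʳ f s t ⟩
  (s ⊗ f) +ₚ (t ⊗ f)       ≈⟨ +ₚ-cong (s⊗ f) (t⊗ f) ⟩
  shiftₛ f +ₚ shiftₜ f     ∎
  where open ≗-Reasoning

w⊗ : ∀ f → w ⊗ f ≗ₚ f +ₚ shiftₛ (shiftₜ f)
w⊗ f = begin
  w ⊗ f                      ≈⟨ ℚ[s,t].distribʳ f 1ₚ u ⟩
  (1ₚ ⊗ f) +ₚ (u ⊗ f)        ≈⟨ +ₚ-cong
    (≗-trans {1ₚ ⊗ f} {ℚ[s,t].𝟙 ⊗ f} {f} (⊗-cong 1ₚ≗𝟙 (≗-refl {f})) (ℚ[s,t].identityˡ f)) (u⊗ f) ⟩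
  f +ₚ shiftₛ (shiftₜ f)     ∎
  where open ≗-Reasoning

-- IsPalindromic with a + a′ = d instead of truncated subtraction.
record Palindromic (d : ℕ) (f : Poly) : Set where
  field
    boundedₛ  : ∀ a b → d < a → f a b ≡ 0ℚ
    reversal  : ∀ a a′ b b′ → a + a′ ≡ d → b + b′ ≡ d → f a b ≡ f a′ b′
    symmetric : ∀ a b → f a b ≡ f b a

  boundedₜ : ∀ a b → d < b → f a b ≡ 0ℚ
  boundedₜ a b d<b = trans (symmetric a b) (boundedₛ b a d<b)

  -- Reversal of darga d + 1 exchanges sf and tf, because (st)^(d+1) (1/s) f(1/s, 1/t) = t (st)^d
  -- f(1/s, 1/t). At the edges a zero from a shift meets another one, or a zero from the bound on f.
  -- In the same way `≡shiftₛₜ` exchanges f and stf.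
  shiftₛ≡shiftₜ : ∀ a a′ b b′ → a + a′ ≡ suc d → b + b′ ≡ suc d →
                  shiftₛ f a b ≡ shiftₜ f a′ b′
  shiftₛ≡shiftₜ zero    a′ b zero     p q = refl
  shiftₛ≡shiftₜ zero    a′ b (suc b′) p q =
    sym (boundedₛ a′ b′ (ℕ.≤-reflexive (sym p)))
  shiftₛ≡shiftₜ (suc a) a′ b zero     p q =
    boundedₜ a b (ℕ.≤-reflexive (trans (sym q) (ℕ.+-identityʳ b)))
  shiftₛ≡shiftₜ (suc a) a′ b (suc b′) p q =
    reversal a a′ b b′ (ℕ.suc-injective p)
      (ℕ.suc-injective (trans (sym (ℕ.+-suc b b′)) q))

  ≡shiftₛₜ : ∀ a a′ b b′ → a + a′ ≡ suc d → b + b′ ≡ suc d →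
             f a b ≡ shiftₛ (shiftₜ f) a′ b′
  ≡shiftₛₜ a zero     b b′       p q =
    boundedₛ a b (ℕ.≤-reflexive (trans (sym p) (ℕ.+-identityʳ a)))
  ≡shiftₛₜ a (suc a′) b zero     p q =
    boundedₜ a b (ℕ.≤-reflexive (trans (sym q) (ℕ.+-identityʳ b)))
  ≡shiftₛₜ a (suc a′) b (suc b′) p q = reversal a a′ b b′
    (ℕ.suc-injective (trans (sym (ℕ.+-suc a a′)) p))
    (ℕ.suc-injective (trans (sym (ℕ.+-suc b b′)) q))

  shiftₛ-transpose : ∀ a b → shiftₛ f a b ≡ shiftₜ f b a
  shiftₛ-transpose zero    b = refl
  shiftₛ-transpose (suc a) b = symmetric a b

  shiftₛₜ-symmetric : ∀ a b → shiftₛ (shiftₜ f) a b ≡ shiftₛ (shiftₜ f) b a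
  shiftₛₜ-symmetric zero    zero    = refl
  shiftₛₜ-symmetric zero    (suc b) = refl
  shiftₛₜ-symmetric (suc a) zero    = refl
  shiftₛₜ-symmetric (suc a) (suc b) = symmetric a b

open Palindromic

palindromic-cong : ∀ {d f g} → f ≗ₚ g → Palindromic d g → Palindromic d f
palindromic-cong p P = record
  { boundedₛ  = λ a b d<a → trans (p a b) (boundedₛ P a b d<a)
  ; reversal  = λ a a′ b b′ e e′ →
      trans (p a b) (trans (reversal P a a′ b b′ e e′) (sym (p a′ b′)))
  ; symmetric = λ a b → trans (p a b) (trans (symmetric P a b) (sym (p b a)))
  }

palindromic-0 : ∀ {d} → Palindromic d 0ₚ
palindromic-0 = record
  { boundedₛ = λ _ _ _ → refl ; reversal = λ _ _ _ _ _ _ → refl ; symmetric = λ _ _ → refl }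

palindromic-+ : ∀ {d f g} → Palindromic d f → Palindromic d g → Palindromic d (f +ₚ g)
palindromic-+ P Q = record
  { boundedₛ  = λ a b d<a → cong₂ ℚ._+_ (boundedₛ P a b d<a) (boundedₛ Q a b d<a)
  ; reversal  = λ a a′ b b′ e e′ →
      cong₂ ℚ._+_ (reversal P a a′ b b′ e e′) (reversal Q a a′ b b′ e e′)
  ; symmetric = λ a b → cong₂ ℚ._+_ (symmetric P a b) (symmetric Q a b)
  }

palindromic-1 : Palindromic 0 ℚ[s,t].𝟙
palindromic-1 = record
  { boundedₛ  = λ { (suc a) b _ → refl }
  ; reversal  = λ { zero zero zero zero _ _ → refl }
  ; symmetric = λ { zero    zero    → refl ; zero    (suc b) → refl
                  ; (suc a) zero    → refl ; (suc a) (suc b) → refl }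
  }

palindromic-u : ∀ {d f} → Palindromic d f → Palindromic (2 + d) (u ⊗ f)
palindromic-u {d} {f} P = palindromic-cong (u⊗ f) (record
  { boundedₛ = λ { (suc a) zero    _     → refl
                 ; (suc a) (suc b) 2+d<a →
                     boundedₛ P a b (ℕ.<-trans (ℕ.n<1+n d) (s≤s⁻¹ 2+d<a)) }
  ; reversal = rev
  ; symmetric = shiftₛₜ-symmetric P
  })
  where
  -- The exponents 0 and d + 2 face each other under reversal: at 0 the shift gives zero, at d + 2
  -- the bound on f does.
  edgeₛ : ∀ a b → a ≡ 2 + d → shiftₛ (shiftₜ f) a b ≡ 0ℚ
  edgeₛ .(2 + d) zero    refl = refl
  edgeₛ .(2 + d) (suc b) refl = boundedₛ P (suc d) b ℕ.≤-refl
  edgeₜ : ∀ a b → b ≡ 2 + d → shiftₛ (shiftₜ f) a b ≡ 0ℚ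
  edgeₜ a b e = trans (shiftₛₜ-symmetric P a b) (edgeₛ b a e)
  step : ∀ {m n} → suc m + suc n ≡ 2 + d → m + n ≡ d
  step {m} {n} e =
    ℕ.suc-injective (trans (sym (ℕ.+-suc m n)) (ℕ.suc-injective e))
  rev : ∀ a a′ b b′ → a + a′ ≡ 2 + d → b + b′ ≡ 2 + d →
        shiftₛ (shiftₜ f) a b ≡ shiftₛ (shiftₜ f) a′ b′
  rev zero    a′ b b′ p q = sym (edgeₛ a′ b′ p)
  rev (suc a) zero b b′ p q = edgeₛ (suc a) b (trans (sym (ℕ.+-identityʳ _)) p)
  rev (suc a) (suc a′) zero b′ p q = sym (edgeₜ (suc a′) b′ q)
  rev (suc a) (suc a′) (suc b) zero p q =
    edgeₜ (suc a) (suc b) (trans (sym (ℕ.+-identityʳ _)) q)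
  rev (suc a) (suc a′) (suc b) (suc b′) p q =
    reversal P a a′ b b′ (step {a} {a′} p) (step {b} {b′} q)

palindromic-v : ∀ {d f} → Palindromic d f → Palindromic (1 + d) (v ⊗ f)
palindromic-v {d} {f} P = palindromic-cong (v⊗ f) (record
  { boundedₛ = λ a b d<a → cong₂ ℚ._+_ (bₛ a b d<a) (bₜ a b d<a)
  ; reversal = λ a a′ b b′ p q → trans
      (cong₂ ℚ._+_
        (shiftₛ≡shiftₜ P a a′ b b′ p q)
        (sym (shiftₛ≡shiftₜ P a′ a b′ b (trans (ℕ.+-comm a′ a) p) (trans (ℕ.+-comm b′ b) q))))
      (ℚ.+-comm (shiftₜ f a′ b′) (shiftₛ f a′ b′))
  ; symmetric = λ a b → trans
      (cong₂ ℚ._+_ (shiftₛ-transpose P a b) (sym (shiftₛ-transpose P b a)))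
      (ℚ.+-comm (shiftₜ f b a) (shiftₛ f b a))
  })
  where
  bₛ : ∀ a b → suc d < a → shiftₛ f a b ≡ 0ℚ
  bₛ (suc a) b (s≤s d<a) = boundedₛ P a b d<a
  bₜ : ∀ a b → suc d < a → shiftₜ f a b ≡ 0ℚ
  bₜ a zero    _   = refl
  bₜ a (suc b) d<a = boundedₛ P a b (ℕ.<-trans (ℕ.n<1+n d) d<a)

palindromic-w : ∀ {d f} → Palindromic d f → Palindromic (1 + d) (w ⊗ f)
palindromic-w {d} {f} P = palindromic-cong (w⊗ f) (record
  { boundedₛ = λ a b d<a → cong₂ ℚ._+_ (boundedₛ P a b (ℕ.<-trans (ℕ.n<1+n d) d<a)) (bₛ a b d<a)
  ; reversal = λ a a′ b b′ p q → trans
      (cong₂ ℚ._+_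
        (≡shiftₛₜ P a a′ b b′ p q)
        (sym (≡shiftₛₜ P a′ a b′ b (trans (ℕ.+-comm a′ a) p) (trans (ℕ.+-comm b′ b) q))))
      (ℚ.+-comm (shiftₛ (shiftₜ f) a′ b′) (f a′ b′))
  ; symmetric = λ a b → cong₂ ℚ._+_ (symmetric P a b) (shiftₛₜ-symmetric P a b)
  })
  where
  bₛ : ∀ a b → suc d < a → shiftₛ (shiftₜ f) a b ≡ 0ℚ
  bₛ (suc a) zero    _         = refl
  bₛ (suc a) (suc b) (s≤s d<a) = boundedₛ P a b d<a

-- The exponent l of 1 + st is an argument of its own, in place of the truncated `d ∸ j ∸ 2 * i` of
-- `gammaBasis`; the darga is then 2i + j + l, which is additive under products.
B : ℕ → ℕ → ℕ → Poly
B i j l = u ^ i ⊗ v ^ j ⊗ w ^ l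

B-u : ∀ i j l → B (suc i) j l ≗ₚ u ⊗ B i j l
B-u i j l = begin
  u ⊗ u ^ i ⊗ v ^ j ⊗ w ^ l       ≈⟨ ⊗-cong (⊗-assoc u (u ^ i) (v ^ j)) (≗-refl {w ^ l}) ⟩
  u ⊗ (u ^ i ⊗ v ^ j) ⊗ w ^ l     ≈⟨ ⊗-assoc u (u ^ i ⊗ v ^ j) (w ^ l) ⟩
  u ⊗ B i j l                     ∎
  where open ≗-Reasoning

B-v : ∀ j l → B 0 (suc j) l ≗ₚ v ⊗ B 0 j l
B-v j l = begin
  ℚ[s,t].𝟙 ⊗ (v ⊗ v ^ j) ⊗ w ^ l     ≈⟨ ⊗-cong (ℚ[s,t].identityˡ (v ⊗ v ^ j)) (≗-refl {w ^ l}) ⟩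
  v ⊗ v ^ j ⊗ w ^ l                  ≈⟨ ⊗-assoc v (v ^ j) (w ^ l) ⟩
  v ⊗ (v ^ j ⊗ w ^ l)                ≈⟨ ⊗-cong (≗-refl {v}) (⊗-cong (ℚ[s,t].identityˡ (v ^ j)) (≗-refl {w ^ l})) ⟨
  v ⊗ B 0 j l                        ∎
  where open ≗-Reasoning

B-w : ∀ l → B 0 0 l ≗ₚ w ^ l
B-w l = begin
  (ℚ[s,t].𝟙 ⊗ ℚ[s,t].𝟙) ⊗ w ^ l     ≈⟨ ⊗-cong (ℚ[s,t].identityˡ ℚ[s,t].𝟙) (≗-refl {w ^ l}) ⟩
  ℚ[s,t].𝟙 ⊗ w ^ l                  ≈⟨ ℚ[s,t].identityˡ (w ^ l) ⟩
  w ^ l                             ∎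
  where open ≗-Reasoning

palindromic-B : ∀ i j l → Palindromic (2 * i + j + l) (B i j l)
palindromic-B (suc i) j l =
  subst (λ d → Palindromic (d + j + l) (B (suc i) j l)) (sym (ℕ.*-suc 2 i))
    (palindromic-cong (B-u i j l) (palindromic-u (palindromic-B i j l)))
palindromic-B zero (suc j) l = palindromic-cong (B-v j l) (palindromic-v (palindromic-B 0 j l))
palindromic-B zero zero l = palindromic-cong (B-w l) (power l)
  where
  power : ∀ l → Palindromic l (w ^ l)
  power zero    = palindromic-1
  power (suc l) = palindromic-w (power l)

B-⊗ : ∀ i j l i′ j′ l′ → B i j l ⊗ B i′ j′ l′ ≗ₚ B (i + i′) (j + j′) (l + l′)
B-⊗ i j l i′ j′ l′ = begin
  (u ^ i ⊗ v ^ j ⊗ w ^ l) ⊗ (u ^ i′ ⊗ v ^ j′ ⊗ w ^ l′)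
    ≈⟨ interchange (u ^ i ⊗ v ^ j) (w ^ l) (u ^ i′ ⊗ v ^ j′) (w ^ l′) ⟩
  (u ^ i ⊗ v ^ j) ⊗ (u ^ i′ ⊗ v ^ j′) ⊗ (w ^ l ⊗ w ^ l′)
    ≈⟨ ⊗-cong (interchange (u ^ i) (v ^ j) (u ^ i′) (v ^ j′)) (≗-refl {w ^ l ⊗ w ^ l′}) ⟩
  (u ^ i ⊗ u ^ i′) ⊗ (v ^ j ⊗ v ^ j′) ⊗ (w ^ l ⊗ w ^ l′)
    ≈⟨ ⊗-cong (⊗-cong (^-homo-* u i i′) (^-homo-* v j j′)) (^-homo-* w l l′) ⟨
  B (i + i′) (j + j′) (l + l′) ∎
  where
  open ≗-Reasoning
  open CommutativeSemigroupProperties (CommutativeSemiring.*-commutativeSemigroup ℚ[s,t].semiring)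
    using (interchange)

gammaBasis≗B : ∀ i j l → gammaBasis (2 * i + j + l) i j ≗ₚ B i j l
gammaBasis≗B i j l = subst (λ e → (s *ₚ t) ^ₚ i *ₚ (s +ₚ t) ^ₚ j *ₚ (1ₚ +ₚ s *ₚ t) ^ₚ e ≗ₚ B i j l)
  (sym exponent)
  (*ₚ-cong
    (*ₚ-cong (^ₚ≗^ st≗u 1ₚ≗𝟙 i) (^ₚ≗^ (≗-refl {v}) 1ₚ≗𝟙 j))
    (^ₚ≗^ (+ₚ-cong (≗-refl {1ₚ}) st≗u) 1ₚ≗𝟙 l))
  where
  st≗u : s *ₚ t ≗ₚ u
  st≗u = ≗-trans {s *ₚ t} {s ⊗ t} {u} (*ₚ≗⊗ s t) (mono-⊗ 1 0 0 1)
  exponent : 2 * i + j + l ∸ j ∸ 2 * i ≡ l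
  exponent = trans (ℕ.∸-+-assoc (2 * i + j + l) j (2 * i))
    (trans (cong (2 * i + j + l ∸_) (ℕ.+-comm j (2 * i)))
      (ℕ.m+n∸m≡n (2 * i + j) l))

-- The graded cone of gamma-positive polynomials

-- Coefficients are recorded by repeated addition, so only natural ones arise. In this form closure
-- under products comes down to `B-⊗`, while on coefficient arrays it would be a convolution of
-- double sums.
data GP (d : ℕ) (f : Poly) : Set where
  none : f ≗ₚ 0ₚ → GP d f
  basis : ∀ i j l → d ≡ 2 * i + j + l → f ≗ₚ B i j l → GP d f
  plus : ∀ {g h} → GP d g → GP d h → f ≗ₚ g +ₚ h → GP d f

GP-cong : ∀ {d f g} → f ≗ₚ g → GP d g → GP d f
GP-cong {f = f} {g} p (none q)         = none (≗-trans {f} {g} {0ₚ} p q)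
GP-cong {f = f} {g} p (basis i j l e q) = basis i j l e (≗-trans {f} {g} {B i j l} p q)
GP-cong {f = f} {g} p (plus {h} {k} P Q q) = plus P Q (≗-trans {f} {g} {h +ₚ k} p q)

GP-+ : ∀ {d f g} → GP d f → GP d g → GP d (f +ₚ g)
GP-+ {f = f} {g} P Q = plus P Q (≗-refl {f +ₚ g})

GP-⊗ : ∀ {d e f g} → GP d f → GP e g → GP (d + e) (f ⊗ g)
GP-⊗ {f = f} {g} (none p) Q = none
  (≗-trans {f ⊗ g} {0ₚ ⊗ g} {0ₚ} (⊗-cong p (≗-refl {g})) (ℚ[s,t].zeroˡ g))
GP-⊗ {f = f} {g} (plus {h} {k} P P′ p) Q = plus (GP-⊗ P Q) (GP-⊗ P′ Q)
  (≗-trans {f ⊗ g} {(h +ₚ k) ⊗ g} {(h ⊗ g) +ₚ (k ⊗ g)}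
    (⊗-cong p (≗-refl {g})) (ℚ[s,t].distribʳ g h k))
GP-⊗ {f = f} {g} P@(basis _ _ _ _ _) (none q) = none
  (≗-trans {f ⊗ g} {f ⊗ 0ₚ} {0ₚ} (⊗-cong (≗-refl {f}) q) (CommutativeSemiring.zeroʳ ℚ[s,t].semiring f))
GP-⊗ {f = f} {g} P@(basis _ _ _ _ _) (plus {h} {k} Q Q′ q) = plus (GP-⊗ P Q) (GP-⊗ P Q′)
  (≗-trans {f ⊗ g} {f ⊗ (h +ₚ k)} {(f ⊗ h) +ₚ (f ⊗ k)}
    (⊗-cong (≗-refl {f}) q) (CommutativeSemiring.distribˡ ℚ[s,t].semiring f h k))
GP-⊗ {d} {e} {f} {g} (basis i j l p q) (basis i′ j′ l′ p′ q′) =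
  basis (i + i′) (j + j′) (l + l′) degree
    (≗-trans {f ⊗ g} {B i j l ⊗ B i′ j′ l′} {B (i + i′) (j + j′) (l + l′)}
      (⊗-cong q q′) (B-⊗ i j l i′ j′ l′))
  where
  open CommutativeSemigroupProperties ℕ.+-commutativeSemigroup using (interchange)
  degree : d + e ≡ 2 * (i + i′) + (j + j′) + (l + l′)
  degree = begin
    d + e                                          ≡⟨ cong₂ _+_ p p′ ⟩
    (2 * i + j + l) + (2 * i′ + j′ + l′)           ≡⟨ interchange (2 * i + j) l (2 * i′ + j′) l′ ⟩
    (2 * i + j) + (2 * i′ + j′) + (l + l′)         ≡⟨ cong (_+ (l + l′)) (interchange (2 * i) j (2 * i′) j′) ⟩
    (2 * i + 2 * i′) + (j + j′) + (l + l′)         ≡⟨ cong (λ x → x + (j + j′) + (l + l′)) (ℕ.*-distribˡ-+ 2 i i′) ⟨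
    2 * (i + i′) + (j + j′) + (l + l′)             ∎
    where open ≡-Reasoning

GP-1 : GP 0 1ₚ
GP-1 = basis 0 0 0 refl (≗-trans {1ₚ} {ℚ[s,t].𝟙} {B 0 0 0} 1ₚ≗𝟙 (≗-sym {B 0 0 0} {ℚ[s,t].𝟙} (B-w 0)))

GP-u : GP 2 u
GP-u = basis 1 0 0 refl (≗-sym {B 1 0 0} {u} (begin
  B 1 0 0         ≈⟨ B-u 0 0 0 ⟩
  u ⊗ B 0 0 0     ≈⟨ ⊗-cong (≗-refl {u}) (B-w 0) ⟩
  u ⊗ ℚ[s,t].𝟙    ≈⟨ *ₚ-identityʳ u ⟩
  u               ∎))
  where open ≗-Reasoning

GP-v : GP 1 v
GP-v = basis 0 1 0 refl (≗-sym {B 0 1 0} {v} (begin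
  B 0 1 0         ≈⟨ B-v 0 0 ⟩
  v ⊗ B 0 0 0     ≈⟨ ⊗-cong (≗-refl {v}) (B-w 0) ⟩
  v ⊗ ℚ[s,t].𝟙    ≈⟨ *ₚ-identityʳ v ⟩
  v               ∎))
  where open ≗-Reasoning

GP-w : GP 1 w
GP-w = basis 0 0 1 refl (≗-sym {B 0 0 1} {w} (begin
  B 0 0 1         ≈⟨ B-w 1 ⟩
  w ⊗ ℚ[s,t].𝟙    ≈⟨ *ₚ-identityʳ w ⟩
  w               ∎))
  where open ≗-Reasoning

GP⇒palindromic : ∀ {d f} → GP d f → Palindromic d f
GP⇒palindromic (none p)              = palindromic-cong p palindromic-0
GP⇒palindromic (basis i j l refl p)  = palindromic-cong p (palindromic-B i j l)
GP⇒palindromic (plus P Q p)          =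
  palindromic-cong p (palindromic-+ (GP⇒palindromic P) (GP⇒palindromic Q))

GammaSum : ℕ → (ℕ → ℕ → ℚ) → Poly
GammaSum d γ = ∑ₚ≤ (d / 2) λ i → ∑ₚ≤ (d ∸ 2 * i) λ j → γ i j ·ₚ gammaBasis d i j

GammaSum-+ : ∀ d γ δ → GammaSum d (λ i j → γ i j ℚ.+ δ i j) ≗ₚ GammaSum d γ +ₚ GammaSum d δ
GammaSum-+ d γ δ a b = linear (λ i j → gammaBasis d i j a b)
  where
  linear : ∀ e → sum {suc (d / 2)} (λ i → sum {suc (d ∸ 2 * toℕ i)} λ j →
                   (γ (toℕ i) (toℕ j) ℚ.+ δ (toℕ i) (toℕ j)) ℚ.* e (toℕ i) (toℕ j)) ≡
                 sum {suc (d / 2)} (λ i → sum {suc (d ∸ 2 * toℕ i)} λ j →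
                   γ (toℕ i) (toℕ j) ℚ.* e (toℕ i) (toℕ j)) ℚ.+
                 sum {suc (d / 2)} (λ i → sum {suc (d ∸ 2 * toℕ i)} λ j →
                   δ (toℕ i) (toℕ j) ℚ.* e (toℕ i) (toℕ j))
  linear e = trans
    (sum-cong-≗ {suc (d / 2)} λ i → trans
      (sum-cong-≗ {suc (d ∸ 2 * toℕ i)} λ j →
        ℚ.*-distribʳ-+ (e (toℕ i) (toℕ j)) (γ (toℕ i) (toℕ j)) (δ (toℕ i) (toℕ j)))
      (∑-distrib-+ {suc (d ∸ 2 * toℕ i)}
                   (λ j → γ (toℕ i) (toℕ j) ℚ.* e (toℕ i) (toℕ j))
                   (λ j → δ (toℕ i) (toℕ j) ℚ.* e (toℕ i) (toℕ j))))
    (∑-distrib-+ {suc (d / 2)}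
      (λ i → sum {suc (d ∸ 2 * toℕ i)} λ j → γ (toℕ i) (toℕ j) ℚ.* e (toℕ i) (toℕ j))
      (λ i → sum {suc (d ∸ 2 * toℕ i)} λ j → δ (toℕ i) (toℕ j) ℚ.* e (toℕ i) (toℕ j)))

GammaSum-0 : ∀ d → GammaSum d (λ _ _ → 0ℚ) ≗ₚ 0ₚ
GammaSum-0 d a b = vanishing (λ i j → gammaBasis d i j a b)
  where
  vanishing : ∀ e → sum {suc (d / 2)} (λ i → sum {suc (d ∸ 2 * toℕ i)} λ j →
                      0ℚ ℚ.* e (toℕ i) (toℕ j)) ≡ 0ℚ
  vanishing e = trans
    (sum-cong-≗ {suc (d / 2)} λ i → trans
      (sum-cong-≗ {suc (d ∸ 2 * toℕ i)} λ j → ℚ.*-zeroˡ (e (toℕ i) (toℕ j)))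
      (sum-replicate-zero (suc (d ∸ 2 * toℕ i))))
    (sum-replicate-zero (suc (d / 2)))

-- `mono i j` is used here as an array of gamma coefficients with a single 1 at (i, j); `i≤` and
-- `j≤` place that index inside the range of summation.
GammaSum-mono : ∀ i j l → GammaSum (2 * i + j + l) (mono i j) ≗ₚ B i j l
GammaSum-mono i j l a b = begin
  GammaSum d (mono i j) a b
    ≡⟨ ∑-single (d / 2) i (λ i′ → sum {suc (d ∸ 2 * i′)} λ j′ →
         mono i j i′ (toℕ j′) ℚ.* gammaBasis d i′ (toℕ j′) a b) i≤ row ⟩
  sum {suc (d ∸ 2 * i)} (λ j′ → mono i j i (toℕ j′) ℚ.* gammaBasis d i (toℕ j′) a b)
    ≡⟨ ∑-single (d ∸ 2 * i) j (λ j′ → mono i j i j′ ℚ.* gammaBasis d i j′ a b) j≤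
         (λ j′ ne → vanish i j′ (inj₂ ne)) ⟩
  mono i j i j ℚ.* gammaBasis d i j a b
    ≡⟨ cong (ℚ._* gammaBasis d i j a b) (mono-diagonal i j) ⟩
  1ℚ ℚ.* gammaBasis d i j a b
    ≡⟨ ℚ.*-identityˡ _ ⟩
  gammaBasis d i j a b
    ≡⟨ gammaBasis≗B i j l a b ⟩
  B i j l a b ∎
  where
  open ≡-Reasoning
  d = 2 * i + j + l
  2i≤d : 2 * i ≤ d
  2i≤d = ℕ.≤-trans (ℕ.m≤m+n (2 * i) j) (ℕ.m≤m+n (2 * i + j) l)
  i≤ : i ≤ d / 2
  i≤ = ℕ.≤-trans (ℕ.≤-reflexive (sym (trans (cong (_/ 2) (ℕ.*-comm 2 i)) (m*n/n≡m i 2)))) (/-monoˡ-≤ 2 2i≤d)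
  j≤ : j ≤ d ∸ 2 * i
  j≤ = ℕ.≤-trans (ℕ.≤-trans (ℕ.m≤m+n j l) (ℕ.≤-reflexive (sym (ℕ.m+n∸m≡n (2 * i) (j + l)))))
    (ℕ.≤-reflexive (cong (_∸ 2 * i) (sym (ℕ.+-assoc (2 * i) j l))))
  vanish : ∀ i′ j′ → i′ ≢ i ⊎ j′ ≢ j → mono i j i′ j′ ℚ.* gammaBasis d i′ j′ a b ≡ 0ℚ
  vanish i′ j′ ne = trans
    (cong (ℚ._* gammaBasis d i′ j′ a b) (mono-off-diagonal i j i′ j′ ne))
    (ℚ.*-zeroˡ (gammaBasis d i′ j′ a b))
  row : ∀ i′ → i′ ≢ i → sum {suc (d ∸ 2 * i′)} (λ j′ →
        mono i j i′ (toℕ j′) ℚ.* gammaBasis d i′ (toℕ j′) a b) ≡ 0ℚ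
  row i′ ne = trans (sum-cong-≗ {suc (d ∸ 2 * i′)} (λ j′ → vanish i′ (toℕ j′) (inj₁ ne)))
    (sum-replicate-zero (suc (d ∸ 2 * i′)))

GP⇒expansion : ∀ {d f} → GP d f →
  ∃ λ γ → f ≗ₚ GammaSum d γ × (∀ i j → 0ℚ ℚ.≤ γ i j)
GP⇒expansion {d} (none p) =
  (λ _ _ → 0ℚ) , (λ a b → trans (p a b) (sym (GammaSum-0 d a b))) , λ _ _ → ℚ.≤-refl {0ℚ}
GP⇒expansion (basis i j l refl p) =
  mono i j , (λ a b → trans (p a b) (sym (GammaSum-mono i j l a b))) , 0≤mono i j
GP⇒expansion {d} (plus P Q p) =
  let γ , eγ , γ≥0 = GP⇒expansion P
      δ , eδ , δ≥0 = GP⇒expansion Q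
  in (λ i j → γ i j ℚ.+ δ i j)
   , (λ a b → trans (p a b) (trans (cong₂ ℚ._+_ (eγ a b) (eδ a b)) (sym (GammaSum-+ d γ δ a b))))
   , (λ i j → ℚ.+-mono-≤ {0ℚ} {γ i j} {0ℚ} {δ i j} (γ≥0 i j) (δ≥0 i j))

GP⇒IsGammaPositive : ∀ {d f} → GP d f → IsGammaPositive d f
GP⇒IsGammaPositive {d} {f} P = let γ , expansion , γ≥0 = GP⇒expansion P in record
  { palindromic = record
    { bounded   = λ { a b (inj₁ d<a) → boundedₛ pal a b d<a
                    ; a b (inj₂ d<b) → boundedₜ pal a b d<b }
    ; reversal  = λ a b a≤d b≤d →
        reversal pal a (d ∸ a) b (d ∸ b) (ℕ.m+[n∸m]≡n a≤d) (ℕ.m+[n∸m]≡n b≤d)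
    ; symmetric = symmetric pal
    }
  ; γ           = γ
  ; expansion   = expansion
  ; nonnegative = λ i j _ → γ≥0 i j
  }
  where
  pal : Palindromic d f
  pal = GP⇒palindromic P

-- Permutations as functions on ℕ, and their inflations

-- A view of q < n: matching on `at i` replaces q by `toℕ i`, and `fn-toℕ` then applies.
data Below (n : ℕ) : ℕ → Set where
  at : (i : Fin n) → Below n (toℕ i)

below : ∀ {q} → q < n → Below n q
below q<n = subst (Below _) (Fin.toℕ-fromℕ< q<n) (at (fromℕ< q<n))

-- The junk value for q ≥ n is 0.
fn : Permutation′ n → ℕ → ℕ
fn {n} σ q with q ℕ.<? n
... | yes q<n = toℕ (σ ⟨$⟩ʳ fromℕ< q<n)
... | no  _   = 0

fn-toℕ : ∀ (σ : Permutation′ n) i → fn σ (toℕ i) ≡ toℕ (σ ⟨$⟩ʳ i)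
fn-toℕ {n} σ i with toℕ i ℕ.<? n
... | yes i<n = cong (λ j → toℕ (σ ⟨$⟩ʳ j)) (Fin.fromℕ<-toℕ i i<n)
... | no  i≮n = ⊥-elim (i≮n (Fin.toℕ<n i))

fn-< : ∀ (σ : Permutation′ n) {q} → q < n → fn σ q < n
fn-< σ q<n with below q<n
... | at i rewrite fn-toℕ σ i = Fin.toℕ<n (σ ⟨$⟩ʳ i)

fn-flip : ∀ (σ : Permutation′ n) {q} → q < n → fn σ (fn (flip σ) q) ≡ q
fn-flip σ q<n with below q<n
... | at i rewrite fn-toℕ (flip σ) i | fn-toℕ σ (σ ⟨$⟩ˡ i) = cong toℕ (inverseʳ σ)

fn-injective : ∀ (σ : Permutation′ n) {p q} → p < n → q < n → fn σ p ≡ fn σ q → p ≡ q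
fn-injective σ {p} {q} p<n q<n e = begin
  p                      ≡⟨ fn-flip (flip σ) p<n ⟨
  fn (flip σ) (fn σ p)   ≡⟨ cong (fn (flip σ)) e ⟩
  fn (flip σ) (fn σ q)   ≡⟨ fn-flip (flip σ) q<n ⟩
  q                      ∎
  where open ≡-Reasoning

fn-cong : ∀ {σ τ : Permutation′ n} → σ ≈ τ → ∀ {q} → q < n → fn σ q ≡ fn τ q
fn-cong {σ = σ} {τ} e q<n with below q<n
... | at i rewrite fn-toℕ σ i | fn-toℕ τ i = cong toℕ (e i)

fn-≈ : ∀ {σ τ : Permutation′ n} → (∀ {q} → q < n → fn σ q ≡ fn τ q) → σ ≈ τ
fn-≈ {σ = σ} {τ} e i = Fin.toℕ-injective
  (trans (sym (fn-toℕ σ i)) (trans (e (Fin.toℕ<n i)) (fn-toℕ τ i)))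

strictlyMonotone⇒inflationary : ∀ {n} (g : ℕ → ℕ) →
  (∀ {x y} → x < y → y < n → g x < g y) → ∀ {x} → x < n → x ≤ g x
strictlyMonotone⇒inflationary g mono {zero}  _   = z≤n
strictlyMonotone⇒inflationary g mono {suc x} x<n = ℕ.≤-<-trans
  (strictlyMonotone⇒inflationary g mono (ℕ.<-trans (ℕ.n<1+n x) x<n))
  (mono (ℕ.n<1+n x) x<n)

private
  -- The map `fn τ ∘ fn (flip σ)` is strictly increasing below n, so it cannot fall below its
  -- argument; the argument taken is `fn σ q`.
  order⇒≤ : (σ τ : Permutation′ n) →
    (∀ {p q} → p < n → q < n → fn σ p < fn σ q → fn τ p < fn τ q) →
    ∀ {q} → q < n → fn σ q ≤ fn τ q
  order⇒≤ {n} σ τ mono {q} q<n =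
    subst (λ x → fn σ q ≤ fn τ x) (fn-flip (flip σ) q<n)
      (strictlyMonotone⇒inflationary (λ x → fn τ (fn (flip σ) x)) mono′ (fn-< σ q<n))
    where
    mono′ : ∀ {x y} → x < y → y < n → fn τ (fn (flip σ) x) < fn τ (fn (flip σ) y)
    mono′ x<y y<n = let x<n = ℕ.<-trans x<y y<n in
      mono (fn-< (flip σ) x<n) (fn-< (flip σ) y<n)
        (subst (_< _) (sym (fn-flip σ x<n)) (subst (_ <_) (sym (fn-flip σ y<n)) x<y))

order-reflects : (σ : Permutation′ n) (f : ℕ → ℕ) →
  (∀ {p q} → p < n → q < n → fn σ p < fn σ q → f p < f q) →
  ∀ {p q} → p < n → q < n → f p < f q → fn σ p < fn σ q
order-reflects σ f mono {p} {q} p<n q<n fp<fq with ℕ.<-cmp (fn σ p) (fn σ q)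
... | tri< lt _ _ = lt
... | tri> _ _ gt = ⊥-elim (ℕ.<-asym fp<fq (mono q<n p<n gt))
... | tri≈ _ eq _ with refl ← fn-injective σ p<n q<n eq = ⊥-elim (ℕ.<-irrefl refl fp<fq)

-- Both inequalities come from `order⇒≤`, once order preservation is turned around. Through this
-- lemma the later comparisons of permutations rest on relative order alone.
order-determines : (σ τ : Permutation′ n) →
  (∀ {p q} → p < n → q < n → fn σ p < fn σ q → fn τ p < fn τ q) →
  ∀ {q} → q < n → fn σ q ≡ fn τ q
order-determines σ τ mono q<n = ℕ.≤-antisym
  (order⇒≤ σ τ mono q<n)
  (order⇒≤ τ σ (order-reflects σ (fn τ) mono) q<n)

-- Partial sums indexed by ℕ rather than `Fin`, so that block i runs from cut i to cut i + 1 and the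
-- end of the last block is cut k.
cuts : (Fin k → ℕ) → ℕ → ℕ
cuts {zero}  m _       = 0
cuts {suc k} m zero    = 0
cuts {suc k} m (suc x) = m zero + cuts (m ∘ suc) x

cuts-zero : ∀ (m : Fin k → ℕ) → cuts m 0 ≡ 0
cuts-zero {zero}  m = refl
cuts-zero {suc k} m = refl

cuts-total : ∀ (m : Fin k → ℕ) → cuts m k ≡ sumℕ m
cuts-total {zero}  m = refl
cuts-total {suc k} m = cong (m zero +_) (cuts-total (m ∘ suc))

cuts-suc : ∀ (m : Fin k → ℕ) i → cuts m (suc (toℕ i)) ≡ cuts m (toℕ i) + m i
cuts-suc m zero    = trans (cong (m zero +_) (cuts-zero (m ∘ suc))) (ℕ.+-identityʳ _)
cuts-suc m (suc i) = trans (cong (m zero +_) (cuts-suc (m ∘ suc) i)) (sym (ℕ.+-assoc (m zero) _ _))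

cuts-mono : ∀ (m : Fin k → ℕ) {x y} → x ≤ y → cuts m x ≤ cuts m y
cuts-mono {zero}  m x≤y       = z≤n
cuts-mono {suc k} m z≤n       = z≤n
cuts-mono {suc k} m (s≤s x≤y) = ℕ.+-monoʳ-≤ (m zero) (cuts-mono (m ∘ suc) x≤y)

cuts-cong : ∀ {m m′ : Fin k → ℕ} → (∀ i → m i ≡ m′ i) → ∀ x → cuts m x ≡ cuts m′ x
cuts-cong {zero}  e x       = refl
cuts-cong {suc k} e zero    = refl
cuts-cong {suc k} e (suc x) = cong₂ _+_ (e zero) (cuts-cong (e ∘ suc) x)

offset-id : ∀ (m : Fin k → ℕ) i → offset idₚ m i ≡ cuts m (toℕ i)
offset-id {suc k} m zero    = vanishing k
  where
  vanishing : ∀ k → sumℕ {k} (λ _ → 0) ≡ 0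
  vanishing zero    = refl
  vanishing (suc k) = vanishing k
offset-id {suc k} m (suc i) = cong (m zero +_) (offset-id (m ∘ suc) i)

-- In the order of values, the i-th block of π[α₁,…,α_k] is the π(i)-th.
offset-cuts : ∀ (π : Permutation′ k) m i →
              offset π m i ≡ cuts (m ∘ (π ⟨$⟩ˡ_)) (toℕ (π ⟨$⟩ʳ i))
offset-cuts π m i = begin
  offset π m i
    ≡⟨ sumℕ-permute _ (flip π) ⟩
  sumℕ (λ j → if does ((π ⟨$⟩ʳ (π ⟨$⟩ˡ j)) Fin.<? (π ⟨$⟩ʳ i)) then m (π ⟨$⟩ˡ j) else 0)
    ≡⟨ sumℕ-cong (λ j → cong (λ x → if does (x Fin.<? (π ⟨$⟩ʳ i)) then m (π ⟨$⟩ˡ j) else 0) (inverseʳ π)) ⟩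
  offset idₚ (m ∘ (π ⟨$⟩ˡ_)) (π ⟨$⟩ʳ i)
    ≡⟨ offset-id (m ∘ (π ⟨$⟩ˡ_)) (π ⟨$⟩ʳ i) ⟩
  cuts (m ∘ (π ⟨$⟩ˡ_)) (toℕ (π ⟨$⟩ʳ i)) ∎
  where open ≡-Reasoning

offset-end : ∀ (π : Permutation′ k) m i →
             offset π m i + m i ≡ cuts (m ∘ (π ⟨$⟩ˡ_)) (suc (toℕ (π ⟨$⟩ʳ i)))
offset-end π m i = trans
  (cong₂ _+_ (offset-cuts π m i) (cong m (sym (inverseˡ π))))
  (sym (cuts-suc (m ∘ (π ⟨$⟩ˡ_)) (π ⟨$⟩ʳ i)))

offset-ordered : ∀ (π : Permutation′ k) m {i j} → π ⟨$⟩ʳ i Fin.< π ⟨$⟩ʳ j →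
                 offset π m i + m i ≤ offset π m j
offset-ordered π m {i} {j} lt
  rewrite offset-end π m i | offset-cuts π m j = cuts-mono (m ∘ (π ⟨$⟩ˡ_)) lt

offset-bound : ∀ (π : Permutation′ k) m i → offset π m i + m i ≤ sumℕ m
offset-bound π m i rewrite offset-end π m i = ℕ.≤-trans
  (cuts-mono (m ∘ (π ⟨$⟩ˡ_)) (Fin.toℕ<n (π ⟨$⟩ʳ i)))
  (ℕ.≤-reflexive (trans (cuts-total (m ∘ (π ⟨$⟩ˡ_))) (sym (sumℕ-permute m (flip π)))))

offset-flip : ∀ (π : Permutation′ k) m j →
              offset (flip π) (m ∘ (π ⟨$⟩ˡ_)) j ≡ offset idₚ m (π ⟨$⟩ˡ j)
offset-flip π m j = begin
  offset (flip π) (m ∘ (π ⟨$⟩ˡ_)) j                          ≡⟨ offset-cuts (flip π) (m ∘ (π ⟨$⟩ˡ_)) j ⟩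
  cuts (m ∘ (π ⟨$⟩ˡ_) ∘ (π ⟨$⟩ʳ_)) (toℕ (π ⟨$⟩ˡ j))
    ≡⟨ cuts-cong (λ i → cong m (inverseˡ π {i})) (toℕ (π ⟨$⟩ˡ j)) ⟩
  cuts m (toℕ (π ⟨$⟩ˡ j))                                    ≡⟨ offset-id m (π ⟨$⟩ˡ j) ⟨
  offset idₚ m (π ⟨$⟩ˡ j)                                    ∎
  where open ≡-Reasoning

locate : ∀ (c : ℕ → ℕ) k {v} → c 0 ≤ v → v < c k →
         ∃ λ i → i < k × c i ≤ v × v < c (suc i)
locate c zero    c0≤v v<ck = ⊥-elim (ℕ.<-irrefl refl (ℕ.≤-<-trans c0≤v v<ck))
locate c (suc k) {v} c0≤v v<ck with v ℕ.<? c k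
... | yes v<ck′ = let i , i<k , r = locate c k c0≤v v<ck′
                  in i , ℕ.<-trans i<k (ℕ.n<1+n k) , r
... | no  v≮ck′ = k , ℕ.n<1+n k , ℕ.≮⇒≥ v≮ck′ , v<ck

difference : ∀ {a v b} → a ≤ v → v < a + b → ∃ λ (p : Fin b) → v ≡ a + toℕ p
difference {a} {v} {b} a≤v v<a+b =
  fromℕ< d<b , trans (sym a+d≡v) (cong (a +_) (sym (Fin.toℕ-fromℕ< d<b)))
  where
  a+d≡v : a + (v ∸ a) ≡ v
  a+d≡v = ℕ.m+[n∸m]≡n a≤v
  d<b : v ∸ a < b
  d<b = ℕ.+-cancelˡ-< a (v ∸ a) b (subst (_< a + b) (sym a+d≡v) v<a+b)

offset-locate : ∀ (π : Permutation′ k) m {v} → v < sumℕ m →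
                ∃ λ i → ∃ λ (p : Fin (m i)) → v ≡ offset π m i + toℕ p
offset-locate {k} π m {v} v<m
  with _ , j<k , cj≤v , v<csj ← locate (cuts (m ∘ (π ⟨$⟩ˡ_))) k
    (subst (_≤ v) (sym (cuts-zero (m ∘ (π ⟨$⟩ˡ_)))) z≤n)
    (subst (v <_) (trans (sumℕ-permute m (flip π)) (sym (cuts-total (m ∘ (π ⟨$⟩ˡ_))))) v<m)
  with below j<k
... | at j = π ⟨$⟩ˡ j , difference
  (ℕ.≤-trans (ℕ.≤-reflexive (trans (offset-cuts π m (π ⟨$⟩ˡ j)) (cong (cuts m′ ∘ toℕ) ππ⁻¹j≡j))) cj≤v)
  (ℕ.<-≤-trans v<csj
    (ℕ.≤-reflexive (sym (trans (offset-end π m (π ⟨$⟩ˡ j)) (cong (cuts m′ ∘ suc ∘ toℕ) ππ⁻¹j≡j)))))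
  where
  m′ : Fin k → ℕ
  m′ = m ∘ (π ⟨$⟩ˡ_)
  ππ⁻¹j≡j : π ⟨$⟩ʳ (π ⟨$⟩ˡ j) ≡ j
  ππ⁻¹j≡j = inverseʳ π

offset-injective : ∀ (π : Permutation′ k) m {i j} {p : Fin (m i)} {q : Fin (m j)} →
  offset π m i + toℕ p ≡ offset π m j + toℕ q → i ≡ j
offset-injective π m {i} {j} {p} {q} e with Fin.<-cmp (π ⟨$⟩ʳ i) (π ⟨$⟩ʳ j)
... | tri≈ _ eq _ = trans (sym (inverseˡ π)) (trans (cong (π ⟨$⟩ˡ_) eq) (inverseˡ π))
... | tri< lt _ _ = ⊥-elim (ℕ.<-irrefl e (ℕ.<-≤-trans (ℕ.+-monoʳ-< (offset π m i) (Fin.toℕ<n p))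
        (ℕ.≤-trans (offset-ordered π m lt) (ℕ.m≤m+n _ _))))
... | tri> _ _ gt = ⊥-elim (ℕ.<-irrefl (sym e) (ℕ.<-≤-trans (ℕ.+-monoʳ-< (offset π m j) (Fin.toℕ<n q))
        (ℕ.≤-trans (offset-ordered π m gt) (ℕ.m≤m+n _ _))))

module _ (m : Fin k → ℕ) where

  -- The layout of π puts block i at `offset π m i`. Place p of block i in the layout of π goes to
  -- place `α i p` of that block in the layout of ρ; an inflation is the transfer from `idₚ` to π,
  -- and its inverse is a transfer back.
  transfer : (π ρ : Permutation′ k) → (∀ i → Fin (m i) → Fin (m i)) → Fin (sumℕ m) → Fin (sumℕ m)
  transfer π ρ α v = let i , p , _ = offset-locate π m (Fin.toℕ<n v) in
    fromℕ< (ℕ.<-≤-trans (ℕ.+-monoʳ-< (offset ρ m i) (Fin.toℕ<n (α i p))) (offset-bound ρ m i))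

  transfer-entry : ∀ π ρ α v i (p : Fin (m i)) → toℕ v ≡ offset π m i + toℕ p →
                   toℕ (transfer π ρ α v) ≡ offset ρ m i + toℕ (α i p)
  transfer-entry π ρ α v i p e with offset-locate π m (Fin.toℕ<n v)
  ... | i′ , p′ , e′ with offset-injective π m {i′} {i} {p′} {p} (trans (sym e′) e)
  ... | refl with Fin.toℕ-injective (ℕ.+-cancelˡ-≡ (offset π m i) _ _ (trans (sym e′) e))
  ... | refl = Fin.toℕ-fromℕ< _

  transfer-inverse : ∀ π ρ (α : ∀ i → Permutation′ (m i)) v →
    transfer ρ π (λ i → α i ⟨$⟩ʳ_) (transfer π ρ (λ i → α i ⟨$⟩ˡ_) v) ≡ v
  transfer-inverse π ρ α v =
    let i , p , e = offset-locate π m (Fin.toℕ<n v)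
        x = transfer π ρ (λ i → α i ⟨$⟩ˡ_) v
    in Fin.toℕ-injective (begin
      toℕ (transfer ρ π (λ i → α i ⟨$⟩ʳ_) x)
        ≡⟨ transfer-entry ρ π (λ i → α i ⟨$⟩ʳ_) x i (α i ⟨$⟩ˡ p)
             (transfer-entry π ρ (λ i → α i ⟨$⟩ˡ_) v i p e) ⟩
      offset π m i + toℕ (α i ⟨$⟩ʳ (α i ⟨$⟩ˡ p))
        ≡⟨ cong (λ x → offset π m i + toℕ x) (inverseʳ (α i)) ⟩
      offset π m i + toℕ p
        ≡⟨ e ⟨
      toℕ v ∎)
    where open ≡-Reasoning

  opaque
    -- Opaque: everything later goes through the graph `IsInflation`, never through the search in
    -- `offset-locate`.
    inflate : Permutation′ k → (∀ i → Permutation′ (m i)) → Permutation′ (sumℕ m)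
    inflate π α = permutation (transfer idₚ π (λ i → α i ⟨$⟩ʳ_)) (transfer π idₚ (λ i → α i ⟨$⟩ˡ_))
      (transfer-inverse π idₚ α) (transfer-inverse idₚ π (flip ∘ α))

    inflate-isInflation : ∀ π α → IsInflation π α (inflate π α)
    inflate-isInflation π α = record
      { total   = refl
      ; entries = λ i p q → transfer-entry idₚ π _ q i p
      }

module _ {π : Permutation′ k} {m : Fin k → ℕ} {α : ∀ i → Permutation′ (m i)}
         {σ : Permutation′ n} (I : IsInflation π α σ) where

  open IsInflation I

  -- The blocks of the inverse are the inverse blocks, listed in the order of their values. This
  -- carries statements about `des` over to `ides`.
  isInflation-flip : IsInflation (flip π) (λ j → flip (α (π ⟨$⟩ˡ j))) (flip σ)
  isInflation-flip = record
    { total   = trans total (sumℕ-permute m (flip π))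
    ; entries = λ j p q e →
        let i = π ⟨$⟩ˡ j
            x<n = ℕ.<-≤-trans (ℕ.+-monoʳ-< (offset idₚ m i) (Fin.toℕ<n (α i ⟨$⟩ˡ p)))
                    (ℕ.≤-trans (offset-bound idₚ m i) (ℕ.≤-reflexive (sym total)))
            x = fromℕ< x<n
            σx≡q : σ ⟨$⟩ʳ x ≡ q
            σx≡q = Fin.toℕ-injective (begin
              toℕ (σ ⟨$⟩ʳ x)
                ≡⟨ entries i (α i ⟨$⟩ˡ p) x (Fin.toℕ-fromℕ< x<n) ⟩
              offset π m i + toℕ (α i ⟨$⟩ʳ (α i ⟨$⟩ˡ p))
                ≡⟨ cong₂ _+_
                     (trans (offset-cuts π m i)
                       (trans (cong (cuts (m ∘ (π ⟨$⟩ˡ_)) ∘ toℕ) (inverseʳ π))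
                         (sym (offset-id (m ∘ (π ⟨$⟩ˡ_)) j))))
                     (cong toℕ (inverseʳ (α i))) ⟩
              offset idₚ (m ∘ (π ⟨$⟩ˡ_)) j + toℕ p
                ≡⟨ e ⟨
              toℕ q ∎)
        in begin
          toℕ (σ ⟨$⟩ˡ q)                       ≡⟨ cong (λ y → toℕ (σ ⟨$⟩ˡ y)) σx≡q ⟨
          toℕ (σ ⟨$⟩ˡ (σ ⟨$⟩ʳ x))              ≡⟨ cong toℕ (inverseˡ σ) ⟩
          toℕ x                                ≡⟨ Fin.toℕ-fromℕ< x<n ⟩
          offset idₚ m i + toℕ (α i ⟨$⟩ˡ p)    ≡⟨ cong (_+ toℕ (α i ⟨$⟩ˡ p)) (offset-flip π m j) ⟨
          offset (flip π) (m ∘ (π ⟨$⟩ˡ_)) j + toℕ (α i ⟨$⟩ˡ p) ∎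
    }
    where open ≡-Reasoning

  inflation-value : ∀ i {p} → p < m i →
                    fn σ (cuts m (toℕ i) + p) ≡ offset π m i + fn (α i) p
  inflation-value i p<m with below p<m
  ... | at p = begin
    fn σ (cuts m (toℕ i) + toℕ p)          ≡⟨ cong (fn σ) (Fin.toℕ-fromℕ< x<n) ⟨
    fn σ (toℕ x)                           ≡⟨ fn-toℕ σ x ⟩
    toℕ (σ ⟨$⟩ʳ x)                         ≡⟨ entries i p x
      (trans (Fin.toℕ-fromℕ< x<n) (cong (_+ toℕ p) (sym (offset-id m i)))) ⟩
    offset π m i + toℕ (α i ⟨$⟩ʳ p)        ≡⟨ cong (offset π m i +_) (fn-toℕ (α i) p) ⟨
    offset π m i + fn (α i) (toℕ p)        ∎
    where
    open ≡-Reasoning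
    x<n : cuts m (toℕ i) + toℕ p < n
    x<n rewrite sym (offset-id m i) = ℕ.<-≤-trans (ℕ.+-monoʳ-< (offset idₚ m i) (Fin.toℕ<n p))
      (ℕ.≤-trans (offset-bound idₚ m i) (ℕ.≤-reflexive (sym total)))
    x : Fin n
    x = fromℕ< x<n

-- The positions lo, …, hi - 1 are cut at c 0 < … < c k into blocks whose
-- values under f are ordered as r 0, …, r (k - 1).
record Decomposition (f : ℕ → ℕ) (lo hi k : ℕ) (r c : ℕ → ℕ) : Set where
  field
    start  : c 0 ≡ lo
    end    : c k ≡ hi
    strict : ∀ {i} → i < k → c i < c (suc i)
    order  : ∀ {i j p q} → i < k → j < k →
             c i ≤ p → p < c (suc i) → c j ≤ q → q < c (suc j) →
             r i < r j → f p < f q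

inflation-decomposition :
  ∀ {π : Permutation′ k} {m : Fin k → ℕ} {α : ∀ i → Permutation′ (m i)} {σ : Permutation′ n} →
  IsInflation π α σ → (∀ i → 0 < m i) → Decomposition (fn σ) 0 n k (fn π) (cuts m)
inflation-decomposition {k} {n} {π} {m} {α} {σ} I 0<m = record
  { start  = cuts-zero m
  ; end    = trans (cuts-total m) (sym (IsInflation.total I))
  ; strict = strict
  ; order  = order
  }
  where
  strict : ∀ {i} → i < k → cuts m i < cuts m (suc i)
  strict i<k with below i<k
  ... | at i rewrite cuts-suc m i = ℕ.m<m+n (cuts m (toℕ i)) (0<m i)
  order : ∀ {i j p q} → i < k → j < k →
          cuts m i ≤ p → p < cuts m (suc i) → cuts m j ≤ q → q < cuts m (suc j) →
          fn π i < fn π j → fn σ p < fn σ q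
  order i<k j<k ci≤p p<c cj≤q q<c lt with below i<k | below j<k
  ... | at i | at j rewrite cuts-suc m i | cuts-suc m j
    with difference ci≤p p<c | difference cj≤q q<c
  ... | p , refl | q , refl
    rewrite inflation-value I i (Fin.toℕ<n p) | inflation-value I j (Fin.toℕ<n q)
          | fn-toℕ π i | fn-toℕ π j =
    ℕ.<-≤-trans (ℕ.+-monoʳ-< (offset π m i) (fn-< (α i) (Fin.toℕ<n p)))
      (ℕ.≤-trans (offset-ordered π m lt) (ℕ.m≤m+n _ _))

-- Descents of inflations

Σ< : ℕ → (ℕ → ℕ) → ℕ
Σ< n d = sumℕ {n} (d ∘ toℕ)

Σ<-cong : ∀ n {d e : ℕ → ℕ} → (∀ {p} → p < n → d p ≡ e p) → Σ< n d ≡ Σ< n e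
Σ<-cong n eq = sumℕ-cong {n} (λ i → eq (Fin.toℕ<n i))

Σ<-+ : ∀ m n d → Σ< (m + n) d ≡ Σ< m d + Σ< n (λ p → d (m + p))
Σ<-+ zero    n d = refl
Σ<-+ (suc m) n d = trans (cong (d 0 +_) (Σ<-+ m n (d ∘ suc))) (sym (ℕ.+-assoc (d 0) _ _))

-- A block of size m i + 1 has m i adjacencies inside it, and k more join consecutive blocks;
-- together they are the N adjacencies of N + 1 positions.
Σ<-blocks : ∀ k (m : Fin (suc k) → ℕ) d N → suc N ≡ sumℕ (suc ∘ m) →
  Σ< N d ≡ sumℕ (λ i → Σ< (m i) (λ p → d (cuts (suc ∘ m) (toℕ i) + p))) +
           sumℕ {k} (λ i → d (cuts (suc ∘ m) (toℕ (inject₁ i)) + m (inject₁ i)))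
Σ<-blocks zero m d N e = trans
  (cong (λ x → Σ< x d) (ℕ.suc-injective (trans e (ℕ.+-identityʳ _))))
  (trans (sym (ℕ.+-identityʳ _)) (sym (ℕ.+-identityʳ _)))
Σ<-blocks (suc k) m d N e = begin
  Σ< N d
    ≡⟨ cong (λ x → Σ< x d) (trans (ℕ.suc-injective e) refl) ⟩
  Σ< (m₀ + suc N′) d
    ≡⟨ Σ<-+ m₀ (suc N′) d ⟩
  Σ< m₀ d + (d (m₀ + 0) + Σ< N′ (λ p → d (m₀ + suc p)))
    ≡⟨ cong (Σ< m₀ d +_) (cong₂ _+_ (cong d (ℕ.+-identityʳ m₀))
         (trans (Σ<-cong N′ (λ {p} _ → cong d (ℕ.+-suc m₀ p)))
           (trans (Σ<-blocks k (m ∘ suc) (d ∘ (suc m₀ +_)) N′ refl) (cong₂ _+_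
             (sumℕ-cong (λ i → Σ<-cong (m (suc i)) (λ {p} _ →
               cong d (sym (ℕ.+-assoc (suc m₀) (cuts (suc ∘ m ∘ suc) (toℕ i)) p)))))
             (sumℕ-cong (λ i → cong d (sym (ℕ.+-assoc (suc m₀)
               (cuts (suc ∘ m ∘ suc) (toℕ (inject₁ i))) (m (suc (inject₁ i)))))))))))
     ⟩
  Σ< m₀ d + (d m₀ + (I + J))
    ≡⟨ cong (Σ< m₀ d +_) (trans (sym (ℕ.+-assoc (d m₀) I J))
         (trans (cong (_+ J) (ℕ.+-comm (d m₀) I)) (ℕ.+-assoc I (d m₀) J))) ⟩
  Σ< m₀ d + (I + (d m₀ + J))
    ≡⟨ ℕ.+-assoc (Σ< m₀ d) I (d m₀ + J) ⟨
  Σ< m₀ d + I + (d m₀ + J) ∎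
  where
  open ≡-Reasoning
  m₀ N′ I J : ℕ
  m₀ = m zero
  N′ = m (suc zero) + sumℕ {k} (λ i → suc (m (suc (suc i))))
  I = sumℕ (λ i → Σ< (m (suc i)) (λ p → d (cuts (suc ∘ m) (toℕ (suc i)) + p)))
  J = sumℕ {k} (λ i → d (cuts (suc ∘ m) (toℕ (inject₁ (suc i))) + m (inject₁ (suc i))))

-- The Boolean test is the one to which `Fin.<?` reduces, so that `des-fn` involves no case
-- analysis.
bit : ℕ → ℕ → ℕ
bit x y = if x <ᵇ y then 1 else 0

bit-< : ∀ {x y} → x < y → bit x y ≡ 1
bit-< {x} {y} x<y with x <ᵇ y | ℕ.<⇒<ᵇ x<y
... | true | _ = refl

bit-≮ : ∀ {x y} → x ≮ y → bit x y ≡ 0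
bit-≮ {x} {y} x≮y with x <ᵇ y in eq
... | false = refl
... | true  = ⊥-elim (x≮y (ℕ.<ᵇ⇒< x y (subst T (sym eq) _)))

bit-+ : ∀ a x y → bit (a + x) (a + y) ≡ bit x y
bit-+ zero    x y = refl
bit-+ (suc a) x y = bit-+ a x y

descent : (ℕ → ℕ) → ℕ → ℕ
descent f q = bit (f (suc q)) (f q)

length-filter : ∀ {A : Set} {P : Pred A 0ℓ} (P? : Decidable P) (g : Fin n → A) d →
  (∀ i → d (toℕ i) ≡ (if does (P? (g i)) then 1 else 0)) →
  length (filter P? (List.tabulate g)) ≡ Σ< n d
length-filter {zero}  P? g d e = refl
length-filter {suc n} P? g d e with does (P? (g zero)) | e zero
... | true  | eq = cong₂ _+_ (sym eq) (length-filter P? (g ∘ suc) (d ∘ suc) (e ∘ suc))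
... | false | eq = cong₂ _+_ (sym eq) (length-filter P? (g ∘ suc) (d ∘ suc) (e ∘ suc))

des-fn : ∀ (σ : Permutation′ (suc n)) → des σ ≡ Σ< n (descent (fn σ))
des-fn {n} σ = length-filter {n}
  (λ i → (σ ⟨$⟩ʳ suc i) Fin.<? (σ ⟨$⟩ʳ inject₁ i)) id (descent (fn σ))
  (λ i → cong₂ bit (fn-toℕ σ (suc i))
    (trans (cong (fn σ) (sym (Fin.toℕ-inject₁ i))) (fn-toℕ σ (inject₁ i))))

module _ {π : Permutation′ (suc k)} {m : Fin (suc k) → ℕ} {α : ∀ i → Permutation′ (suc (m i))}
         {σ : Permutation′ (suc n)} (I : IsInflation π α σ) where

  private
    c : ℕ → ℕ
    c = cuts (suc ∘ m)

    inner : ∀ i {p} → p < m i → descent (fn σ) (c (toℕ i) + p) ≡ descent (fn (α i)) p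
    inner i {p} p<m = begin
      bit (fn σ (suc (c (toℕ i) + p))) (fn σ (c (toℕ i) + p))
        ≡⟨ cong (λ x → bit (fn σ x) (fn σ (c (toℕ i) + p))) (ℕ.+-suc (c (toℕ i)) p) ⟨
      bit (fn σ (c (toℕ i) + suc p)) (fn σ (c (toℕ i) + p))
        ≡⟨ cong₂ bit (inflation-value I i (s<s p<m))
             (inflation-value I i (ℕ.<-trans p<m (ℕ.n<1+n (m i)))) ⟩
      bit (o + fn (α i) (suc p)) (o + fn (α i) p)
        ≡⟨ bit-+ o _ _ ⟩
      bit (fn (α i) (suc p)) (fn (α i) p) ∎
      where
      open ≡-Reasoning
      o : ℕ
      o = offset π (suc ∘ m) i

    -- Here q is the last position of one block and q + 1 the first of the next, so `order` compares
    -- their values as the pattern compares its neighbouring entries.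
    outer : ∀ (i : Fin k) →
      descent (fn σ) (c (toℕ (inject₁ i)) + m (inject₁ i)) ≡ descent (fn π) (toℕ i)
    outer i = compare
      where
      open Decomposition (inflation-decomposition I (λ _ → z<s))
      q a b : ℕ
      q = c (toℕ (inject₁ i)) + m (inject₁ i)
      a = toℕ (inject₁ i)
      b = suc (toℕ i)
      a<k : a < suc k
      a<k = Fin.toℕ<n (inject₁ i)
      b<k : b < suc k
      b<k = s<s (Fin.toℕ<n i)
      sq≡cb : suc q ≡ c b
      sq≡cb = trans (sym (ℕ.+-suc _ _)) (trans (sym (cuts-suc (suc ∘ m) (inject₁ i)))
        (cong (c ∘ suc) (Fin.toℕ-inject₁ i)))
      ca≤q : c a ≤ q
      ca≤q = ℕ.m≤m+n _ _
      q<csa : q < c (suc a)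
      q<csa = ℕ.≤-reflexive (trans sq≡cb (cong (c ∘ suc) (sym (Fin.toℕ-inject₁ i))))
      cb≤sq : c b ≤ suc q
      cb≤sq = ℕ.≤-reflexive (sym sq≡cb)
      sq<csb : suc q < c (suc b)
      sq<csb = subst (_< c (suc b)) (sym sq≡cb) (strict b<k)
      fna : fn π a ≡ fn π (toℕ i)
      fna = cong (fn π) (Fin.toℕ-inject₁ i)
      compare : descent (fn σ) q ≡ descent (fn π) (toℕ i)
      compare with ℕ.<-cmp (fn π b) (fn π a)
      ... | tri< lt _ _ = trans
        (bit-< (order b<k a<k cb≤sq sq<csb ca≤q q<csa lt))
        (sym (bit-< (subst (fn π b <_) fna lt)))
      ... | tri> _ _ gt = trans
        (bit-≮ (ℕ.<-asym (order a<k b<k ca≤q q<csa cb≤sq sq<csb gt)))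
        (sym (bit-≮ (ℕ.<-asym (subst (_< fn π b) fna gt))))
      ... | tri≈ _ eq _ = ⊥-elim (ℕ.1+n≢n
        (trans (fn-injective π b<k a<k eq) (Fin.toℕ-inject₁ i)))

  des-inflation : des σ ≡ des π + sumℕ (λ i → des (α i))
  des-inflation = begin
    des σ
      ≡⟨ des-fn σ ⟩
    Σ< n (descent (fn σ))
      ≡⟨ Σ<-blocks k m (descent (fn σ)) n (IsInflation.total I) ⟩
    _ ≡⟨ cong₂ _+_
           (sumℕ-cong (λ i → trans (Σ<-cong (m i) (inner i)) (sym (des-fn (α i)))))
           (trans (sumℕ-cong outer) (sym (des-fn π))) ⟩
    sumℕ (λ i → des (α i)) + des π
      ≡⟨ ℕ.+-comm _ (des π) ⟩
    des π + sumℕ (λ i → des (α i)) ∎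
    where open ≡-Reasoning

ides-inflation :
  ∀ {π : Permutation′ (suc k)} {m : Fin (suc k) → ℕ} {α : ∀ i → Permutation′ (suc (m i))}
  {σ : Permutation′ (suc n)} → IsInflation π α σ →
  ides σ ≡ ides π + sumℕ (λ i → ides (α i))
ides-inflation {π = π} {α = α} I = trans (des-inflation (isInflation-flip I))
  (cong (ides π +_) (sym (sumℕ-permute (λ i → ides (α i)) (flip π))))

private
  variable
    k′ lo hi : ℕ
    f g r r′ c c′ : ℕ → ℕ

-- Uniqueness of substitution decompositions

infix 4 _∈⟦_,_⟩ _∉⟦_,_⟩

_∈⟦_,_⟩ _∉⟦_,_⟩ : ℕ → ℕ → ℕ → Set
p ∈⟦ x , y ⟩ = x ≤ p × p < y
p ∉⟦ x , y ⟩ = p < x ⊎ y ≤ p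

-- A witness that the positions from x to y - 1 do not form a block: an outside entry whose value
-- lies between two inside ones.
record Separated (f : ℕ → ℕ) (lo hi x y : ℕ) : Set where
  constructor separated
  field
    {p a b} : ℕ
    inside  : p ∈⟦ lo , hi ⟩
    outside : p ∉⟦ x , y ⟩
    left    : a ∈⟦ x , y ⟩
    right   : b ∈⟦ x , y ⟩
    fa<fp   : f a < f p
    fp<fb   : f p < f b

-- Simplicity with witnesses in place of negations. The witnesses can be found by finite search, and
-- they transfer from a pattern r to any f that is cut according to r.
OrderSimple : ℕ → (ℕ → ℕ) → Set
OrderSimple k r =
  ∀ {x y} → 2 + x ≤ y → y ≤ k → ¬ (x ≡ 0 × y ≡ k) → Separated r 0 k x y

module _ (D : Decomposition f lo hi k r c) where

  open Decomposition D

  cut-≤ : ∀ {i j} → i ≤ j → j ≤ k → c i ≤ c j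
  cut-≤ {i} {zero}  z≤n _    = ℕ.≤-refl
  cut-≤ {i} {suc j} i≤sj j<k with ℕ.m≤n⇒m<n∨m≡n i≤sj
  ... | inj₂ refl = ℕ.≤-refl
  ... | inj₁ i<sj = ℕ.≤-trans (cut-≤ (s≤s⁻¹ i<sj) (ℕ.<⇒≤ j<k)) (ℕ.<⇒≤ (strict j<k))

  cut-< : ∀ {i j} → i < j → j ≤ k → c i < c j
  cut-< i<j j≤k = ℕ.<-≤-trans (strict (ℕ.<-≤-trans i<j j≤k)) (cut-≤ i<j j≤k)

  cut-lo : ∀ {i} → i ≤ k → lo ≤ c i
  cut-lo i≤k = subst (_≤ _) start (cut-≤ z≤n i≤k)

  cut-hi : ∀ {i} → i ≤ k → c i ≤ hi
  cut-hi i≤k = subst (_ ≤_) end (cut-≤ i≤k ℕ.≤-refl)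

  block-of : ∀ {p} → p ∈⟦ lo , hi ⟩ → ∃ λ i → i < k × p ∈⟦ c i , c (suc i) ⟩
  block-of (lo≤p , p<hi) = locate c k (subst (_≤ _) (sym start) lo≤p) (subst (_ <_) (sym end) p<hi)

  block-unique : ∀ {i j p} → i < k → j < k →
                 p ∈⟦ c i , c (suc i) ⟩ → p ∈⟦ c j , c (suc j) ⟩ → i ≡ j
  block-unique {i} {j} i<k j<k (ci≤p , p<csi) (cj≤p , p<csj) with ℕ.<-cmp i j
  ... | tri≈ _ eq _ = eq
  ... | tri< lt _ _ = ⊥-elim (ℕ.<⇒≱ p<csi (ℕ.≤-trans (cut-≤ lt (ℕ.<⇒≤ j<k)) cj≤p))
  ... | tri> _ _ gt = ⊥-elim (ℕ.<⇒≱ p<csj (ℕ.≤-trans (cut-≤ gt (ℕ.<⇒≤ i<k)) ci≤p))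

  cut∈ : ∀ {i} → i < k → c i ∈⟦ c i , c (suc i) ⟩
  cut∈ i<k = ℕ.≤-refl , strict i<k

  block-unseparated : (∀ {i j} → i < k → j < k → r i ≡ r j → i ≡ j) →
    ∀ {j} → j < k → ¬ Separated f lo hi (c j) (c (suc j))
  block-unseparated r-inj {j} j<k (separated p∈ p∉ (cj≤a , a<csj) (cj≤b , b<csj) fa<fp fp<fb)
    with l , l<k , cl≤p , p<csl ← block-of p∈
    with ℕ.<-cmp (r j) (r l)
  ... | tri< lt _ _ = ℕ.<-asym fp<fb (order j<k l<k cj≤b b<csj cl≤p p<csl lt)
  ... | tri> _ _ gt = ℕ.<-asym fa<fp (order l<k j<k cl≤p p<csl cj≤a a<csj gt)
  ... | tri≈ _ eq _ with refl ← r-inj j<k l<k eq | p∉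
  ...   | inj₁ p<cj  = ℕ.<⇒≱ p<cj cl≤p
  ...   | inj₂ csj≤p = ℕ.<⇒≱ p<csl csj≤p

  block-proper : 1 < k → ∀ {j} → j < k → ¬ (c j ≡ lo × c (suc j) ≡ hi)
  block-proper 1<k {zero}  _   (_ , e) = ℕ.<-irrefl (trans e (sym end)) (cut-< 1<k ℕ.≤-refl)
  block-proper 1<k {suc j} j<k (e , _) = ℕ.<-irrefl (trans start (sym e)) (cut-< z<s (ℕ.<⇒≤ j<k))

  module _ (simple : OrderSimple k r) (3<k : 3 < k)
           {x y : ℕ} (lo≤x : lo ≤ x) (x≤y : x ≤ y) (y<hi : y < hi)
           (unseparated : ¬ Separated f lo hi x (suc y))
           (proper : ¬ (x ≡ lo × suc y ≡ hi)) where

    private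
      -- If every block with index in [X, Y) meets the interval and every
      -- other block reaches outside of it, then [X, Y) is a block of r.
      contradictory : ∀ {X Y} → 2 + X ≤ Y → Y ≤ k → ¬ (X ≡ 0 × Y ≡ k) →
        (∀ {i} → i ∈⟦ X , Y ⟩ → ∃ λ p → p ∈⟦ c i , c (suc i) ⟩ × p ∈⟦ x , suc y ⟩) →
        (∀ {i} → i < k → i ∉⟦ X , Y ⟩ → ∃ λ p → p ∈⟦ c i , c (suc i) ⟩ × p ∉⟦ x , suc y ⟩) → ⊥
      contradictory 2+X≤Y Y≤k nw meets leaves
        with separated {i} {a} {b} (_ , i<k) i∉ a∈ b∈ ra<ri ri<rb ← simple 2+X≤Y Y≤k nw
        with p , (ci≤p , p<csi) , p∉ ← leaves i<k i∉
           | q , (ca≤q , q<csa) , q∈ ← meets a∈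
           | s , (cb≤s , s<csb) , s∈ ← meets b∈
        = unseparated (separated
            (ℕ.≤-trans (cut-lo (ℕ.<⇒≤ i<k)) ci≤p , ℕ.<-≤-trans p<csi (cut-hi i<k)) p∉ q∈ s∈
            (order a<k i<k ca≤q q<csa ci≤p p<csi ra<ri)
            (order i<k b<k ci≤p p<csi cb≤s s<csb ri<rb))
        where
        a<k : a < k
        a<k = ℕ.<-≤-trans (proj₂ a∈) Y≤k
        b<k : b < k
        b<k = ℕ.<-≤-trans (proj₂ b∈) Y≤k

      module _ {i j : ℕ} (x∈ : x ∈⟦ c i , c (suc i) ⟩) (y∈ : y ∈⟦ c j , c (suc j) ⟩)
               (i<j : i < j) (j<k : j < k) where

        later-cut∈ : ∀ {a} → i < a → a ≤ j → c a ∈⟦ x , suc y ⟩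
        later-cut∈ i<a a≤j =
            ℕ.≤-trans (ℕ.<⇒≤ (proj₂ x∈)) (cut-≤ i<a (ℕ.<⇒≤ (ℕ.≤-<-trans a≤j j<k)))
          , s≤s (ℕ.≤-trans (cut-≤ a≤j (ℕ.<⇒≤ j<k)) (proj₁ y∈))

        spanned : ¬ (i ≡ 0 × suc j ≡ k) → ⊥
        spanned nw = contradictory (s≤s i<j) j<k nw meets leaves
          where
          meets : ∀ {a} → a ∈⟦ i , suc j ⟩ → ∃ λ p → p ∈⟦ c a , c (suc a) ⟩ × p ∈⟦ x , suc y ⟩
          meets (i≤a , s≤s a≤j) with ℕ.m≤n⇒m<n∨m≡n i≤a
          ... | inj₁ i<a  = _ , cut∈ (ℕ.≤-<-trans a≤j j<k) , later-cut∈ i<a a≤j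
          ... | inj₂ refl = x , x∈ , ℕ.≤-refl , s≤s x≤y
          leaves : ∀ {a} → a < k → a ∉⟦ i , suc j ⟩ →
                   ∃ λ p → p ∈⟦ c a , c (suc a) ⟩ × p ∉⟦ x , suc y ⟩
          leaves {a} a<k (inj₁ a<i) = _ , cut∈ a<k ,
            inj₁ (ℕ.<-≤-trans (cut-< a<i (ℕ.<⇒≤ (ℕ.<-trans i<j j<k))) (proj₁ x∈))
          leaves {a} a<k (inj₂ j<a) = _ , cut∈ a<k ,
            inj₂ (ℕ.≤-trans (proj₂ y∈) (cut-≤ j<a (ℕ.<⇒≤ a<k)))

        module _ (i≡0 : i ≡ 0) (sj≡k : suc j ≡ k) where

          -- X and Y leave out the first (last) block unless the interval contains it.
          contained : ∀ {X Y} → X ≤ 1 → j ≤ Y → Y ≤ k → ¬ (X ≡ 0 × Y ≡ k) →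
            (X ≡ 0 → x ≡ lo) → (X ≡ 1 → lo < x) → (Y ≡ j → suc y < hi) → ⊥
          contained {X} {Y} X≤1 j≤Y Y≤k nw X≡0⇒ X≡1⇒ Y≡j⇒ =
            contradictory (ℕ.≤-trans (s≤s (s≤s X≤1)) (ℕ.≤-trans (s≤s⁻¹ (subst (3 <_) (sym sj≡k) 3<k)) j≤Y))
              Y≤k nw meets leaves
            where
            meets : ∀ {a} → a ∈⟦ X , Y ⟩ → ∃ λ p → p ∈⟦ c a , c (suc a) ⟩ × p ∈⟦ x , suc y ⟩
            meets {zero} (X≤0 , 0<Y) = _ , cut∈ (ℕ.<-≤-trans 0<Y Y≤k) ,
              ℕ.≤-reflexive (trans (X≡0⇒ (ℕ.n≤0⇒n≡0 X≤0)) (sym start)) ,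
              s≤s (ℕ.≤-trans (subst (_≤ x) (sym start) lo≤x) x≤y)
            meets {suc a} (_ , a<Y) = _ , cut∈ (ℕ.<-≤-trans a<Y Y≤k) ,
              later-cut∈ (subst (_< suc a) (sym i≡0) z<s)
                (s≤s⁻¹ (subst (suc a <_) (sym sj≡k) (ℕ.<-≤-trans a<Y Y≤k)))
            leaves : ∀ {a} → a < k → a ∉⟦ X , Y ⟩ →
                     ∃ λ p → p ∈⟦ c a , c (suc a) ⟩ × p ∉⟦ x , suc y ⟩
            leaves {a} a<k (inj₁ a<X) with refl ← ℕ.n<1⇒n≡0 (ℕ.<-≤-trans a<X X≤1) =
              _ , cut∈ a<k , inj₁ (subst (_< x) (sym start) (X≡1⇒ (ℕ.≤-antisym X≤1 a<X)))
            leaves {a} a<k (inj₂ Y≤a) = suc y ,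
              (ℕ.≤-trans (ℕ.≤-reflexive (cong c a≡j)) (ℕ.≤-trans (proj₁ y∈) (ℕ.n≤1+n y)) ,
                subst (suc y <_) (sym (trans (cong c (trans (cong suc a≡j) sj≡k)) end))
                  (Y≡j⇒ (ℕ.≤-antisym (subst (Y ≤_) a≡j Y≤a) j≤Y))) ,
              inj₂ ℕ.≤-refl
              where
              a≡j : a ≡ j
              a≡j = ℕ.≤-antisym (s≤s⁻¹ (subst (a <_) (sym sj≡k) a<k)) (ℕ.≤-trans j≤Y Y≤a)

          covering : ⊥
          covering with x ℕ.≟ lo | suc y ℕ.≟ hi
          ... | yes p | yes q = proper (p , q)
          ... | yes p | no  q = contained {0} {j} z≤n ℕ.≤-refl (ℕ.<⇒≤ j<k)
            (λ (_ , j≡k) → ℕ.<-irrefl j≡k j<k) (λ _ → p) (λ ()) (λ _ → ℕ.≤∧≢⇒< y<hi q)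
          ... | no  p | yes q = contained {1} {k} ℕ.≤-refl (ℕ.<⇒≤ j<k) ℕ.≤-refl
            (λ ()) (λ ()) (λ _ → ℕ.≤∧≢⇒< lo≤x (p ∘ sym)) (λ k≡j → ⊥-elim (ℕ.<-irrefl (sym k≡j) j<k))
          ... | no  p | no  q = contained {1} {j} ℕ.≤-refl ℕ.≤-refl (ℕ.<⇒≤ j<k)
            (λ ()) (λ ()) (λ _ → ℕ.≤∧≢⇒< lo≤x (p ∘ sym)) (λ _ → ℕ.≤∧≢⇒< y<hi q)

    -- If the interval met several blocks, the pattern would have a proper block: the indices met,
    -- when these are not all; otherwise all indices except a first or last one whose block is only
    -- partly covered. This trimming may drop two indices, and k > 3 leaves at least two.
    interval-in-block : ∃ λ i → i < k × c i ≤ x × suc y ≤ c (suc i)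
    interval-in-block
      with i , i<k , x∈ ← block-of (lo≤x , ℕ.≤-<-trans x≤y y<hi)
         | j , j<k , y∈ ← block-of (ℕ.≤-trans lo≤x x≤y , y<hi)
      with ℕ.<-cmp i j
    ... | tri≈ _ refl _ = i , i<k , proj₁ x∈ , proj₂ y∈
    ... | tri> _ _ j<i = ⊥-elim (ℕ.<⇒≱ (proj₂ y∈)
          (ℕ.≤-trans (cut-≤ j<i (ℕ.<⇒≤ i<k)) (ℕ.≤-trans (proj₁ x∈) x≤y)))
    ... | tri< i<j _ _ with i ℕ.≟ 0 | suc j ℕ.≟ k
    ...   | yes p | yes q = ⊥-elim (covering x∈ y∈ i<j j<k p q)
    ...   | no  p | _     = ⊥-elim (spanned x∈ y∈ i<j j<k (p ∘ proj₁))
    ...   | yes _ | no  q = ⊥-elim (spanned x∈ y∈ i<j j<k (q ∘ proj₂))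

-- Block i of D′ is a proper unseparated interval, hence inside a single block of D; that block
-- contains the common left end `c i`, so it is block i. Applied both ways from left to right, this
-- matches all cuts.
refined-block :
  (D : Decomposition f lo hi k r c) → OrderSimple k r → 3 < k →
  (D′ : Decomposition f lo hi k′ r′ c′) →
  (∀ {i j} → i < k′ → j < k′ → r′ i ≡ r′ j → i ≡ j) → 1 < k′ →
  ∀ {i} → i < k → i < k′ → c i ≡ c′ i → c′ (suc i) ≤ c (suc i)
refined-block {c = c} {c′ = c′} D simple 3<k D′ r′-inj 1<k′ {i} i<k i<k′ ci≡c′i
  with c′ (suc i) in eq | Decomposition.strict D′ i<k′ | block-unseparated D′ r′-inj i<k′
     | block-proper D′ 1<k′ i<k′ | cut-hi D′ i<k′
... | suc y | s≤s c′i≤y | unseparated | proper | y<hi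
  with j , j<k , cj≤c′i , sy≤csj ←
    interval-in-block D simple 3<k (cut-lo D′ (ℕ.<⇒≤ i<k′)) c′i≤y y<hi
      (λ S → unseparated S) proper
  with refl ← block-unique D j<k i<k (cj≤c′i , ℕ.≤-trans (s≤s c′i≤y) sy≤csj)
    (subst (λ p → p ∈⟦ c i , c (suc i) ⟩) ci≡c′i (cut∈ D i<k))
  = sy≤csj

module _ {f lo hi k k′ r r′ c c′}
  (D : Decomposition f lo hi k r c) (simple : OrderSimple k r) (3<k : 3 < k)
  (r-inj : ∀ {i j} → i < k → j < k → r i ≡ r j → i ≡ j)
  (D′ : Decomposition f lo hi k′ r′ c′) (simple′ : OrderSimple k′ r′) (3<k′ : 3 < k′)
  (r′-inj : ∀ {i j} → i < k′ → j < k′ → r′ i ≡ r′ j → i ≡ j) where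

  simple-cuts-unique : ∀ {i} → i ≤ k → i ≤ k′ → c i ≡ c′ i
  simple-cuts-unique {zero}  _   _    = trans (Decomposition.start D) (sym (Decomposition.start D′))
  simple-cuts-unique {suc i} i<k i<k′ = ℕ.≤-antisym
    (refined-block D′ simple′ 3<k′ D r-inj (ℕ.<-trans (s<s z<s) 3<k) i<k′ i<k (sym ci≡c′i))
    (refined-block D simple 3<k D′ r′-inj (ℕ.<-trans (s<s z<s) 3<k′) i<k i<k′ ci≡c′i)
    where
    ci≡c′i : c i ≡ c′ i
    ci≡c′i = simple-cuts-unique (ℕ.<⇒≤ i<k) (ℕ.<⇒≤ i<k′)

  simple-arity-unique : k ≡ k′
  simple-arity-unique with ℕ.<-cmp k k′
  ... | tri≈ _ eq _ = eq
  ... | tri< lt _ _ = ⊥-elim (ℕ.<-irrefl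
        (trans (sym (simple-cuts-unique ℕ.≤-refl (ℕ.<⇒≤ lt)))
          (trans (Decomposition.end D) (sym (Decomposition.end D′))))
        (cut-< D′ lt ℕ.≤-refl))
  ... | tri> _ _ gt = ⊥-elim (ℕ.<-irrefl
        (trans (simple-cuts-unique (ℕ.<⇒≤ gt) ℕ.≤-refl)
          (trans (Decomposition.end D′) (sym (Decomposition.end D))))
        (cut-< D gt ℕ.≤-refl))

-- The pattern is recovered from the values of f at the left ends of the blocks.
pattern-unique : ∀ {ρ ρ′ : Permutation′ k} →
  Decomposition f lo hi k (fn ρ) c → Decomposition f lo hi k (fn ρ′) c′ →
  (∀ {i} → i ≤ k → c i ≡ c′ i) → ρ ≈ ρ′
pattern-unique {k = k} {f = f} {c = c} {c′ = c′} {ρ} {ρ′} D D′ c≡c′ =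
  fn-≈ (order-determines ρ ρ′ λ p<k q<k lt →
  order-reflects ρ′ (f ∘ c′) (monotone D′) p<k q<k
    (subst₂ (λ x y → f x < f y) (c≡c′ (ℕ.<⇒≤ p<k)) (c≡c′ (ℕ.<⇒≤ q<k)) (monotone D p<k q<k lt)))
  where
  monotone : ∀ {c} {ρ : Permutation′ k} → Decomposition f _ _ k (fn ρ) c → ∀ {p q} → p < k → q < k →
             fn ρ p < fn ρ q → f (c p) < f (c q)
  monotone D p<k q<k lt =
    let open Decomposition D in order p<k q<k ℕ.≤-refl (strict p<k) ℕ.≤-refl (strict q<k) lt

decomposition-cong : ∀ {g} → (∀ {p} → p < hi → f p ≡ g p) →
  Decomposition g lo hi k r c → Decomposition f lo hi k r c
decomposition-cong e D = record
  { start  = start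
  ; end    = end
  ; strict = strict
  ; order  = λ i<k j<k ci≤p p<csi cj≤q q<csj lt →
      subst₂ _<_ (sym (e (ℕ.<-≤-trans p<csi (cut-hi D i<k)))) (sym (e (ℕ.<-≤-trans q<csj (cut-hi D j<k))))
        (order i<k j<k ci≤p p<csi cj≤q q<csj lt)
  }
  where open Decomposition D

-- Sums, skew sums and their cuts

data Sign : Set where
  ⊕ ⊖ : Sign

opposite : Sign → Sign
opposite ⊕ = ⊖
opposite ⊖ = ⊕

two : Sign → Permutation′ 2
two ⊕ = idₚ
two ⊖ = reverse

Before : Sign → ℕ → ℕ → Set
Before ⊕ a b = a < b
Before ⊖ a b = b < a

record Cut (s : Sign) (f : ℕ → ℕ) (lo c hi : ℕ) : Set where
  constructor cut
  field
    lo<c  : lo < c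
    c<hi  : c < hi
    cross : ∀ {p q} → p ∈⟦ lo , c ⟩ → q ∈⟦ c , hi ⟩ → Before s (f p) (f q)

HasCut : Sign → (ℕ → ℕ) → ℕ → ℕ → Set
HasCut s f lo hi = ∃ λ c → Cut s f lo c hi

two-cut : ∀ s → Decomposition f lo hi 2 (fn (two s)) c → Cut s f lo (c 1) hi
two-cut {f} {lo} {hi} {c} s D = cut
  (subst (_< c 1) start (strict z<s)) (subst (c 1 <_) end (strict (s<s z<s)))
  (λ (lo≤p , p<c) (c≤q , q<hi) →
    cross s order (subst (_≤ _) (sym start) lo≤p , p<c) (c≤q , subst (_ <_) (sym end) q<hi))
  where
  open Decomposition D
  cross : ∀ s → (∀ {i j p q} → i < 2 → j < 2 →
             c i ≤ p → p < c (suc i) → c j ≤ q → q < c (suc j) →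
             fn (two s) i < fn (two s) j → f p < f q) →
          ∀ {p q} → p ∈⟦ c 0 , c 1 ⟩ → q ∈⟦ c 1 , c 2 ⟩ → Before s (f p) (f q)
  cross ⊕ ord (a , b) (c , d) = ord {0} {1} z<s (s<s z<s) a b c d z<s
  cross ⊖ ord (a , b) (c , d) = ord {1} {0} (s<s z<s) z<s c d a b z<s

three : ℕ → ℕ → ℕ → ℕ → ℕ
three a b c zero          = a
three a b c (suc zero)    = b
three a b c (suc (suc _)) = c

cut-two : ∀ s {x} → Cut s f lo x hi → Decomposition f lo hi 2 (fn (two s)) (three lo x hi)
cut-two {f} {lo} {hi} s {x} (cut lo<x x<hi cross) = record
  { start  = refl
  ; end    = refl
  ; strict = λ { {zero} _ → lo<x ; {suc zero} _ → x<hi ; {suc (suc _)} (s≤s (s≤s ())) }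
  ; order  = order s cross
  }
  where
  order : ∀ s → (∀ {p q} → p ∈⟦ lo , x ⟩ → q ∈⟦ x , hi ⟩ → Before s (f p) (f q)) →
    ∀ {i j p q} → i < 2 → j < 2 →
    three lo x hi i ≤ p → p < three lo x hi (suc i) →
    three lo x hi j ≤ q → q < three lo x hi (suc j) →
    fn (two s) i < fn (two s) j → f p < f q
  order ⊕ cr {zero}     {suc zero} _ _ a b c d _ = cr (a , b) (c , d)
  order ⊖ cr {suc zero} {zero}     _ _ a b c d _ = cr (c , d) (a , b)
  order ⊕ cr {zero}     {zero}     _ _ a b c d ()
  order ⊖ cr {zero}     {zero}     _ _ a b c d (s≤s ())
  order ⊖ cr {zero}     {suc zero} _ _ a b c d ()
  order ⊕ cr {suc zero} {zero}     _ _ a b c d ()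
  order ⊕ cr {suc zero} {suc zero} _ _ a b c d (s≤s ())
  order ⊖ cr {suc zero} {suc zero} _ _ a b c d ()
  order s cr {suc (suc _)} (s≤s (s≤s ()))
  order s cr {_} {suc (suc _)} _ (s≤s (s≤s ()))

cut-cong : ∀ {s x g} → (∀ {p} → p < hi → f p ≡ g p) → Cut s g lo x hi → Cut s f lo x hi
cut-cong {hi = hi} {f} {lo} {s} {x} {g} e (cut lo<x x<hi cross) = cut lo<x x<hi λ p∈ q∈ →
  subst₂ (Before s) (sym (e (ℕ.<-trans (proj₂ p∈) x<hi))) (sym (e (proj₂ q∈))) (cross p∈ q∈)

cut-left : ∀ {s x y} → x < y → y < hi → Cut s f lo x hi → Cut s f lo x y
cut-left x<y y<hi (cut lo<x _ cross) = cut lo<x x<y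
  λ p∈ (x≤q , q<y) → cross p∈ (x≤q , ℕ.<-trans q<y y<hi)

-- Of two different cuts, the smaller would also cut the first part of the larger. Thus an
-- indecomposable first summand fixes where it ends.
cut-unique : ∀ {s x y} → Cut s f lo x hi → ¬ HasCut s f lo x →
             Cut s f lo y hi → ¬ HasCut s f lo y → x ≡ y
cut-unique {x = x} {y} X ¬X Y ¬Y with ℕ.<-cmp x y
... | tri≈ _ eq _ = eq
... | tri< lt _ _ = ⊥-elim (¬Y (x , cut-left lt (Cut.c<hi Y) X))
... | tri> _ _ gt = ⊥-elim (¬X (y , cut-left gt (Cut.c<hi X) Y))

-- Every cut has the first position on its left and the last on its right, so a sum and a skew sum
-- would order the same two entries oppositely.
cut-opposite : ∀ {s} → HasCut s f lo hi → ¬ HasCut (opposite s) f lo hi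
cut-opposite {hi = suc h} {s = s} (x , cut lo<x (s≤s x≤h) cross) (y , cut lo<y (s≤s y≤h) cross′) =
  absurd s (cross (ℕ.≤-refl , lo<x) (x≤h , ℕ.≤-refl)) (cross′ (ℕ.≤-refl , lo<y) (y≤h , ℕ.≤-refl))
  where
  absurd : ∀ s {a b} → Before s a b → ¬ Before (opposite s) a b
  absurd ⊕ = ℕ.<-asym
  absurd ⊖ = ℕ.<-asym

cut-unseparatedˡ : ∀ {s x} → Cut s f lo x hi → ¬ Separated f lo hi lo x
cut-unseparatedˡ X (separated p∈ (inj₁ p<lo) _ _ _ _) = ℕ.<⇒≱ p<lo (proj₁ p∈)
cut-unseparatedˡ {s = ⊕} X (separated p∈ (inj₂ x≤p) _ b∈ _ fp<fb) =
  ℕ.<-asym fp<fb (Cut.cross X b∈ (x≤p , proj₂ p∈))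
cut-unseparatedˡ {s = ⊖} X (separated p∈ (inj₂ x≤p) a∈ _ fa<fp _) =
  ℕ.<-asym fa<fp (Cut.cross X a∈ (x≤p , proj₂ p∈))

cut-unseparatedʳ : ∀ {s x} → Cut s f lo x hi → ¬ Separated f lo hi x hi
cut-unseparatedʳ X (separated p∈ (inj₂ hi≤p) _ _ _ _) = ℕ.<⇒≱ (proj₂ p∈) hi≤p
cut-unseparatedʳ {s = ⊕} X (separated p∈ (inj₁ p<x) a∈ _ fa<fp _) =
  ℕ.<-asym fa<fp (Cut.cross X (proj₁ p∈ , p<x) a∈)
cut-unseparatedʳ {s = ⊖} X (separated p∈ (inj₁ p<x) _ b∈ _ fp<fb) =
  ℕ.<-asym fp<fb (Cut.cross X (proj₁ p∈ , p<x) b∈)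

-- Both sides of a cut are unseparated, so they lie within the first and the last block; these would
-- leave no room for the blocks in between.
simple-uncut : ∀ {s} → Decomposition f lo hi k r c → OrderSimple k r → 3 < k → ¬ HasCut s f lo hi
simple-uncut {hi = suc h} {k = suc k} {c = c} D simple 3<k (suc x , X@(cut lo≤x (s≤s x<h) _))
  with i , i<k , ci≤lo , x<csi ← interval-in-block D simple 3<k ℕ.≤-refl (s≤s⁻¹ lo≤x) (s≤s (ℕ.<⇒≤ x<h))
         (cut-unseparatedˡ X) (λ (_ , e) → ℕ.<-irrefl e (s≤s x<h))
     | j , j<k , cj≤x , h<csj ← interval-in-block D simple 3<k (ℕ.<⇒≤ lo≤x) x<h ℕ.≤-refl
         (cut-unseparatedʳ X) (λ (e , _) → ℕ.<-irrefl (sym e) lo≤x)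
  with refl ← block-unique D i<k z<s
         (ci≤lo , ℕ.<-≤-trans lo≤x x<csi)
         (ℕ.≤-reflexive (Decomposition.start D) ,
          subst (_< c 1) (Decomposition.start D) (Decomposition.strict D z<s))
     | refl ← block-unique D j<k (ℕ.n<1+n k)
         (ℕ.≤-trans cj≤x x<h , h<csj)
         (s≤s⁻¹ (subst (c k <_) (Decomposition.end D) (Decomposition.strict D (ℕ.n<1+n k))) ,
          ℕ.≤-reflexive (sym (Decomposition.end D)))
  = ℕ.<-irrefl refl (ℕ.<-≤-trans
      (cut-< D (ℕ.<-trans (s<s z<s) (s<s⁻¹ 3<k)) (ℕ.n≤1+n k)) (ℕ.≤-trans cj≤x x<csi))

-- Indexed by length - 1, which is the darga.
AnyPerm : Set
AnyPerm = Σ ℕ λ n → Permutation′ (suc n)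

deg size : AnyPerm → ℕ
deg      = proj₁
size a   = suc (deg a)

perm : (a : AnyPerm) → Permutation′ (size a)
perm = proj₂

val : AnyPerm → ℕ → ℕ
val a = fn (perm a)

infix 4 _≃_

-- Equality up to the presentation of the bijection, stated through `fn` so that no value has to be
-- transported between sizes.
record _≃_ (a b : AnyPerm) : Set where
  constructor _,_
  field
    deg≡ : deg a ≡ deg b
    val≡ : ∀ {q} → q < size a → val a q ≡ val b q

open _≃_

-- Preserving < suffices, because val a is injective on positions.
OrderOf : AnyPerm → (ℕ → ℕ) → ℕ → Set
OrderOf a f lo = ∀ {p q} → p < size a → q < size a → val a p < val a q → f (lo + p) < f (lo + q)

order-≃ : ∀ {a b} → deg a ≡ deg b → OrderOf a (val b) 0 → a ≃ b
order-≃ {a} {b} refl o = refl , order-determines (perm a) (perm b) o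

-- The degree is spelled out so that its successor is `sumℕ (size ∘ v)` by computation, the size
-- that `inflate` produces.
node : Permutation′ (suc k) → (Fin (suc k) → AnyPerm) → AnyPerm
node {k} ρ v = deg (v zero) + sumℕ {k} (size ∘ v ∘ suc) , inflate (size ∘ v) ρ (perm ∘ v)

blocks : (Fin k → AnyPerm) → ℕ → ℕ
blocks v = cuts (size ∘ v)

module _ (ρ : Permutation′ (suc k)) (v : Fin (suc k) → AnyPerm) where

  node-isInflation : IsInflation ρ (perm ∘ v) (perm (node ρ v))
  node-isInflation = inflate-isInflation (size ∘ v) ρ (perm ∘ v)

  node-decomposition : Decomposition (val (node ρ v)) 0 (size (node ρ v)) (suc k) (fn ρ) (blocks v)
  node-decomposition = inflation-decomposition node-isInflation (λ _ → z<s)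

  node-value : ∀ i {p} → p < size (v i) →
    val (node ρ v) (blocks v (toℕ i) + p) ≡ offset ρ (size ∘ v) i + val (v i) p
  node-value = inflation-value node-isInflation

  node-block-order : ∀ i → OrderOf (v i) (val (node ρ v)) (blocks v (toℕ i))
  node-block-order i {p} {q} p< q< lt =
    subst₂ _<_ (sym (node-value i p<)) (sym (node-value i q<)) (ℕ.+-monoʳ-< (offset ρ (size ∘ v) i) lt)

  node-block-order⁻ : ∀ i {p q} → p < size (v i) → q < size (v i) →
    val (node ρ v) (blocks v (toℕ i) + p) < val (node ρ v) (blocks v (toℕ i) + q) →
    val (v i) p < val (v i) q
  node-block-order⁻ i = order-reflects (perm (v i)) _ (node-block-order i)

  -- Recognises f on an interval as an inflation from its pattern and its blocks, as completeness of
  -- the enumeration requires. Entries of different blocks are compared by ρ, entries of one block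
  -- by the assumption on `v i`.
  node-order : ∀ {f lo hi c} → Decomposition f lo hi (suc k) (fn ρ) c →
    (∀ {x} → x ≤ suc k → lo + blocks v x ≡ c x) →
    (∀ i → OrderOf (v i) f (c (toℕ i))) → OrderOf (node ρ v) f lo
  node-order {f} {lo} {hi} {c} D shifted o {p} {q} p< q< lt
    with i , i<k , ci≤p , p<csi ← block-of node-decomposition (z≤n , p<)
       | j , j<k , cj≤q , q<csj ← block-of node-decomposition (z≤n , q<)
    with ℕ.<-cmp (fn ρ i) (fn ρ j)
  ... | tri< lt′ _ _ = Decomposition.order D i<k j<k
    (up (ℕ.<⇒≤ i<k) ci≤p) (down i<k p<csi) (up (ℕ.<⇒≤ j<k) cj≤q) (down j<k q<csj) lt′
    where
    up : ∀ {x p} → x ≤ suc k → blocks v x ≤ p → c x ≤ lo + p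
    up x≤k le = subst (_≤ _) (shifted x≤k) (ℕ.+-monoʳ-≤ lo le)
    down : ∀ {x p} → x < suc k → p < blocks v (suc x) → lo + p < c (suc x)
    down x<k le = subst (_ <_) (shifted x<k) (ℕ.+-monoʳ-< lo le)
  ... | tri> _ _ gt = ⊥-elim (ℕ.<-asym lt
    (Decomposition.order node-decomposition j<k i<k cj≤q q<csj ci≤p p<csi gt))
  ... | tri≈ _ eq _ with refl ← fn-injective ρ i<k j<k eq | below i<k
  ...   | at i rewrite cuts-suc (size ∘ v) i
    with difference ci≤p p<csi | difference cj≤q q<csj
  ...   | p′ , refl | q′ , refl =
    subst₂ (λ x y → f x < f y) (reassoc (toℕ p′)) (reassoc (toℕ q′))
      (o i (Fin.toℕ<n p′) (Fin.toℕ<n q′) (node-block-order⁻ i (Fin.toℕ<n p′) (Fin.toℕ<n q′) lt))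
    where
    reassoc : ∀ p → c (toℕ i) + p ≡ lo + (blocks v (toℕ i) + p)
    reassoc p = trans (cong (_+ p) (sym (shifted (ℕ.<⇒≤ i<k)))) (ℕ.+-assoc lo _ p)

node-decomposition′ : ∀ (ρ : Permutation′ (suc k)) (ρ′ : Permutation′ (suc k′)) {v v′} →
  node ρ v ≃ node ρ′ v′ →
  Decomposition (val (node ρ v)) 0 (size (node ρ v)) (suc k′) (fn ρ′) (blocks v′)
node-decomposition′ {k′ = k′} ρ ρ′ {v} {v′} (e , f≡) = decomposition-cong f≡
  (subst (λ n → Decomposition (val (node ρ′ v′)) 0 (suc n) (suc k′) (fn ρ′) (blocks v′))
    (sym e) (node-decomposition ρ′ v′))

children-unique : ∀ (ρ ρ′ : Permutation′ (suc k)) {v v′} → node ρ v ≃ node ρ′ v′ →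
  (∀ {x} → x ≤ suc k → blocks v x ≡ blocks v′ x) → ∀ i → v i ≃ v′ i
children-unique {k} ρ ρ′ {v} {v′} (e , f≡) c≡c′ i = order-≃ deg≡′ order
  where
  deg≡′ : deg (v i) ≡ deg (v′ i)
  deg≡′ = ℕ.suc-injective (ℕ.+-cancelˡ-≡ (blocks v (toℕ i)) _ _
    (trans (sym (cuts-suc (size ∘ v) i)) (trans (c≡c′ (Fin.toℕ<n i))
      (trans (cuts-suc (size ∘ v′) i) (cong (_+ size (v′ i)) (sym (c≡c′ (ℕ.<⇒≤ (Fin.toℕ<n i)))))))))
  transport : ∀ {p} → p < size (v i) →
    val (node ρ v) (blocks v (toℕ i) + p) ≡ val (node ρ′ v′) (blocks v′ (toℕ i) + p)
  transport {p} p< = trans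
    (f≡ (ℕ.<-≤-trans (ℕ.+-monoʳ-< (blocks v (toℕ i)) p<)
      (subst (_≤ size (node ρ v)) (cuts-suc (size ∘ v) i) (cut-hi (node-decomposition ρ v) (Fin.toℕ<n i)))))
    (cong (λ x → val (node ρ′ v′) (x + p)) (c≡c′ (ℕ.<⇒≤ (Fin.toℕ<n i))))
  order : OrderOf (v i) (val (v′ i)) 0
  order {p} {q} p< q< lt = node-block-order⁻ ρ′ v′ i {p} {q}
    (subst (p <_) (cong suc deg≡′) p<) (subst (q <_) (cong suc deg≡′) q<)
    (subst₂ _<_ (transport p<) (transport q<) (node-block-order ρ v i p< q< lt))

module _ {ρ : Permutation′ (suc k)} (simple : OrderSimple (suc k) (fn ρ)) (3<k : 3 < suc k)
         {ρ′ : Permutation′ (suc k′)} (simple′ : OrderSimple (suc k′) (fn ρ′)) (3<k′ : 3 < suc k′)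
         {v v′} (e : node ρ v ≃ node ρ′ v′) where

  simple-node-cuts : ∀ {x} → x ≤ suc k → x ≤ suc k′ → blocks v x ≡ blocks v′ x
  simple-node-cuts = simple-cuts-unique
    (node-decomposition ρ v) simple 3<k (fn-injective ρ)
    (node-decomposition′ ρ ρ′ e) simple′ 3<k′ (fn-injective ρ′)

  simple-node-arity : suc k ≡ suc k′
  simple-node-arity = simple-arity-unique
    (node-decomposition ρ v) simple 3<k (fn-injective ρ)
    (node-decomposition′ ρ ρ′ e) simple′ 3<k′ (fn-injective ρ′)

simple-node-unique : ∀ {ρ ρ′ : Permutation′ (suc k)} →
  OrderSimple (suc k) (fn ρ) → OrderSimple (suc k) (fn ρ′) → 3 < suc k →
  ∀ {v v′} → node ρ v ≃ node ρ′ v′ → ρ ≈ ρ′ × (∀ i → v i ≃ v′ i)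
simple-node-unique {ρ = ρ} {ρ′} simple simple′ 3<k {v} {v′} e =
    pattern-unique (node-decomposition ρ v) (node-decomposition′ ρ ρ′ e) c≡c′
  , children-unique ρ ρ′ e c≡c′
  where
  c≡c′ : ∀ {x} → x ≤ _ → blocks v x ≡ blocks v′ x
  c≡c′ x≤k = simple-node-cuts {ρ = ρ} simple 3<k simple′ 3<k e x≤k x≤k

Decomposable : Sign → AnyPerm → Set
Decomposable s a = HasCut s (val a) 0 (size a)

decomposable-resp : ∀ {s a b} → a ≃ b → Decomposable s b → Decomposable s a
decomposable-resp (refl , e) (c , X) = c , cut-cong e X

node-decomposable : ∀ s v → Decomposable s (node (two s) v)
node-decomposable s v = _ , two-cut s (node-decomposition (two s) v)

simple-node-indecomposable : ∀ {s} {ρ : Permutation′ (suc k)} {v} →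
  OrderSimple (suc k) (fn ρ) → 3 < suc k → ¬ Decomposable s (node ρ v)
simple-node-indecomposable {ρ = ρ} {v} = simple-uncut (node-decomposition ρ v)

module _ {s} {v v′ : Fin 2 → AnyPerm}
         (indec : ¬ Decomposable s (v zero)) (indec′ : ¬ Decomposable s (v′ zero))
         (e : node (two s) v ≃ node (two s) v′) where

  private
    φ : ℕ → ℕ
    φ = val (node (two s) v)

    first-uncut : ∀ (w : Fin 2 → AnyPerm) → ¬ Decomposable s (w zero) →
      (∀ {p} → p < size (w zero) → φ p ≡ val (node (two s) w) p) → ¬ HasCut s φ 0 (blocks w 1)
    first-uncut w ¬w f≡ (x , cut 0<x x< cross) = ¬w (x , cut 0<x x<size λ {p} {q} p∈ q∈ →
      before s (order (ℕ.<-trans (proj₂ p∈) x<size) (proj₂ q∈))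
        (order (proj₂ q∈) (ℕ.<-trans (proj₂ p∈) x<size))
        (cross p∈ (proj₁ q∈ , subst (q <_) (sym (ℕ.+-identityʳ _)) (proj₂ q∈))))
      where
      x<size : x < size (w zero)
      x<size = subst (x <_) (ℕ.+-identityʳ _) x<
      order : ∀ {p q} → p < size (w zero) → q < size (w zero) → φ p < φ q → val (w zero) p < val (w zero) q
      order p< q< lt = node-block-order⁻ (two s) w zero p< q< (subst₂ _<_ (f≡ p<) (f≡ q<) lt)
      before : ∀ s {a b a′ b′} → (a < b → a′ < b′) → (b < a → b′ < a′) → Before s a b → Before s a′ b′
      before ⊕ F G = F
      before ⊖ F G = G

    first-size : blocks v 1 ≡ blocks v′ 1
    first-size = cut-unique
      (two-cut s (node-decomposition (two s) v)) (first-uncut v indec λ _ → refl)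
      (two-cut s (node-decomposition′ (two s) (two s) e))
      (first-uncut v′ indec′ λ {p} p< → val≡ e {p}
        (subst (p <_) (cong suc (sym (deg≡ e))) (ℕ.<-≤-trans p< (ℕ.m≤m+n _ _))))

    all-sizes : ∀ {x} → x ≤ 2 → blocks v x ≡ blocks v′ x
    all-sizes {zero}        _ = refl
    all-sizes {suc zero}    _ = first-size
    all-sizes {suc (suc zero)} _ = trans (cuts-total (size ∘ v))
      (trans (cong suc (deg≡ e)) (sym (cuts-total (size ∘ v′))))
    all-sizes {suc (suc (suc _))} (s≤s (s≤s ()))

  -- An indecomposable first child fixes the inner cut by `cut-unique`, and the total size fixes the
  -- end.
  two-node-unique : ∀ i → v i ≃ v′ i
  two-node-unique = children-unique (two s) (two s) e all-sizes

-- Enumeration of H(5) and its generating function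

total : (A → Poly) → List A → Poly
total w = foldr (λ a f → w a +ₚ f) 0ₚ

total-++ : ∀ (w : A → Poly) xs ys → total w (xs ++ ys) ≗ₚ total w xs +ₚ total w ys
total-++ w []       ys = ≗-sym {0ₚ +ₚ total w ys} {total w ys} (+ₚ-identityˡ (total w ys))
total-++ w (x ∷ xs) ys = ≗-trans {w x +ₚ total w (xs ++ ys)} {w x +ₚ (total w xs +ₚ total w ys)}
  {w x +ₚ total w xs +ₚ total w ys}
  (+ₚ-cong (≗-refl {w x}) (total-++ w xs ys))
  (≗-sym {w x +ₚ total w xs +ₚ total w ys} (+ₚ-assoc (w x) (total w xs) (total w ys)))

module _ (f : A → C → E) (wA : A → Poly) (wC : C → Poly) (wE : E → Poly)
         (mult : ∀ a c → wE (f a c) ≗ₚ wA a ⊗ wC c) where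

  total-map : ∀ a cs → total wE (map (f a) cs) ≗ₚ wA a ⊗ total wC cs
  total-map a []       = ≗-sym {wA a ⊗ 0ₚ} {0ₚ} (zeroʳₚ (wA a))
  total-map a (c ∷ cs) = ≗-trans {wE (f a c) +ₚ total wE (map (f a) cs)}
    {(wA a ⊗ wC c) +ₚ (wA a ⊗ total wC cs)} {wA a ⊗ (wC c +ₚ total wC cs)}
    (+ₚ-cong (mult a c) (total-map a cs))
    (≗-sym {wA a ⊗ (wC c +ₚ total wC cs)} (distribˡₚ (wA a) (wC c) (total wC cs)))

  total-product : ∀ as cs → total wE (cartesianProductWith f as cs) ≗ₚ total wA as ⊗ total wC cs
  total-product []       cs = ≗-sym {0ₚ ⊗ total wC cs} {0ₚ} (zeroˡₚ (total wC cs))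
  total-product (a ∷ as) cs = begin
    total wE (map (f a) cs ++ cartesianProductWith f as cs)
      ≈⟨ total-++ wE (map (f a) cs) (cartesianProductWith f as cs) ⟩
    total wE (map (f a) cs) +ₚ total wE (cartesianProductWith f as cs)
      ≈⟨ +ₚ-cong (total-map a cs) (total-product as cs) ⟩
    (wA a ⊗ total wC cs) +ₚ (total wA as ⊗ total wC cs)
      ≈⟨ distribʳₚ (total wC cs) (wA a) (total wA as) ⟨
    total wA (a ∷ as) ⊗ total wC cs ∎
    where open ≗-Reasoning

gf : (A → Poly) → (ℕ → List A) → Series
gf w G n = total w (G n)

gf-++ : ∀ (w : A → Poly) G H → gf w (λ n → G n ++ H n) ≋ gf w G ⊞ gf w H
gf-++ w G H n = total-++ w (G n) (H n)

-- The counterpart on lists of multiplication by z.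
delay : (ℕ → List A) → ℕ → List A
delay G zero    = []
delay G (suc n) = G n

gf-delay : ∀ (w : A → Poly) G S → gf w G ≋ S → gf w (delay G) ≋ shift S
gf-delay w G S e zero    = ≗-refl {0ₚ}
gf-delay w G S e (suc n) = e n

convolve : (A → C → E) → (ℕ → List A) → (ℕ → List C) → ℕ → List E
convolve f G H zero    = cartesianProductWith f (G 0) (H 0)
convolve f G H (suc n) = cartesianProductWith f (G 0) (H (suc n)) ++ convolve f (G ∘ suc) H n

module _ (f : A → C → E) (wA : A → Poly) (wC : C → Poly) (wE : E → Poly)
         (mult : ∀ a c → wE (f a c) ≗ₚ wA a ⊗ wC c) where

  gf-convolve : ∀ G H → gf wE (convolve f G H) ≋ gf wA G ⊠ gf wC H
  gf-convolve G H zero    = total-product f wA wC wE mult (G 0) (H 0)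
  gf-convolve G H (suc n) =
    ≗-trans {total wE (xs ++ ys)} {total wE xs +ₚ total wE ys} {(gf wA G ⊠ gf wC H) (suc n)}
      (total-++ wE xs ys)
      (+ₚ-cong {total wE xs} {total wA (G 0) ⊗ total wC (H (suc n))}
               {total wE ys} {(gf wA (G ∘ suc) ⊠ gf wC H) n}
        (total-product f wA wC wE mult (G 0) (H (suc n)))
        (gf-convolve (G ∘ suc) H n))
    where
    xs ys : List _
    xs = cartesianProductWith f (G 0) (H (suc n))
    ys = convolve f (G ∘ suc) H n

desIdes : Permutation′ k → Poly
desIdes σ = mono (des σ) (ides σ)

weight : AnyPerm → Poly
weight a = desIdes (perm a)

tupleWeight : (Fin k → AnyPerm) → Poly
tupleWeight v = mono (sumℕ λ i → des (perm (v i))) (sumℕ λ i → ides (perm (v i)))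

weight-node : ∀ (ρ : Permutation′ (suc k)) v → weight (node ρ v) ≗ₚ desIdes ρ ⊗ tupleWeight v
weight-node ρ v a b = trans
  (cong₂ (λ i j → mono i j a b)
    (des-inflation (node-isInflation ρ v)) (ides-inflation (node-isInflation ρ v)))
  (sym (mono-⊗ (des ρ) (ides ρ) _ _ a b))

weight-cons : ∀ a (v : Fin k → AnyPerm) → tupleWeight (a Vector.∷ v) ≗ₚ weight a ⊗ tupleWeight v
weight-cons a v i j = sym (mono-⊗ (des (perm a)) (ides (perm a)) _ _ i j)

pair : AnyPerm → AnyPerm → Fin 2 → AnyPerm
pair a b = a Vector.∷ b Vector.∷ Vector.[]

weight-pair : ∀ a b → tupleWeight (pair a b) ≗ₚ weight a ⊗ weight b
weight-pair a b i j = trans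
  (cong₂ (λ x y → mono (des (perm a) + x) (ides (perm a) + y) i j) (ℕ.+-identityʳ _) (ℕ.+-identityʳ _))
  (sym (mono-⊗ (des (perm a)) (ides (perm a)) _ _ i j))

table : (to from : Vec (Fin k) k) →
        {True (Fin.all? λ i → lookup to (lookup from i) Fin.≟ i)} →
        {True (Fin.all? λ i → lookup from (lookup to i) Fin.≟ i)} → Permutation′ k
table to from {p} {q} = permutation (lookup to) (lookup from) (toWitness p) (toWitness q)

opaque
  -- In 1-based one-line notation 2413 and 3142. That no simple permutation is missing is checked by
  -- `classify₄`, and by `classify₅` for the next list.
  simple₄ : List (Permutation′ 4)
  simple₄ = table (1F ∷ 3F ∷ 0F ∷ 2F ∷ []) (2F ∷ 0F ∷ 3F ∷ 1F ∷ [])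
          ∷ table (2F ∷ 0F ∷ 3F ∷ 1F ∷ []) (1F ∷ 3F ∷ 0F ∷ 2F ∷ [])
          ∷ []

  -- 24153, 25314, 31524, 35142, 41352 and 42513.
  simple₅ : List (Permutation′ 5)
  simple₅ = table (1F ∷ 3F ∷ 0F ∷ 4F ∷ 2F ∷ []) (2F ∷ 0F ∷ 4F ∷ 1F ∷ 3F ∷ [])
          ∷ table (1F ∷ 4F ∷ 2F ∷ 0F ∷ 3F ∷ []) (3F ∷ 0F ∷ 2F ∷ 4F ∷ 1F ∷ [])
          ∷ table (2F ∷ 0F ∷ 4F ∷ 1F ∷ 3F ∷ []) (1F ∷ 3F ∷ 0F ∷ 4F ∷ 2F ∷ [])
          ∷ table (2F ∷ 4F ∷ 0F ∷ 3F ∷ 1F ∷ []) (2F ∷ 4F ∷ 0F ∷ 3F ∷ 1F ∷ [])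
          ∷ table (3F ∷ 0F ∷ 2F ∷ 4F ∷ 1F ∷ []) (1F ∷ 4F ∷ 2F ∷ 0F ∷ 3F ∷ [])
          ∷ table (3F ∷ 1F ∷ 4F ∷ 0F ∷ 2F ∷ []) (3F ∷ 1F ∷ 4F ∷ 0F ∷ 2F ∷ [])
          ∷ []

data Root : Set where
  prime : Root
  split : Sign → Root

tuples : (ℕ → List AnyPerm) → ∀ k → ℕ → List (Fin k → AnyPerm)
tuples G zero    zero    = [ Vector.[] ]
tuples G zero    (suc n) = []
tuples G (suc k) n       = convolve Vector._∷_ G (tuples G k) n

point : ℕ → List AnyPerm
point zero    = [ 0 , idₚ ]
point (suc n) = []

-- The members of H(5) of size n + 1 that have a decomposition tree of height
-- less than g, by the root; the first child of a root ⊕ (⊖) has another root.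
family : ℕ → Root → ℕ → List AnyPerm
every  : ℕ → ℕ → List AnyPerm
firsts : ℕ → Sign → ℕ → List AnyPerm

family zero    _         n = []
family (suc g) prime     n = point n
  ++ (delay (delay (delay λ n → cartesianProductWith node simple₄ (tuples (every g) 4 n))) n
  ++ delay (delay (delay (delay λ n → cartesianProductWith node simple₅ (tuples (every g) 5 n)))) n)
family (suc g) (split s) n =
  delay (λ n → cartesianProductWith node [ two s ] (convolve pair (firsts g s) (every g) n)) n

every g n    = family g prime n ++ (family g (split ⊕) n ++ family g (split ⊖) n)
firsts g s n = family g prime n ++ family g (split (opposite s)) n

-- Gamma-positivity of the generating functions

GP-degree : ∀ {d e f} → d ≡ e → GP d f → GP e f
GP-degree refl P = P

-- The number e is the excess of the darga over the exponent of z. A factor z lowers it by 1, the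
-- factors u, v and w raise it by 2, 1 and 1, and every term of the equation for F balances to 0.
Homogeneous : ℕ → Series → Set
Homogeneous e S = ∀ n → GP (e + n) (S n)

homogeneous-cong : ∀ {e S T} → S ≋ T → Homogeneous e T → Homogeneous e S
homogeneous-cong p P n = GP-cong (p n) (P n)

homogeneous-⊞ : ∀ {e S T} → Homogeneous e S → Homogeneous e T → Homogeneous e (S ⊞ T)
homogeneous-⊞ P Q n = GP-+ (P n) (Q n)

homogeneous-⊠ : ∀ {e S T} → Homogeneous e S → Homogeneous 0 T → Homogeneous e (S ⊠ T)
homogeneous-⊠ {e} P Q zero    = GP-degree (ℕ.+-identityʳ (e + 0)) (GP-⊗ (P 0) (Q 0))
homogeneous-⊠ {e} P Q (suc n) = GP-+
  (GP-degree (cong (_+ suc n) (ℕ.+-identityʳ e)) (GP-⊗ (P 0) (Q (suc n))))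
  (GP-degree (sym (ℕ.+-suc e n))
    (homogeneous-⊠ (λ i → GP-degree (ℕ.+-suc e i) (P (suc i))) Q n))

homogeneous-· : ∀ {e c S} → GP e c → Homogeneous 0 S → Homogeneous e (c · S)
homogeneous-· P Q n = GP-⊗ P (Q n)

homogeneous-shift : ∀ {e S} → Homogeneous (suc e) S → Homogeneous e (shift S)
homogeneous-shift     P zero    = none (≗-refl {0ₚ})
homogeneous-shift {e} P (suc n) = GP-degree (sym (ℕ.+-suc e n)) (P n)

homogeneous-𝟘 : ∀ {e} → Homogeneous e 𝟘
homogeneous-𝟘 n = none (≗-refl {0ₚ})

opaque
  unfolding simple₄ simple₅

  -- 2413 has one descent and its inverse 3142 has two, so the weights st² and s²t are symmetric
  -- only together.
  GP-simple₄ : GP 3 (total desIdes simple₄)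
  GP-simple₄ = GP-cong (begin
    mono 1 2 +ₚ (mono 2 1 +ₚ 0ₚ)     ≈⟨ +ₚ-cong (≗-refl {mono 1 2}) (+ₚ-identityʳ (mono 2 1)) ⟩
    mono 1 2 +ₚ mono 2 1             ≈⟨ +ₚ-comm (mono 1 2) (mono 2 1) ⟩
    mono 2 1 +ₚ mono 1 2             ≈⟨ +ₚ-cong (mono-⊗ 1 1 1 0) (mono-⊗ 1 1 0 1) ⟨
    (u ⊗ s) +ₚ (u ⊗ t)               ≈⟨ distribˡₚ u s t ⟨
    u ⊗ v                            ∎)
    (GP-⊗ GP-u GP-v)
    where open ≗-Reasoning

  -- Each of the six has two descents, and so has its inverse.
  GP-simple₅ : GP 4 (total desIdes simple₅)
  GP-simple₅ = GP-+ u² (GP-+ u² (GP-+ u² (GP-+ u² (GP-+ u² (GP-+ u² (none (≗-refl {0ₚ})))))))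
    where
    u² : GP 4 (mono 2 2)
    u² = GP-cong (≗-sym {u ⊗ u} {mono 2 2} (mono-⊗ 1 1 1 1)) (GP-⊗ GP-u GP-u)

tuples-homogeneous : ∀ {G} → Homogeneous 0 (gf weight G) → ∀ k → Homogeneous 0 (gf tupleWeight (tuples G k))
tuples-homogeneous P zero    zero    = GP-cong (+ₚ-identityʳ 1ₚ) GP-1
tuples-homogeneous P zero    (suc n) = none (≗-refl {0ₚ})
tuples-homogeneous {G} P (suc k) = homogeneous-cong
  (gf-convolve Vector._∷_ weight tupleWeight tupleWeight weight-cons G (tuples G k))
  (homogeneous-⊠ P (tuples-homogeneous P k))

nodes-gf : ∀ (ρs : List (Permutation′ (suc k))) V S → gf tupleWeight V ≋ S →
  gf weight (λ n → cartesianProductWith node ρs (V n)) ≋ total desIdes ρs · S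
nodes-gf ρs V S e n = begin
  total weight (cartesianProductWith node ρs (V n))
    ≈⟨ total-product node desIdes tupleWeight weight weight-node ρs (V n) ⟩
  total desIdes ρs ⊗ total tupleWeight (V n)
    ≈⟨ ⊗-cong (≗-refl {total desIdes ρs}) (e n) ⟩
  total desIdes ρs ⊗ S n ∎
  where open ≗-Reasoning

ε : Sign → Poly
ε s = desIdes (two s)

prime-gf every-gf : ℕ → Series
split-gf : ℕ → Sign → Series
prime-gf g   = gf weight (family g prime)
split-gf g s = gf weight (family g (split s))
every-gf g   = gf weight (every g)

every-gf≋ : ∀ g → every-gf g ≋ prime-gf g ⊞ (split-gf g ⊕ ⊞ split-gf g ⊖)
every-gf≋ g n = ≗-trans
  {every-gf g n} {prime-gf g n +ₚ total weight (family g (split ⊕) n ++ family g (split ⊖) n)}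
  {prime-gf g n +ₚ (split-gf g ⊕ n +ₚ split-gf g ⊖ n)}
  (total-++ weight (family g prime n) _)
  (+ₚ-cong (≗-refl {prime-gf g n}) (total-++ weight (family g (split ⊕) n) _))

split-gf≋ : ∀ g s → split-gf (suc g) s ≋
  ε s · shift ((prime-gf g ⊞ split-gf g (opposite s)) ⊠ every-gf g)
split-gf≋ g s n = begin
  split-gf (suc g) s n
    ≈⟨ gf-delay weight _ ((ε s +ₚ 0ₚ) · (I ⊠ every-gf g))
         (nodes-gf [ two s ] (convolve pair (firsts g s) (every g)) (I ⊠ every-gf g) pairs-gf) n ⟩
  shift ((ε s +ₚ 0ₚ) · (I ⊠ every-gf g)) n
    ≈⟨ Z.shift-· (ε s +ₚ 0ₚ) (I ⊠ every-gf g) n ⟩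
  (ε s +ₚ 0ₚ) ⊗ shift (I ⊠ every-gf g) n
    ≈⟨ ⊗-cong (+ₚ-identityʳ (ε s)) (≗-refl {shift (I ⊠ every-gf g) n}) ⟩
  ε s ⊗ shift (I ⊠ every-gf g) n ∎
  where
  open ≗-Reasoning
  I : Series
  I = prime-gf g ⊞ split-gf g (opposite s)
  pairs-gf : gf tupleWeight (convolve pair (firsts g s) (every g)) ≋ I ⊠ every-gf g
  pairs-gf n = ≗-trans
    {total tupleWeight (convolve pair (firsts g s) (every g) n)}
    {(gf weight (firsts g s) ⊠ every-gf g) n} {(I ⊠ every-gf g) n}
    (gf-convolve pair weight weight tupleWeight weight-pair (firsts g s) (every g) n)
    (Z.⊠-cong {gf weight (firsts g s)} {I} {every-gf g} {every-gf g}
      (gf-++ weight (family g prime) (family g (split (opposite s))))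
      (λ m → ≗-refl {every-gf g m}) n)

module Zs = CommutativeSemiring Z.semiring
module ≋-Reasoning where
  open import Relation.Binary.Reasoning.Setoid Zs.setoid public

-- Nothing of the kind holds for `split-gf` with one sign: in degree 1 it can be 1 or u, neither
-- palindromic. The induction therefore descends two levels at once, which makes level 1 a base case
-- of its own; that level has no splits.
every-homogeneous : ∀ g → Homogeneous 0 (every-gf g)
prime-homogeneous : ∀ g → Homogeneous 0 (prime-gf g)

prime-homogeneous zero    = homogeneous-𝟘
prime-homogeneous (suc g) = homogeneous-cong
  (gf-++ weight point (λ n → delay (delay (delay N₄)) n ++ delay (delay (delay (delay N₅))) n))
  (homogeneous-⊞ point-homogeneous (homogeneous-cong
    (gf-++ weight (delay (delay (delay N₄))) (delay (delay (delay (delay N₅)))))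
    (homogeneous-⊞
      (homogeneous-delay (homogeneous-delay (homogeneous-delay (nodes simple₄ GP-simple₄))))
      (homogeneous-delay (homogeneous-delay (homogeneous-delay (homogeneous-delay
        (nodes simple₅ GP-simple₅))))))))
  where
  N₄ N₅ : ℕ → List AnyPerm
  N₄ n = cartesianProductWith node simple₄ (tuples (every g) 4 n)
  N₅ n = cartesianProductWith node simple₅ (tuples (every g) 5 n)
  point-homogeneous : Homogeneous 0 (gf weight point)
  point-homogeneous zero    = GP-cong (+ₚ-identityʳ 1ₚ) GP-1
  point-homogeneous (suc n) = none (≗-refl {0ₚ})
  homogeneous-delay : ∀ {e G} → Homogeneous (suc e) (gf weight G) → Homogeneous e (gf weight (delay G))
  homogeneous-delay {G = G} P = homogeneous-cong
    (gf-delay weight G (gf weight G) (λ n → ≗-refl {gf weight G n})) (homogeneous-shift P)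
  nodes : ∀ {e} (ρs : List (Permutation′ (suc k))) → GP e (total desIdes ρs) →
    Homogeneous e (gf weight (λ n → cartesianProductWith node ρs (tuples (every g) (suc k) n)))
  nodes {k} ρs P = homogeneous-cong
    (nodes-gf ρs (tuples (every g) (suc k)) (gf tupleWeight (tuples (every g) (suc k)))
      (λ n → ≗-refl {gf tupleWeight (tuples (every g) (suc k)) n}))
    (homogeneous-· P (tuples-homogeneous {every g} (every-homogeneous g) (suc k)))

every-homogeneous zero          = homogeneous-𝟘
every-homogeneous (suc zero)    = homogeneous-cong (every-gf≋ 1)
  (homogeneous-⊞ (prime-homogeneous 1) (homogeneous-⊞ (none-split ⊕) (none-split ⊖)))
  where
  none-split : ∀ s → Homogeneous 0 (split-gf 1 s)
  none-split s = homogeneous-cong {T = 𝟘} (begin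
    split-gf 1 s                                   ≈⟨ split-gf≋ 0 s ⟩
    ε s · shift ((𝟘 ⊞ 𝟘) ⊠ 𝟘)                      ≈⟨ Z.·-cong {ε s} (Z.shift-cong {(𝟘 ⊞ 𝟘) ⊠ 𝟘} {𝟘} (Zs.zeroʳ (𝟘 ⊞ 𝟘))) ⟩
    ε s · shift 𝟘                                  ≈⟨ (λ { zero → zeroʳₚ (ε s) ; (suc n) → zeroʳₚ (ε s) }) ⟩
    𝟘                                              ∎) homogeneous-𝟘
    where open ≋-Reasoning
every-homogeneous (suc (suc g)) = homogeneous-cong functional-equation
  (homogeneous-⊞ (prime-homogeneous (suc (suc g))) (homogeneous-⊞
    (homogeneous-cong (λ n a b → sym (Z.shift-· (α +ₚ β) (X₁ ⊠ F₁) n a b))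
      (homogeneous-shift (homogeneous-· GP-w
        (homogeneous-⊠ (prime-homogeneous (suc g)) (every-homogeneous (suc g))))))
    (homogeneous-cong twice
      (homogeneous-shift (homogeneous-shift (homogeneous-· (GP-⊗ GP-1 GP-u)
        (homogeneous-⊠
          (homogeneous-⊠ (homogeneous-⊞ (prime-homogeneous g) (every-homogeneous g)) (every-homogeneous g))
          (every-homogeneous (suc g)))))))))
  where
  open ≋-Reasoning
  α β : Poly
  α = ε ⊕
  β = ε ⊖
  X₀ X₁ F₀ F₁ S⊕ S⊖ P Q R : Series
  X₀ = prime-gf g
  X₁ = prime-gf (suc g)
  F₀ = every-gf g
  F₁ = every-gf (suc g)
  S⊕ = split-gf g ⊕
  S⊖ = split-gf g ⊖
  P = (X₀ ⊞ S⊕) ⊠ F₀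
  Q = (X₀ ⊞ S⊖) ⊠ F₀
  R = (X₀ ⊞ F₀) ⊠ F₀ ⊠ F₁
  twice : (α ⊗ β) · shift (shift R) ≋ shift (shift ((α ⊗ β) · R))
  twice = begin
    (α ⊗ β) · shift (shift R)       ≈⟨ Z.shift-· (α ⊗ β) (shift R) ⟨
    shift ((α ⊗ β) · shift R)       ≈⟨ Z.shift-cong (Z.shift-· (α ⊗ β) R) ⟨
    shift (shift ((α ⊗ β) · R))     ∎
  -- A prime first child is allowed under either sign, so X₀ is counted twice; one copy completes S⊕
  -- ⊞ S⊖ to F₀.
  P⊞Q : P ⊞ Q ≋ (X₀ ⊞ F₀) ⊠ F₀
  P⊞Q = begin
    P ⊞ Q                                    ≈⟨ Z.distribʳ F₀ (X₀ ⊞ S⊕) (X₀ ⊞ S⊖) ⟨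
    ((X₀ ⊞ S⊕) ⊞ (X₀ ⊞ S⊖)) ⊠ F₀             ≈⟨ Z.⊠-cong (begin
      (X₀ ⊞ S⊕) ⊞ (X₀ ⊞ S⊖)                    ≈⟨ interchange X₀ S⊕ X₀ S⊖ ⟩
      (X₀ ⊞ X₀) ⊞ (S⊕ ⊞ S⊖)                    ≈⟨ Zs.+-assoc X₀ X₀ (S⊕ ⊞ S⊖) ⟩
      X₀ ⊞ (X₀ ⊞ (S⊕ ⊞ S⊖))                    ≈⟨ Z.⊞-cong (Zs.refl {X₀}) (every-gf≋ g) ⟨
      X₀ ⊞ F₀                                  ∎) (Zs.refl {F₀}) ⟩
    (X₀ ⊞ F₀) ⊠ F₀                           ∎
    where open CommutativeSemigroupProperties Zs.+-commutativeSemigroup using (interchange)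
  unfold : ∀ s T → split-gf (suc g) (opposite s) ≋ ε (opposite s) · shift T →
           split-gf (2 + g) s ≋ ε s · shift ((X₁ ⊞ ε (opposite s) · shift T) ⊠ F₁)
  unfold s T e = begin
    split-gf (2 + g) s
      ≈⟨ split-gf≋ (suc g) s ⟩
    ε s · shift ((X₁ ⊞ split-gf (suc g) (opposite s)) ⊠ F₁)
      ≈⟨ Z.·-cong {ε s} (Z.shift-cong (Z.⊠-cong (Z.⊞-cong (Zs.refl {X₁}) e) (Zs.refl {F₁}))) ⟩
    ε s · shift ((X₁ ⊞ ε (opposite s) · shift T) ⊠ F₁) ∎
  functional-equation : every-gf (2 + g) ≋ prime-gf (2 + g) ⊞
    ((α +ₚ β) · shift (X₁ ⊠ F₁) ⊞ (α ⊗ β) · shift (shift R))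
  functional-equation = begin
    every-gf (2 + g)
      ≈⟨ every-gf≋ (2 + g) ⟩
    prime-gf (2 + g) ⊞ (split-gf (2 + g) ⊕ ⊞ split-gf (2 + g) ⊖)
      ≈⟨ Z.⊞-cong (Zs.refl {prime-gf (2 + g)}) (begin
        split-gf (2 + g) ⊕ ⊞ split-gf (2 + g) ⊖
          ≈⟨ Z.⊞-cong (unfold ⊕ P (split-gf≋ g ⊖)) (unfold ⊖ Q (split-gf≋ g ⊕)) ⟩
        α · shift ((X₁ ⊞ β · shift P) ⊠ F₁) ⊞ β · shift ((X₁ ⊞ α · shift Q) ⊠ F₁)
          ≈⟨ Z.alternate-⊞ α β X₁ P Q F₁ ⟩
        (α +ₚ β) · shift (X₁ ⊠ F₁) ⊞ (α ⊗ β) · shift (shift ((P ⊞ Q) ⊠ F₁))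
          ≈⟨ Z.⊞-cong (Zs.refl {(α +ₚ β) · shift (X₁ ⊠ F₁)})
               (Z.·-cong {α ⊗ β} (Z.shift-cong (Z.shift-cong (Z.⊠-cong P⊞Q (Zs.refl {F₁}))))) ⟩
        (α +ₚ β) · shift (X₁ ⊠ F₁) ⊞ (α ⊗ β) · shift (shift R) ∎) ⟩
    prime-gf (2 + g) ⊞ ((α +ₚ β) · shift (X₁ ⊠ F₁) ⊞ (α ⊗ β) · shift (shift R)) ∎

-- The enumeration is sound and without repetition

Distinct : (A → A → Set) → List A → Set
Distinct R = AllPairs (λ a b → ¬ R a b)

private
  distinct-map : ∀ {R : A → A → Set} {S : C → C → Set} (f : A → C) {xs} →
    (∀ {x y} → x ∈ xs → y ∈ xs → S (f x) (f y) → R x y) → Distinct R xs → Distinct S (map f xs)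
  distinct-map f inj []       = []
  distinct-map f inj (p ∷ ps) =
    All.map⁺ (All.tabulate λ y∈ s → All.lookup p y∈ (inj (here refl) (there y∈) s)) ∷
    distinct-map f (λ x∈ y∈ → inj (there x∈) (there y∈)) ps

module _ {R : A → A → Set} {S : C → C → Set} {T : E → E → Set} (f : A → C → E) where

  distinct-product : ∀ {xs ys} →
    (∀ {x x′ y y′} → x ∈ xs → x′ ∈ xs → y ∈ ys → y′ ∈ ys → T (f x y) (f x′ y′) → R x x′ × S y y′) →
    Distinct R xs → Distinct S ys → Distinct T (cartesianProductWith f xs ys)
  distinct-product          inj []       qs = []
  distinct-product {x ∷ xs} {ys} inj (p ∷ ps) qs = AllPairs.++⁺
    (distinct-map (f x) (λ y∈ y′∈ t → proj₂ (inj (here refl) (here refl) y∈ y′∈ t)) qs)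
    (distinct-product (λ x∈ x′∈ → inj (there x∈) (there x′∈)) ps qs)
    (All.map⁺ (All.tabulate λ y∈ → All.tabulate λ e∈ t → absurd y∈ (∈-cartesianProductWith⁻ f xs ys e∈) t))
    where
    absurd : ∀ {y e} → y ∈ ys → (∃₂ λ a b → a ∈ xs × b ∈ ys × e ≡ f a b) → ¬ T (f x y) e
    absurd y∈ (x′ , y′ , x′∈ , y′∈ , refl) t =
      All.lookup p x′∈ (proj₁ (inj (here refl) (there x′∈) y∈ y′∈ t))

∈-convolve⁻ : ∀ (f : A → C → E) G H n {e} → e ∈ convolve f G H n →
  ∃₂ λ i j → ∃₂ λ a c → i + j ≡ n × a ∈ G i × c ∈ H j × e ≡ f a c
∈-convolve⁻ f G H zero e∈ =
  let a , c , a∈ , c∈ , eq = ∈-cartesianProductWith⁻ f (G 0) (H 0) e∈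
  in 0 , 0 , a , c , refl , a∈ , c∈ , eq
∈-convolve⁻ f G H (suc n) e∈ with ∈-++⁻ (cartesianProductWith f (G 0) (H (suc n))) e∈
... | inj₁ e∈₁ =
  let a , c , a∈ , c∈ , eq = ∈-cartesianProductWith⁻ f (G 0) (H (suc n)) e∈₁
  in 0 , suc n , a , c , refl , a∈ , c∈ , eq
... | inj₂ e∈₂ =
  let i , j , a , c , i+j≡n , r = ∈-convolve⁻ f (G ∘ suc) H n e∈₂
  in suc i , j , a , c , cong suc i+j≡n , r

∈-convolve⁺ : ∀ (f : A → C → E) G H i j {a c} → a ∈ G i → c ∈ H j → f a c ∈ convolve f G H (i + j)
∈-convolve⁺ f G H zero    zero    a∈ c∈ = ∈-cartesianProductWith⁺ f a∈ c∈
∈-convolve⁺ f G H zero    (suc j) a∈ c∈ = ∈-++⁺ˡ (∈-cartesianProductWith⁺ f a∈ c∈)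
∈-convolve⁺ f G H (suc i) j       a∈ c∈ =
  ∈-++⁺ʳ (cartesianProductWith f (G 0) (H (suc (i + j)))) (∈-convolve⁺ f (G ∘ suc) H i j a∈ c∈)

module _ {R : A → A → Set} {S : C → C → Set} {T : E → E → Set} (f : A → C → E) where

  -- Terms from different splittings i + j = n are told apart by the grading of the first factor
  -- alone.
  distinct-convolve : ∀ G H →
    (∀ {i i′ a a′} → a ∈ G i → a′ ∈ G i′ → R a a′ → i ≡ i′) →
    (∀ {a a′ c c′} → T (f a c) (f a′ c′) → R a a′ × S c c′) →
    (∀ i → Distinct R (G i)) → (∀ j → Distinct S (H j)) → ∀ n → Distinct T (convolve f G H n)
  distinct-convolve G H graded inj P Q zero    = distinct-product f (λ _ _ _ _ → inj) (P 0) (Q 0)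
  distinct-convolve G H graded inj P Q (suc n) = AllPairs.++⁺
    (distinct-product f (λ _ _ _ _ → inj) (P 0) (Q (suc n)))
    (distinct-convolve (G ∘ suc) H (λ a∈ a′∈ r → ℕ.suc-injective (graded a∈ a′∈ r)) inj (P ∘ suc) Q n)
    (All.tabulate λ x∈ → All.tabulate λ y∈ →
      absurd (∈-cartesianProductWith⁻ f (G 0) (H (suc n)) x∈) (∈-convolve⁻ f (G ∘ suc) H n y∈))
    where
    absurd : ∀ {x y} → (∃₂ λ a b → a ∈ G 0 × b ∈ H (suc n) × x ≡ f a b) →
      (∃₂ λ i j → ∃₂ λ a c → i + j ≡ n × a ∈ G (suc i) × c ∈ H j × y ≡ f a c) → ¬ T x y
    absurd (a , c , a∈ , c∈ , refl) (i , j , a′ , c′ , _ , a′∈ , c′∈ , refl) t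
      with () ← graded a∈ a′∈ (proj₁ (inj t))

∈-delay⁻ : ∀ (G : ℕ → List A) n {a} → a ∈ delay G n → ∃ λ m → suc m ≡ n × a ∈ G m
∈-delay⁻ G (suc n) a∈ = n , refl , a∈

distinct-delay : ∀ {R : A → A → Set} {G} → (∀ n → Distinct R (G n)) → ∀ n → Distinct R (delay G n)
distinct-delay P zero    = []
distinct-delay P (suc n) = P n

Graded : (ℕ → List AnyPerm) → Set
Graded G = ∀ {n a} → a ∈ G n → deg a ≡ n

∈-tuples⁻ : ∀ {G} → Graded G → ∀ k n {v} → v ∈ tuples G k n →
            sumℕ (deg ∘ v) ≡ n × (∀ i → ∃ λ m → v i ∈ G m)
∈-tuples⁻ gr zero    zero    (here refl) = refl , λ ()
∈-tuples⁻ {G} gr (suc k) n v∈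
  with i , j , a , v , i+j≡n , a∈ , v∈′ , refl ← ∈-convolve⁻ Vector._∷_ G (tuples G k) n v∈ =
  let sum≡ , rest = ∈-tuples⁻ gr k j v∈′
  in trans (cong₂ _+_ (gr a∈) sum≡) i+j≡n , λ { zero → i , a∈ ; (suc l) → rest l }

-- Finite choice: elements found separately for each index are collected into one listed tuple,
-- together with what is known of them.
∈-tuples⁺ : ∀ {G} k {Q : Fin k → AnyPerm → Set} → (∀ i → ∃ λ a → a ∈ G (deg a) × Q i a) →
            ∃ λ v → v ∈ tuples G k (sumℕ (deg ∘ v)) × (∀ i → Q i (v i))
∈-tuples⁺ zero    choice = Vector.[] , here refl , λ ()
∈-tuples⁺ {G} (suc k) choice =
  let a , a∈ , qa = choice zero
      v , v∈ , qv = ∈-tuples⁺ k (choice ∘ suc)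
  in a Vector.∷ v
   , ∈-convolve⁺ Vector._∷_ G (tuples G k) (deg a) _ a∈ v∈
   , λ { zero → qa ; (suc i) → qv i }

infix 4 _≃ᵥ_

_≃ᵥ_ : (Fin k → AnyPerm) → (Fin k → AnyPerm) → Set
v ≃ᵥ w = ∀ i → v i ≃ w i

distinct-tuples : ∀ {G} → Graded G → (∀ n → Distinct _≃_ (G n)) → ∀ k n → Distinct _≃ᵥ_ (tuples G k n)
distinct-tuples gr P zero    zero    = [] ∷ []
distinct-tuples gr P zero    (suc n) = []
distinct-tuples {G} gr P (suc k) n   = distinct-convolve Vector._∷_ G (tuples G k)
  (λ a∈ a′∈ e → trans (sym (gr a∈)) (trans (_≃_.deg≡ e) (gr a′∈)))
  (λ e → e zero , e ∘ suc)
  P (distinct-tuples gr P k) n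

deg-node : ∀ (ρ : Permutation′ (suc k)) v → deg (node ρ v) ≡ k + sumℕ (deg ∘ v)
deg-node {k} ρ v = ℕ.suc-injective (trans (sumℕ-+ {suc k} (λ _ → 1) (deg ∘ v))
  (cong (_+ sumℕ (deg ∘ v)) (ones (suc k))))
  where
  ones : ∀ k → sumℕ {k} (λ _ → 1) ≡ k
  ones zero    = refl
  ones (suc k) = cong suc (ones k)

SeparatedF : Permutation′ n → ℕ → ℕ → Set
SeparatedF {n} ρ x y = ∃ λ (p : Fin n) → toℕ p ∉⟦ x , y ⟩
  × (∃ λ (a : Fin n) → toℕ a ∈⟦ x , y ⟩ × ρ ⟨$⟩ʳ a Fin.< ρ ⟨$⟩ʳ p)
  × (∃ λ (b : Fin n) → toℕ b ∈⟦ x , y ⟩ × ρ ⟨$⟩ʳ p Fin.< ρ ⟨$⟩ʳ b)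

-- `OrderSimple` over `Fin`, where every quantifier can be searched.
OrderSimpleF : Permutation′ n → Set
OrderSimpleF {n} ρ = ∀ (y x : Fin (suc n)) → 2 + toℕ x ≤ toℕ y →
  ¬ (toℕ x ≡ 0 × toℕ y ≡ n) → SeparatedF ρ (toℕ x) (toℕ y)

orderSimpleF? : (ρ : Permutation′ n) → Dec (OrderSimpleF ρ)
orderSimpleF? {n} ρ = Fin.all? λ y → Fin.all? λ x →
  (2 + toℕ x ℕ.≤? toℕ y) →-dec (¬? ((toℕ x ℕ.≟ 0) ×-dec (toℕ y ℕ.≟ n)) →-dec
    Fin.any? λ p → (out? p x y) ×-dec (Fin.any? (λ a → in? a x y ×-dec (ρ ⟨$⟩ʳ a) Fin.<? (ρ ⟨$⟩ʳ p))
      ×-dec Fin.any? (λ b → in? b x y ×-dec (ρ ⟨$⟩ʳ p) Fin.<? (ρ ⟨$⟩ʳ b))))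
  where
  in? : ∀ (a : Fin n) (x y : Fin (suc n)) → Dec (toℕ a ∈⟦ toℕ x , toℕ y ⟩)
  in? a x y = (toℕ x ℕ.≤? toℕ a) ×-dec (toℕ a ℕ.<? toℕ y)
  out? : ∀ (a : Fin n) (x y : Fin (suc n)) → Dec (toℕ a ∉⟦ toℕ x , toℕ y ⟩)
  out? a x y = (toℕ a ℕ.<? toℕ x) ⊎-dec (toℕ y ℕ.≤? toℕ a)

orderSimple : ∀ {ρ : Permutation′ n} → OrderSimpleF ρ → OrderSimple n (fn ρ)
orderSimple {n} {ρ} S 2+x≤y y≤n nw
  with below (s≤s y≤n) | below (s≤s (ℕ.≤-trans (ℕ.≤-trans (ℕ.m≤n+m _ 2) 2+x≤y) y≤n))
... | at y | at x with p , p∉ , (a , a∈ , a<p) , (b , b∈ , p<b) ← S y x 2+x≤y nw =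
  separated (z≤n , Fin.toℕ<n p) p∉ a∈ b∈
    (subst₂ _<_ (sym (fn-toℕ ρ a)) (sym (fn-toℕ ρ p)) a<p)
    (subst₂ _<_ (sym (fn-toℕ ρ p)) (sym (fn-toℕ ρ b)) p<b)

≈? : (ρ τ : Permutation′ n) → Dec (ρ ≈ τ)
≈? ρ τ = Fin.all? λ i → (ρ ⟨$⟩ʳ i) Fin.≟ (τ ⟨$⟩ʳ i)

opaque
  unfolding simple₄ simple₅

  simple₄-simple : ∀ {ρ} → ρ ∈ simple₄ → OrderSimple 4 (fn ρ)
  simple₄-simple ρ∈ = orderSimple (All.lookup (from-yes (All.all? orderSimpleF? simple₄)) ρ∈)

  simple₅-simple : ∀ {ρ} → ρ ∈ simple₅ → OrderSimple 5 (fn ρ)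
  simple₅-simple ρ∈ = orderSimple (All.lookup (from-yes (All.all? orderSimpleF? simple₅)) ρ∈)

  simple₄-distinct : Distinct _≈_ simple₄
  simple₄-distinct = from-yes (AllPairs.allPairs? (λ ρ τ → ¬? (≈? ρ τ)) simple₄)

  simple₅-distinct : Distinct _≈_ simple₅
  simple₅-distinct = from-yes (AllPairs.allPairs? (λ ρ τ → ¬? (≈? ρ τ)) simple₅)

-- A view of `family` that hides the list operations and covers the arities 4 and 5 by one
-- constructor.
data Member (g : ℕ) : Root → ℕ → AnyPerm → Set where
  is-point  : Member g prime 0 (0 , idₚ)
  is-simple : (ρ : Permutation′ (suc k)) → 3 < suc k → suc k ≤ 5 → OrderSimple (suc k) (fn ρ) →
              ∀ {m v} → v ∈ tuples (every g) (suc k) m → Member g prime (k + m) (node ρ v)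
  is-split  : ∀ s {i j a b} → a ∈ firsts g s i → b ∈ every g j →
              Member g (split s) (suc (i + j)) (node (two s) (pair a b))

module _ (g : ℕ) where

  nodes₄ nodes₅ : ℕ → List AnyPerm
  nodes₄ n = cartesianProductWith node simple₄ (tuples (every g) 4 n)
  nodes₅ n = cartesianProductWith node simple₅ (tuples (every g) 5 n)

  ∈-nodes₄⁻ : ∀ n {a} → a ∈ delay (delay (delay nodes₄)) n → ∃₂ λ ρ v → ∃ λ m →
    3 + m ≡ n × ρ ∈ simple₄ × v ∈ tuples (every g) 4 m × a ≡ node ρ v
  ∈-nodes₄⁻ n a∈
    with n₁ , refl , a∈ ← ∈-delay⁻ (delay (delay nodes₄)) n a∈
    with n₂ , refl , a∈ ← ∈-delay⁻ (delay nodes₄) n₁ a∈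
    with m , refl , a∈ ← ∈-delay⁻ nodes₄ n₂ a∈ =
    let ρ , v , r = ∈-cartesianProductWith⁻ node simple₄ (tuples (every g) 4 m) a∈
    in ρ , v , m , refl , r

  ∈-nodes₅⁻ : ∀ n {a} → a ∈ delay (delay (delay (delay nodes₅))) n → ∃₂ λ ρ v → ∃ λ m →
    4 + m ≡ n × ρ ∈ simple₅ × v ∈ tuples (every g) 5 m × a ≡ node ρ v
  ∈-nodes₅⁻ n a∈
    with n₁ , refl , a∈ ← ∈-delay⁻ (delay (delay (delay nodes₅))) n a∈
    with n₂ , refl , a∈ ← ∈-delay⁻ (delay (delay nodes₅)) n₁ a∈
    with n₃ , refl , a∈ ← ∈-delay⁻ (delay nodes₅) n₂ a∈
    with m , refl , a∈ ← ∈-delay⁻ nodes₅ n₃ a∈ =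
    let ρ , v , r = ∈-cartesianProductWith⁻ node simple₅ (tuples (every g) 5 m) a∈
    in ρ , v , m , refl , r

  member : ∀ r n {a} → a ∈ family (suc g) r n → Member g r n a
  member prime n a∈ with ∈-++⁻ (point n) a∈
  member prime zero a∈ | inj₁ (here refl) = is-point
  ... | inj₂ a∈₂ with ∈-++⁻ (delay (delay (delay nodes₄)) n) a∈₂
  ...   | inj₁ a∈₄ with ρ , v , m , refl , ρ∈ , v∈ , refl ← ∈-nodes₄⁻ n a∈₄ =
    is-simple ρ ℕ.≤-refl (ℕ.n≤1+n 4) (simple₄-simple ρ∈) v∈
  ...   | inj₂ a∈₅ with ρ , v , m , refl , ρ∈ , v∈ , refl ← ∈-nodes₅⁻ n a∈₅ =
    is-simple ρ (ℕ.n≤1+n 4) ℕ.≤-refl (simple₅-simple ρ∈) v∈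
  member (split s) n a∈
    with m , refl , a∈ ← ∈-delay⁻ _ n a∈
    with ρ , v , here refl , v∈ , refl ←
      ∈-cartesianProductWith⁻ node [ two s ] (convolve pair (firsts g s) (every g) m) a∈
    with i , j , a , b , refl , a∈ , b∈ , refl ← ∈-convolve⁻ pair (firsts g s) (every g) m v∈ =
    is-split s a∈ b∈

∈-every⁻ : ∀ g n {a} → a ∈ every g n → ∃ λ r → a ∈ family g r n
∈-every⁻ g n a∈ with ∈-++⁻ (family g prime n) a∈
... | inj₁ a∈₁ = prime , a∈₁
... | inj₂ a∈₂ with ∈-++⁻ (family g (split ⊕) n) a∈₂
...   | inj₁ a∈⊕ = split ⊕ , a∈⊕
...   | inj₂ a∈⊖ = split ⊖ , a∈⊖

∈-every⁺ : ∀ g r n {a} → a ∈ family g r n → a ∈ every g n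
∈-every⁺ g prime     n a∈ = ∈-++⁺ˡ a∈
∈-every⁺ g (split ⊕) n a∈ = ∈-++⁺ʳ (family g prime n) (∈-++⁺ˡ a∈)
∈-every⁺ g (split ⊖) n a∈ = ∈-++⁺ʳ (family g prime n) (∈-++⁺ʳ (family g (split ⊕) n) a∈)

∈-firsts⁻ : ∀ g s n {a} → a ∈ firsts g s n → a ∈ family g prime n ⊎ a ∈ family g (split (opposite s)) n
∈-firsts⁻ g s n = ∈-++⁻ (family g prime n)

firsts⊆every : ∀ g s n {a} → a ∈ firsts g s n → a ∈ every g n
firsts⊆every g s n a∈ with ∈-firsts⁻ g s n a∈
... | inj₁ a∈₁ = ∈-every⁺ g prime n a∈₁
... | inj₂ a∈₂ = ∈-every⁺ g (split (opposite s)) n a∈₂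

every-graded : ∀ g → Graded (every g)
family-graded : ∀ g r {n a} → a ∈ family g r n → deg a ≡ n

every-graded g {n} a∈ = let r , a∈′ = ∈-every⁻ g n a∈ in family-graded g r a∈′

family-graded (suc g) r {n} a∈ with member g r n a∈
... | is-point = refl
... | is-simple {k} ρ _ _ _ {m} {v} v∈ =
  trans (deg-node ρ v) (cong (k +_) (proj₁ (∈-tuples⁻ (every-graded g) (suc k) m v∈)))
... | is-split s {i} {j} {a} {b} a∈ b∈ = trans (deg-node (two s) (pair a b))
  (cong suc (cong₂ _+_ (every-graded g (firsts⊆every g s i a∈))
    (trans (ℕ.+-identityʳ (deg b)) (every-graded g b∈))))

split-decomposable : ∀ g {s n a} → a ∈ family g (split s) n → Decomposable s a
split-decomposable (suc g) {s} {n} a∈ with member g (split s) n a∈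
... | is-split s {a = a} {b} _ _ = node-decomposable s (pair a b)

prime-indecomposable : ∀ g {s n a} → a ∈ family g prime n → ¬ Decomposable s a
prime-indecomposable (suc g) {s} {n} a∈ with member g prime n a∈
... | is-point = λ { (suc c , cut _ (s≤s ()) _) }
... | is-simple ρ 3<k _ S {v = v} _ = simple-node-indecomposable {s = s} {ρ} {v} S 3<k

-- Barring the root s from first children is what supplies the hypothesis of `two-node-unique`.
firsts-indecomposable : ∀ g {s n a} → a ∈ firsts g s n → ¬ Decomposable s a
firsts-indecomposable g {s} {n} a∈ with ∈-firsts⁻ g s n a∈
... | inj₁ a∈₁ = prime-indecomposable g a∈₁
... | inj₂ a∈₂ = λ d → cut-opposite {s = s} d (split-decomposable g a∈₂)

every-distinct  : ∀ g n → Distinct _≃_ (every g n)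
family-distinct : ∀ g r n → Distinct _≃_ (family g r n)
firsts-distinct : ∀ g s n → Distinct _≃_ (firsts g s n)

prime-split-distinct : ∀ g s n → All (λ a → All (λ b → ¬ a ≃ b) (family g (split s) n)) (family g prime n)
prime-split-distinct g s n = All.tabulate λ a∈ → All.tabulate λ b∈ a≃b →
  prime-indecomposable g a∈ (decomposable-resp a≃b (split-decomposable g b∈))

every-distinct g n = AllPairs.++⁺ (family-distinct g prime n)
  (AllPairs.++⁺ (family-distinct g (split ⊕) n) (family-distinct g (split ⊖) n)
    (All.tabulate λ a∈ → All.tabulate λ b∈ a≃b →
      cut-opposite {s = ⊕} (split-decomposable g a∈) (decomposable-resp a≃b (split-decomposable g b∈))))
  (All.zipWith (λ (p , q) → All.++⁺ p q) (prime-split-distinct g ⊕ n , prime-split-distinct g ⊖ n))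

firsts-distinct g s n = AllPairs.++⁺ (family-distinct g prime n) (family-distinct g (split (opposite s)) n)
  (prime-split-distinct g (opposite s) n)

family-distinct zero    r n = []
family-distinct (suc g) prime n = AllPairs.++⁺ (point-distinct n)
  (AllPairs.++⁺
    (distinct-delay (distinct-delay (distinct-delay λ m → distinct-product node
      (λ {ρ} {ρ′} {v} {v′} ρ∈ ρ′∈ _ _ →
        simple-node-unique {ρ = ρ} {ρ′} (simple₄-simple ρ∈) (simple₄-simple ρ′∈) ℕ.≤-refl {v} {v′})
      simple₄-distinct (distinct-tuples (every-graded g) (every-distinct g) 4 m))) n)
    (distinct-delay (distinct-delay (distinct-delay (distinct-delay λ m → distinct-product node
      (λ {ρ} {ρ′} {v} {v′} ρ∈ ρ′∈ _ _ →
        simple-node-unique {ρ = ρ} {ρ′} (simple₅-simple ρ∈) (simple₅-simple ρ′∈) (ℕ.n≤1+n 4) {v} {v′})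
      simple₅-distinct (distinct-tuples (every-graded g) (every-distinct g) 5 m)))) n)
    (All.tabulate λ a∈ → All.tabulate λ b∈ → 4≢5 (∈-nodes₄⁻ g n a∈) (∈-nodes₅⁻ g n b∈)))
  (All.tabulate λ a∈ → All.tabulate λ b∈ _ → point≢ n a∈ b∈)
  where
  point-distinct : ∀ n → Distinct _≃_ (point n)
  point-distinct zero    = [] ∷ []
  point-distinct (suc n) = []
  point≢ : ∀ n {a b} → a ∈ point n →
    ¬ b ∈ delay (delay (delay (nodes₄ g))) n ++ delay (delay (delay (delay (nodes₅ g)))) n
  point≢ zero _ ()
  4≢5 : ∀ {a b} →
    (∃₂ λ ρ v → ∃ λ m → 3 + m ≡ n × ρ ∈ simple₄ × v ∈ tuples (every g) 4 m × a ≡ node ρ v) →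
    (∃₂ λ ρ v → ∃ λ m → 4 + m ≡ n × ρ ∈ simple₅ × v ∈ tuples (every g) 5 m × b ≡ node ρ v) →
    ¬ a ≃ b
  4≢5 (ρ , v , _ , _ , ρ∈ , _ , refl) (ρ′ , v′ , _ , _ , ρ′∈ , _ , refl) a≃b
    with () ← simple-node-arity {ρ = ρ} (simple₄-simple ρ∈) ℕ.≤-refl
      {ρ′ = ρ′} (simple₅-simple ρ′∈) (ℕ.n≤1+n 4) {v} {v′} a≃b
family-distinct (suc g) (split s) n = distinct-delay (λ m → distinct-product {R = _≈_} node (injective m)
    ([] ∷ [])
    (distinct-convolve pair (firsts g s) (every g)
      (λ {i} {i′} a∈ a′∈ e → trans (sym (every-graded g (firsts⊆every g s i a∈)))
        (trans (_≃_.deg≡ e) (every-graded g (firsts⊆every g s i′ a′∈))))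
      (λ e → e zero , e (suc zero))
      (firsts-distinct g s) (every-distinct g) m)) n
  where
  first-indec : ∀ m {v} → v ∈ convolve pair (firsts g s) (every g) m → ¬ Decomposable s (v zero)
  first-indec m v∈ with _ , _ , _ , _ , _ , a∈ , _ , refl ← ∈-convolve⁻ pair (firsts g s) (every g) m v∈ =
    firsts-indecomposable g a∈
  injective : ∀ m {ρ ρ′ v v′} → ρ ∈ [ two s ] → ρ′ ∈ [ two s ] →
    v ∈ convolve pair (firsts g s) (every g) m → v′ ∈ convolve pair (firsts g s) (every g) m →
    node ρ v ≃ node ρ′ v′ → ρ ≈ ρ′ × v ≃ᵥ v′
  injective m {v = v} {v′} (here refl) (here refl) v∈ v′∈ e = (λ _ → refl) ,
    two-node-unique {s} {v} {v′} (first-indec m v∈) (first-indec m v′∈) e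

-- The values of a block form an interval, so the separating value would be attained inside the
-- block, although its entry lies outside.
orderSimple⇒isSimple : ∀ (σ : Permutation′ n) → OrderSimple n (fn σ) → IsSimple σ
orderSimple⇒isSimple {n} σ S i j (block , nontrivial)
  with v , w , value ← IsBlock.interval block
  with separated {p} {a} {b} p∈ p∉ a∈ b∈ lt lt′ ←
    S (ℕ.≤∧≢⇒< (IsBlock.nonempty block) (λ e → nontrivial (inj₁ (sym e))))
      (IsBlock.inside block) (nontrivial ∘ inj₂)
  with below (proj₂ p∈) | below (ℕ.<-≤-trans (proj₂ a∈) (IsBlock.inside block))
     | below (ℕ.<-≤-trans (proj₂ b∈) (IsBlock.inside block))
... | at p | at a | at b
  with q , q∈ , σq≡σp ← Equivalence.from (value (σ ⟨$⟩ʳ p))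
    ( ℕ.≤-trans (proj₁ (Equivalence.to (value (σ ⟨$⟩ʳ a)) (a , a∈ , refl)))
        (ℕ.<⇒≤ (subst₂ _<_ (fn-toℕ σ a) (fn-toℕ σ p) lt))
    , ℕ.<-trans (subst₂ _<_ (fn-toℕ σ p) (fn-toℕ σ b) lt′)
        (proj₂ (Equivalence.to (value (σ ⟨$⟩ʳ b)) (b , b∈ , refl))))
  with refl ← trans (sym (inverseˡ σ)) (trans (cong (σ ⟨$⟩ˡ_) σq≡σp) (inverseˡ σ)) | p∉
... | inj₁ p<i = ℕ.<⇒≱ p<i (proj₁ q∈)
... | inj₂ j≤p = ℕ.<⇒≱ (proj₂ q∈) j≤p

short-orderSimple : ∀ {ρ : Permutation′ n} → n ≤ 2 → OrderSimple n (fn ρ)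
short-orderSimple n≤2 {x} {y} 2+x≤y y≤n nw = ⊥-elim (nw
  ( ℕ.n≤0⇒n≡0 (ℕ.+-cancelˡ-≤ 2 x 0 (ℕ.≤-trans 2+x≤y (ℕ.≤-trans y≤n n≤2)))
  , ℕ.≤-antisym y≤n (ℕ.≤-trans n≤2 (ℕ.≤-trans (ℕ.m≤m+n 2 x) 2+x≤y))))

module _ (D : PermSet) (closed : SubstitutionClosed D) (simples : Simp≤ 5 ⊆ D) where

  private
    node-mem : ∀ (ρ : Permutation′ (suc k)) v → suc k ≤ 5 → OrderSimple (suc k) (fn ρ) →
      (∀ i → mem D (size (v i)) (perm (v i))) → mem D (size (node ρ v)) (perm (node ρ v))
    node-mem ρ v k≤5 S v∈D = Equivalence.from (closed _ _)
      ( _ , ρ , size ∘ v , perm ∘ v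
      , simples _ ρ (s≤s z≤n , k≤5 , orderSimple⇒isSimple ρ S) , v∈D , node-isInflation ρ v )

  -- D is arbitrary because H(5) is an intersection. Each node is a single inflation of a simple
  -- permutation of length at most 5, so closedness of D applies directly.
  every-mem  : ∀ g n {a} → a ∈ every g n → mem D (size a) (perm a)
  family-mem : ∀ g r n {a} → a ∈ family g r n → mem D (size a) (perm a)

  every-mem g n a∈ = let r , a∈′ = ∈-every⁻ g n a∈ in family-mem g r n a∈′

  family-mem (suc g) r n a∈ with member g r n a∈
  ... | is-point = simples 1 idₚ
    (s≤s z≤n , s≤s z≤n , orderSimple⇒isSimple idₚ (short-orderSimple {ρ = idₚ} (s≤s z≤n)))
  ... | is-simple {k} ρ _ k≤5 S {m} {v} v∈ = node-mem ρ v k≤5 S λ i →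
    let l , vi∈ = proj₂ (∈-tuples⁻ (every-graded g) (suc k) m v∈) i in every-mem g l vi∈
  ... | is-split s {i} {j} {a} {b} a∈ b∈ = node-mem (two s) (pair a b) (s≤s (s≤s z≤n))
    (short-orderSimple {ρ = two s} (s≤s (s≤s z≤n)))
    λ { zero → every-mem g i (firsts⊆every g s i a∈) ; (suc zero) → every-mem g j b∈ }

-- Every member of H(5) is enumerated

data Label : Permutation′ k → Set where
  signed : ∀ s → Label (two s)
  four   : ∀ {ρ} → ρ ∈ simple₄ → Label ρ
  five   : ∀ {ρ} → ρ ∈ simple₅ → Label ρ

-- Decomposition trees over the absolute positions lo, …, hi - 1 of one function,
-- so that trees compose without any associativity law for inflation.
data Good (f : ℕ → ℕ) : ℕ → ℕ → Set where
  leaf   : ∀ {lo} → Good f lo (suc lo)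
  branch : ∀ {k lo hi c} {ρ : Permutation′ k} → Label ρ → Decomposition f lo hi k (fn ρ) c →
           (∀ {i} → i < k → Good f (c i) (c (suc i))) → Good f lo hi

locate-between : ∀ (h : ℕ → ℕ) {x y p} → x ≤ y → p ∈⟦ h x , h y ⟩ →
                 ∃ λ a → a ∈⟦ x , y ⟩ × p ∈⟦ h a , h (suc a) ⟩
locate-between h {x} {y} {p} x≤y (hx≤p , p<hy) =
  let i , i<d , le , lt = locate (λ z → h (x + z)) (y ∸ x)
        (subst (λ z → h z ≤ p) (sym (ℕ.+-identityʳ x)) hx≤p)
        (subst (λ z → p < h z) (sym (ℕ.m+[n∸m]≡n x≤y)) p<hy)
  in x + i
   , (ℕ.m≤m+n x i , subst (x + i <_) (ℕ.m+[n∸m]≡n x≤y) (ℕ.+-monoʳ-< x i<d))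
   , le , subst (λ z → p < h z) (ℕ.+-suc x i) lt

increasing : ∀ (h : ℕ → ℕ) {x y} → x < y → (∀ {i} → i ∈⟦ x , y ⟩ → h i < h (suc i)) → h x < h y
increasing h {x} {suc y} (s≤s x≤y) strict with ℕ.m≤n⇒m<n∨m≡n x≤y
... | inj₂ refl = strict (ℕ.≤-refl , ℕ.≤-refl)
... | inj₁ x<y  = ℕ.<-trans
  (increasing h x<y (λ (x≤i , i<y) → strict (x≤i , ℕ.<-trans i<y (ℕ.n<1+n y))))
  (strict (x≤y , ℕ.≤-refl))

-- Substitutes a tree for each leaf: h sends a position of g to the start of the block of f that
-- replaces it. The cuts of the new tree are the images of the old ones under h, so the upper part
-- keeps its shape. Closure under inflation rests on this.
good-graft : ∀ {x y} (h : ℕ → ℕ) → Good g x y →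
  (∀ {i} → i ∈⟦ x , y ⟩ → h i < h (suc i)) →
  (∀ {i j p q} → i ∈⟦ x , y ⟩ → j ∈⟦ x , y ⟩ → p ∈⟦ h i , h (suc i) ⟩ → q ∈⟦ h j , h (suc j) ⟩ →
    g i < g j → f p < f q) →
  (∀ {i} → i ∈⟦ x , y ⟩ → Good f (h i) (h (suc i))) →
  Good f (h x) (h y)
good-graft h leaf strict order leaves = leaves (ℕ.≤-refl , ℕ.≤-refl)
good-graft {g = g} {f = f} {x} {y} h (branch {k} {c = c} {ρ} L D children) strict order leaves = branch L
  record
    { start  = cong h (Decomposition.start D)
    ; end    = cong h (Decomposition.end D)
    ; strict = λ i<k → increasing h (Decomposition.strict D i<k) (λ a∈ → strict (widen i<k a∈))
    ; order  = λ i<k j<k ci≤p p<csi cj≤q q<csj lt →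
        let a , a∈ , p∈ = locate-between h (ℕ.<⇒≤ (Decomposition.strict D i<k)) (ci≤p , p<csi)
            b , b∈ , q∈ = locate-between h (ℕ.<⇒≤ (Decomposition.strict D j<k)) (cj≤q , q<csj)
        in order (widen i<k a∈) (widen j<k b∈) p∈ q∈
             (Decomposition.order D i<k j<k (proj₁ a∈) (proj₂ a∈) (proj₁ b∈) (proj₂ b∈) lt)
    }
  (λ i<k → good-graft h (children i<k)
    (λ a∈ → strict (widen i<k a∈))
    (λ a∈ b∈ → order (widen i<k a∈) (widen i<k b∈))
    (λ a∈ → leaves (widen i<k a∈)))
  where
  widen : ∀ {i a} → i < k → a ∈⟦ c i , c (suc i) ⟩ → a ∈⟦ x , y ⟩
  widen i<k (ci≤a , a<csi) = ℕ.≤-trans (cut-lo D (ℕ.<⇒≤ i<k)) ci≤a , ℕ.<-≤-trans a<csi (cut-hi D i<k)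

-- Grafting with blocks of size one, which moves a tree along an order-preserving translation.
good-shift : ∀ a → Good g 0 n →
  (∀ {p q} → p < n → q < n → g p < g q → f (a + p) < f (a + q)) → Good f a (a + n)
good-shift {g} {n} {f} a G order = subst (λ z → Good f z (a + n)) (ℕ.+-identityʳ a)
  (good-graft (a +_) G
    (λ _ → ℕ.+-monoʳ-< a (ℕ.n<1+n _))
    (λ {i} {j} {p} {q} i∈ j∈ p∈ q∈ lt →
      subst₂ (λ p q → f p < f q) (exact i p∈) (exact j q∈) (order (proj₂ i∈) (proj₂ j∈) lt))
    (λ {i} _ → subst (Good f (a + i)) (sym (ℕ.+-suc a i)) leaf))
  where
  exact : ∀ i {p} → p ∈⟦ a + i , a + suc i ⟩ → a + i ≡ p
  exact i {p} (le , lt) = ℕ.≤-antisym le (s≤s⁻¹ (subst (p <_) (ℕ.+-suc a i) lt))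

good-cong : Good g 0 n → (∀ {p} → p < n → f p ≡ g p) → Good f 0 n
good-cong G e = good-shift 0 G λ p< q< lt → subst₂ _<_ (sym (e p<)) (sym (e q<)) lt

good-inflation :
  ∀ {π : Permutation′ k} {m : Fin k → ℕ} {α : ∀ i → Permutation′ (m i)} {σ : Permutation′ n} →
  IsInflation π α σ → (∀ i → 0 < m i) → Good (fn π) 0 k → (∀ i → Good (fn (α i)) 0 (m i)) → Good (fn σ) 0 n
good-inflation {k} {n} {π} {m} {α} {σ} I 0<m G leaves = subst₂ (Good (fn σ)) start end
  (good-graft (cuts m) G
    (λ i∈ → strict (proj₂ i∈))
    (λ i∈ j∈ p∈ q∈ → order (proj₂ i∈) (proj₂ j∈) (proj₁ p∈) (proj₂ p∈) (proj₁ q∈) (proj₂ q∈))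
    (λ i∈ → block (below (proj₂ i∈))))
  where
  open Decomposition (inflation-decomposition I 0<m)
  block : ∀ {i} → Below k i → Good (fn σ) (cuts m i) (cuts m (suc i))
  block (at i) = subst (Good (fn σ) (cuts m (toℕ i))) (sym (cuts-suc m i))
    (good-shift (cuts m (toℕ i)) (leaves i) λ p< q< lt →
      subst₂ _<_ (sym (inflation-value I i p<)) (sym (inflation-value I i q<)) (ℕ.+-monoʳ-< (offset π m i) lt))

-- Exhaustive classification of the simple permutations of length 2 to 5

-- A block has as many values as positions, so only the lower end v of its value interval is
-- searched for.
ProperBlockF : Vec (Fin n) n → Set
ProperBlockF {n} t = ∃₂ λ (i j : Fin (suc n)) →
  (2 + toℕ i ≤ toℕ j × ¬ (toℕ i ≡ 0 × toℕ j ≡ n)) × ∃ λ (v : Fin (suc n)) →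
  ∀ p → (toℕ p ∈⟦ toℕ i , toℕ j ⟩ → toℕ (lookup t p) ∈⟦ toℕ v , toℕ v + (toℕ j ∸ toℕ i) ⟩) ×
        (toℕ (lookup t p) ∈⟦ toℕ v , toℕ v + (toℕ j ∸ toℕ i) ⟩ → toℕ p ∈⟦ toℕ i , toℕ j ⟩)

Repeats : Vec (Fin n) n → Set
Repeats {n} t = ∃₂ λ (p q : Fin n) → p ≢ q × lookup t p ≡ lookup t q

-- The search runs over all words of length n on n letters, as quantification over `Vec` is
-- decidable by enumeration; `Repeats` discards the words that are not permutations and is tested
-- first.
Classified : List (Permutation′ n) → Vec (Fin n) n → Set
Classified ρs t = Repeats t ⊎ Any (λ ρ → ∀ i → ρ ⟨$⟩ʳ i ≡ lookup t i) ρs ⊎ ProperBlockF t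

∈? : ∀ p x y → Dec (p ∈⟦ x , y ⟩)
∈? p x y = (x ℕ.≤? p) ×-dec (p ℕ.<? y)

classified? : (ρs : List (Permutation′ n)) → Decidable (Classified ρs)
classified? {n} ρs t =
  Fin.any? (λ p → Fin.any? λ q → ¬? (p Fin.≟ q) ×-dec (lookup t p Fin.≟ lookup t q)) ⊎-dec
  Any.any? (λ ρ → Fin.all? λ i → (ρ ⟨$⟩ʳ i) Fin.≟ lookup t i) ρs ⊎-dec
  Fin.any? λ i → Fin.any? λ j →
    ((2 + toℕ i ℕ.≤? toℕ j) ×-dec ¬? ((toℕ i ℕ.≟ 0) ×-dec (toℕ j ℕ.≟ n))) ×-dec
    Fin.any? λ v → Fin.all? λ p →
      let l = toℕ v + (toℕ j ∸ toℕ i)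
          in₁ = ∈? (toℕ p) (toℕ i) (toℕ j)
          in₂ = ∈? (toℕ (lookup t p)) (toℕ v) l
      in (in₁ →-dec in₂) ×-dec (in₂ →-dec in₁)

allVec? : ∀ k {P : Pred (Vec (Fin n) k) 0ℓ} → Decidable P → Dec (∀ t → P t)
allVec? zero    P? = map′ (λ { p [] → p }) (λ p → p []) (P? [])
allVec? (suc k) P? = map′ (λ { p (x ∷ t) → p x t }) (λ p x t → p (x ∷ t))
  (Fin.all? λ x → allVec? k λ t → P? (x ∷ t))

classified⇒listed : ∀ {ρs} → (∀ t → Classified {n} ρs t) → ∀ σ → IsSimple σ → ∃ λ ρ → ρ ∈ ρs × ρ ≈ σ
classified⇒listed {n} C σ simple with C (tabulate (σ ⟨$⟩ʳ_))
... | inj₁ (p , q , p≢q , e) = ⊥-elim (p≢q (trans (sym (inverseˡ σ)) (trans (cong (σ ⟨$⟩ˡ_)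
        (trans (sym (lookup∘tabulate (σ ⟨$⟩ʳ_) p)) (trans e (lookup∘tabulate (σ ⟨$⟩ʳ_) q)))) (inverseˡ σ))))
... | inj₂ (inj₁ found) = let ρ , ρ∈ , e = find found in
  ρ , ρ∈ , λ i → trans (e i) (lookup∘tabulate (σ ⟨$⟩ʳ_) i)
... | inj₂ (inj₂ (i , j , (2+i≤j , whole) , v , interval)) = ⊥-elim (simple (toℕ i) (toℕ j)
  ( record
    { nonempty = ℕ.≤-trans (ℕ.n≤1+n _) 2+i≤j
    ; inside   = s≤s⁻¹ (Fin.toℕ<n j)
    ; interval = toℕ v , toℕ v + (toℕ j ∸ toℕ i) , λ y → mk⇔
        (λ { (p , p∈ , refl) → subst (λ z → toℕ z ∈⟦ _ , _ ⟩)
              (lookup∘tabulate (σ ⟨$⟩ʳ_) p) (proj₁ (interval p) p∈) })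
        (λ y∈ → σ ⟨$⟩ˡ y , proj₂ (interval (σ ⟨$⟩ˡ y))
            (subst (λ z → toℕ z ∈⟦ _ , _ ⟩)
              (sym (trans (lookup∘tabulate (σ ⟨$⟩ʳ_) (σ ⟨$⟩ˡ y)) (inverseʳ σ))) y∈)
          , inverseʳ σ)
    }
  , λ { (inj₁ j≡si) → ℕ.<-irrefl (sym j≡si) 2+i≤j ; (inj₂ w) → whole w }))

opaque
  unfolding simple₄ simple₅

  classify₂ : ∀ t → Classified (two ⊕ ∷ two ⊖ ∷ []) t
  classify₂ = from-yes (allVec? 2 (classified? (two ⊕ ∷ two ⊖ ∷ [])))

  -- The list is empty because every permutation of length 3 has two adjacent entries with
  -- consecutive values.
  classify₃ : ∀ t → Classified {3} [] t
  classify₃ = from-yes (allVec? 3 (classified? []))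

  classify₄ : ∀ t → Classified simple₄ t
  classify₄ = from-yes (allVec? 4 (classified? simple₄))

  classify₅ : ∀ t → Classified simple₅ t
  classify₅ = from-yes (allVec? 5 (classified? simple₅))

simple-good : ∀ n (σ : Permutation′ n) → 1 ≤ n → n ≤ 5 → IsSimple σ → Good (fn σ) 0 n
simple-good 1 σ _ _ S = leaf
simple-good (suc (suc n)) σ 1≤n n≤5 S = let ρ , L , ρ≈σ = label n σ n≤5 S in
  branch {c = λ i → i} L
    record
      { start  = refl
      ; end    = refl
      ; strict = λ _ → ℕ.n<1+n _
      ; order  = λ {i} {j} i<n j<n i≤p p<si j≤q q<sj lt →
          subst₂ (λ p q → fn σ p < fn σ q) (ℕ.≤-antisym i≤p (s≤s⁻¹ p<si)) (ℕ.≤-antisym j≤q (s≤s⁻¹ q<sj))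
            (subst₂ _<_ (fn-cong ρ≈σ i<n) (fn-cong ρ≈σ j<n) lt)
      }
    (λ _ → leaf)
  where
  label : ∀ n (σ : Permutation′ (2 + n)) → 2 + n ≤ 5 → IsSimple σ → ∃ λ ρ → Label ρ × ρ ≈ σ
  label 0 σ _ S with classified⇒listed classify₂ σ S
  ... | _ , here refl , e         = two ⊕ , signed ⊕ , e
  ... | _ , there (here refl) , e = two ⊖ , signed ⊖ , e
  label 1 σ _ S with () ← proj₁ (proj₂ (classified⇒listed classify₃ σ S))
  label 2 σ _ S = let ρ , ρ∈ , e = classified⇒listed classify₄ σ S in ρ , four ρ∈ , e
  label 3 σ _ S = let ρ , ρ∈ , e = classified⇒listed classify₅ σ S in ρ , five ρ∈ , e
  label (suc (suc (suc (suc n)))) σ (s≤s (s≤s (s≤s (s≤s (s≤s ()))))) S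

-- The instance of D at which membership in H(5) is used: it is closed and contains the simple
-- permutations of length at most 5, so every member of H(5) has a tree.
good-set : PermSet
good-set = record
  { mem      = λ n σ → 1 ≤ n × Good (fn σ) 0 n
  ; positive = proj₁
  ; resp     = λ σ≈τ (1≤n , G) → 1≤n , good-cong G (λ p<n → sym (fn-cong σ≈τ p<n))
  }

good-set-closed : SubstitutionClosed good-set
good-set-closed n σ = mk⇔
  (λ σ∈ → 1 , idₚ , (λ _ → n) , (λ _ → σ) , (s≤s z≤n , leaf) , (λ _ → σ∈) , record
    { total   = sym (ℕ.+-identityʳ n)
    ; entries = λ { zero p q e → cong (λ i → toℕ (σ ⟨$⟩ʳ i)) (Fin.toℕ-injective e) }
    })
  (λ (k , α , m , β , α∈ , β∈ , I) →
      ℕ.≤-trans (proj₁ α∈) (k≤ I (proj₁ ∘ β∈))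
    , good-inflation I (proj₁ ∘ β∈) (proj₂ α∈) (proj₂ ∘ β∈))
  where
  k≤ : ∀ {k} {α : Permutation′ k} {m} {β : ∀ i → Permutation′ (m i)} → IsInflation α β σ →
       (∀ i → 1 ≤ m i) → k ≤ n
  k≤ {k} {m = m} I 1≤m = subst (k ≤_) (sym (IsInflation.total I)) (k≤sum k m 1≤m)
    where
    k≤sum : ∀ k (m : Fin k → ℕ) → (∀ i → 1 ≤ m i) → k ≤ sumℕ m
    k≤sum zero    m 1≤m = z≤n
    k≤sum (suc k) m 1≤m = ℕ.+-mono-≤ (1≤m zero) (k≤sum k (m ∘ suc) (1≤m ∘ suc))

H5-good : ∀ (σ : Permutation′ n) → H 5 n σ → Good (fn σ) 0 n
H5-good σ σ∈ = proj₂ (σ∈ good-set good-set-closed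
  λ n τ (1≤n , n≤5 , S) → 1≤n , simple-good n τ 1≤n n≤5 S)

-- Normal forms of decomposition trees and their realisation in the enumeration

data First (s : Sign) : Root → Set where
  prime : First s prime
  other : First s (split (opposite s))

first? : ∀ s r → First s r ⊎ r ≡ split s
first? s prime     = inj₁ prime
first? ⊕ (split ⊕) = inj₂ refl
first? ⊕ (split ⊖) = inj₁ other
first? ⊖ (split ⊕) = inj₁ other
first? ⊖ (split ⊖) = inj₂ refl

-- Trees shaped like `family`: the root is part of the type, so that the first child of a split can
-- be required not to repeat its sign.
data Normal (f : ℕ → ℕ) : Root → ℕ → ℕ → Set where
  leaf    : ∀ {lo} → Normal f prime lo (suc lo)
  cut     : ∀ {s r r′ lo x hi} → Cut s f lo x hi → First s r →
            Normal f r lo x → Normal f r′ x hi → Normal f (split s) lo hi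
  node₄   : ∀ {ρ lo hi c} → ρ ∈ simple₄ → Decomposition f lo hi 4 (fn ρ) c →
            (∀ {i} → i < 4 → ∃ λ r → Normal f r (c i) (c (suc i))) → Normal f prime lo hi
  node₅   : ∀ {ρ lo hi c} → ρ ∈ simple₅ → Decomposition f lo hi 5 (fn ρ) c →
            (∀ {i} → i < 5 → ∃ λ r → Normal f r (c i) (c (suc i))) → Normal f prime lo hi

-- (a ⊕ b) ⊕ c is rotated to a ⊕ (b ⊕ c).
normal-cut : ∀ {x s r r′} → Cut s f lo x hi → Normal f r lo x → Normal f r′ x hi → Normal f (split s) lo hi
normal-cut {f} {lo} {hi} {x} {s} {r} (cut lo<x x<hi cross) N N′ with first? s r
... | inj₁ F    = cut (cut lo<x x<hi cross) F N N′
... | inj₂ refl with cut {x = y} (cut lo<y y<x cross′) F N₁ N₂ ← N =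
  cut (cut lo<y (ℕ.<-trans y<x x<hi) outer) F N₁ (normal-cut
    (cut y<x x<hi λ (y≤p , p<x) q∈ → cross (ℕ.≤-trans (ℕ.<⇒≤ lo<y) y≤p , p<x) q∈) N₂ N′)
  where
  outer : ∀ {p q} → p ∈⟦ lo , y ⟩ → q ∈⟦ y , hi ⟩ → Before s (f p) (f q)
  outer {q = q} (lo≤p , p<y) (y≤q , q<hi) with ℕ.<-≤-connex q x
  ... | inj₁ q<x = cross′ (lo≤p , p<y) (y≤q , q<x)
  ... | inj₂ x≤q = cross (lo≤p , ℕ.<-trans p<y y<x) (x≤q , q<hi)

normalise : Good f lo hi → ∃ λ r → Normal f r lo hi
normalise leaf = prime , leaf
normalise {f} (branch {c = c} (signed s) D children) = split s , subst₂ (Normal f (split s)) start end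
  (normal-cut
    (subst₂ (λ l h → Cut s f l (c 1) h) (sym start) (sym end) (two-cut s D))
    (proj₂ (normalise (children z<s))) (proj₂ (normalise (children (s<s z<s)))))
  where open Decomposition D
normalise (branch (four ρ∈) D children) = prime , node₄ ρ∈ D λ i<4 → normalise (children i<4)
normalise (branch (five ρ∈) D children) = prime , node₅ ρ∈ D λ i<5 → normalise (children i<5)

normal-nonempty : ∀ {r} → Normal f r lo hi → lo < hi
normal-nonempty leaf              = ℕ.n<1+n _
normal-nonempty (cut X _ _ _)     = ℕ.<-trans (Cut.lo<c X) (Cut.c<hi X)
normal-nonempty (node₄ _ D _)   =
  subst₂ _<_ (Decomposition.start D) (Decomposition.end D) (cut-< D z<s ℕ.≤-refl)
normal-nonempty (node₅ _ D _)   =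
  subst₂ _<_ (Decomposition.start D) (Decomposition.end D) (cut-< D z<s ℕ.≤-refl)

record Realised (P : AnyPerm → Set) (f : ℕ → ℕ) (lo hi : ℕ) : Set where
  constructor realised
  field
    {a}   : AnyPerm
    a∈    : P a
    fits  : lo + size a ≡ hi
    order : OrderOf a f lo

-- There are at least two nonempty blocks, so each is shorter than the whole and the bound g + 1
-- drops to g.
block-bound : ∀ {r c} g → Decomposition f lo hi k r c → 1 < k → hi ≤ lo + suc g →
  ∀ {i} → i < k → c (suc i) ≤ c i + g
block-bound {lo = lo} {hi = hi} {c = c} g D 1<k hi≤ {zero} _ =
  subst (λ z → c 1 ≤ z + g) (sym (Decomposition.start D))
    (s≤s⁻¹ (ℕ.<-≤-trans (subst (c 1 <_) (Decomposition.end D) (cut-< D 1<k ℕ.≤-refl))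
      (subst (hi ≤_) (ℕ.+-suc lo g) hi≤)))
block-bound {lo = lo} {c = c} g D 1<k hi≤ {suc i} i<k =
  ℕ.≤-trans (cut-hi D i<k) (ℕ.≤-trans hi≤ (ℕ.≤-trans (ℕ.≤-reflexive (ℕ.+-suc lo g))
    (ℕ.+-monoˡ-≤ g (subst (_< c (suc i)) (Decomposition.start D) (cut-< D z<s (ℕ.<⇒≤ i<k))))))

module _ {f lo hi k c} {ρ : Permutation′ (suc k)} (D : Decomposition f lo hi (suc k) (fn ρ) c)
         (v : Fin (suc k) → AnyPerm)
         (fits : ∀ i → c (toℕ i) + size (v i) ≡ c (suc (toℕ i))) where

  blocks-fit : ∀ {x} → x ≤ suc k → lo + blocks v x ≡ c x
  blocks-fit {zero}  _   = trans (cong (lo +_) (cuts-zero (size ∘ v)))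
    (trans (ℕ.+-identityʳ lo) (sym (Decomposition.start D)))
  blocks-fit {suc x} x<k with below x<k
  ... | at i = trans (cong (lo +_) (cuts-suc (size ∘ v) i))
    (trans (sym (ℕ.+-assoc lo _ _)) (trans (cong (_+ size (v i)) (blocks-fit (ℕ.<⇒≤ x<k))) (fits i)))

  node-realised : ∀ {P} → P (node ρ v) → (∀ i → OrderOf (v i) f (c (toℕ i))) → Realised P f lo hi
  node-realised {P} a∈ order = realised {P} a∈
    (trans (cong (lo +_) (sym (Decomposition.end (node-decomposition ρ v))))
      (trans (blocks-fit ℕ.≤-refl) (Decomposition.end D)))
    (node-order ρ v D blocks-fit order)

InFamily : ℕ → Root → AnyPerm → Set
InFamily g r a = a ∈ family g r (deg a)

in-family : ∀ {g r n a} → a ∈ family g r n → InFamily g r a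
in-family {g} {r} {a = a} a∈ = subst (λ n → a ∈ family g r n) (sym (family-graded g r a∈)) a∈

-- Length serves as a bound on height: every branching strictly shortens the interval, so an
-- interval of length at most g has its tree within level g.
realise : ∀ {r} g → Normal f r lo hi → hi ≤ lo + g → Realised (InFamily g r) f lo hi
realise {lo = lo} zero N hi≤lo =
  ⊥-elim (ℕ.<⇒≱ (normal-nonempty N) (subst (_ ≤_) (ℕ.+-identityʳ lo) hi≤lo))
realise {f} {lo} (suc g) leaf _ = realised {a = 0 , idₚ} (here refl) (ℕ.+-comm lo 1)
  λ { {zero} {zero} _ _ () ; {suc _} (s≤s ()) ; {zero} {suc _} _ (s≤s ()) }
realise {f} {lo} {hi} (suc g) (cut {s} {r} {r′} {x = x} X F N N′) hi≤
  with realised {a} a∈ fits order ← realise g N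
    (s≤s⁻¹ (ℕ.<-≤-trans (Cut.c<hi X) (ℕ.≤-trans hi≤ (ℕ.≤-reflexive (ℕ.+-suc lo g)))))
     | realised {b} b∈ fits′ order′ ← realise g N′
    (ℕ.≤-trans hi≤ (ℕ.≤-trans (ℕ.≤-reflexive (ℕ.+-suc lo g)) (ℕ.+-monoˡ-≤ g (Cut.lo<c X)))) =
  node-realised (cut-two s X) (pair a b)
    (λ { zero → fits ; (suc zero) → fits′ })
    (in-family {suc g} {split s} {suc (deg a + deg b)}
      (∈-cartesianProductWith⁺ node {xs = [ two s ]} (here refl)
      (∈-convolve⁺ pair (firsts g s) (every g) (deg a) (deg b) (first∈ F a∈) (∈-every⁺ g r′ (deg b) b∈))))
    (λ { zero → order ; (suc zero) → order′ })
  where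
  first∈ : ∀ {r a} → First s r → InFamily g r a → a ∈ firsts g s (deg a)
  first∈ prime a∈ = ∈-++⁺ˡ a∈
  first∈ {a = a} other a∈ = ∈-++⁺ʳ (family g prime (deg a)) a∈
realise {f} {lo} (suc g) (node₄ {ρ} {c = c} ρ∈ D children) hi≤
  with v , v∈ , fit ← ∈-tuples⁺ {every g} 4
    {λ i a → c (toℕ i) + size a ≡ c (suc (toℕ i)) × OrderOf a f (c (toℕ i))} (λ i →
    let r , N = children (Fin.toℕ<n i)
        realised {a} a∈ fits order = realise g N (block-bound g D (s<s z<s) hi≤ (Fin.toℕ<n i))
    in a , ∈-every⁺ g r (deg a) a∈ , fits , order) =
  node-realised D v (λ i → proj₁ (fit i))
    (in-family {suc g} {prime} {3 + sumℕ (deg ∘ v)} (∈-++⁺ˡ (∈-cartesianProductWith⁺ node ρ∈ v∈)))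
    (λ i → proj₂ (fit i))
realise {f} {lo} (suc g) (node₅ {ρ} {c = c} ρ∈ D children) hi≤
  with v , v∈ , fit ← ∈-tuples⁺ {every g} 5
    {λ i a → c (toℕ i) + size a ≡ c (suc (toℕ i)) × OrderOf a f (c (toℕ i))} (λ i →
    let r , N = children (Fin.toℕ<n i)
        realised {a} a∈ fits order = realise g N (block-bound g D (s<s z<s) hi≤ (Fin.toℕ<n i))
    in a , ∈-every⁺ g r (deg a) a∈ , fits , order) =
  node-realised D v (λ i → proj₁ (fit i))
    (in-family {suc g} {prime} {4 + sumℕ (deg ∘ v)}
      (∈-++⁺ʳ (nodes₄ g (suc (sumℕ (deg ∘ v)))) (∈-cartesianProductWith⁺ node ρ∈ v∈)))
    (λ i → proj₂ (fit i))

H5-listed : ∀ {n} (σ : Permutation′ (suc n)) → H 5 (suc n) σ → ∃ λ a → a ∈ every (suc n) n × a ≃ (n , σ)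
H5-listed {n} σ σ∈ with r , N ← normalise (H5-good σ σ∈)
  with realised {a} a∈ refl order ← realise (suc n) N ℕ.≤-refl =
  a , ∈-every⁺ (suc n) r n a∈ , order-≃ refl order

-- From permutations of arbitrary size to a list of permutations of one size

atDegree : ∀ {n} a → deg a ≡ n → Permutation′ (suc n)
atDegree (_ , σ) refl = σ

restrict : ∀ {n} (as : List AnyPerm) → All (λ a → deg a ≡ n) as → List (Permutation′ (suc n))
restrict []       []       = []
restrict (a ∷ as) (e ∷ es) = atDegree a e ∷ restrict as es

restrict-total : ∀ {n} as (es : All (λ a → deg a ≡ n) as) →
  total weight as ≗ₚ desIdesPoly (restrict as es)
restrict-total []              []          a b = refl
restrict-total ((_ , σ) ∷ as) (refl ∷ es) a b =
  cong (mono (des σ) (ides σ) a b ℚ.+_) (restrict-total as es a b)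

atDegree-≈ : ∀ {n} a b (e : deg a ≡ n) (e′ : deg b ≡ n) → atDegree a e ≈ atDegree b e′ → a ≃ b
atDegree-≈ (_ , σ) (_ , τ) refl refl σ≈τ = refl , fn-cong σ≈τ

restrict-unique : ∀ {n} as (es : All (λ a → deg a ≡ n) as) →
  Distinct _≃_ as → Distinct _≈_ (restrict as es)
restrict-unique []       []       []       = []
restrict-unique {n} (a ∷ as) (e ∷ es) (p ∷ ps) = apart as es p ∷ restrict-unique as es ps
  where
  apart : ∀ as (es : All (λ b → deg b ≡ n) as) → All (λ b → ¬ a ≃ b) as →
          All (λ τ → ¬ atDegree a e ≈ τ) (restrict as es)
  apart []       []        []       = []
  apart (b ∷ bs) (e′ ∷ es) (q ∷ qs) = (λ a≈b → q (atDegree-≈ a b e e′ a≈b)) ∷ apart bs es qs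

restrict-∈⁻ : ∀ {n} as (es : All (λ a → deg a ≡ n) as) {τ} → Any (τ ≈_) (restrict as es) →
  ∃ λ σ → (n , σ) ∈ as × σ ≈ τ
restrict-∈⁻ ((_ , σ) ∷ as) (refl ∷ es) (here τ≈σ)  = σ , here refl , λ i → sym (τ≈σ i)
restrict-∈⁻ (a ∷ as)       (e ∷ es)    {τ} (there τ∈) =
  let σ , σ∈ , σ≈τ = restrict-∈⁻ as es {τ} τ∈ in σ , there σ∈ , σ≈τ

restrict-∈⁺ : ∀ {n} as (es : All (λ a → deg a ≡ n) as) {a τ} →
  a ∈ as → a ≃ (n , τ) → Any (τ ≈_) (restrict as es)
restrict-∈⁺ (a ∷ as) (refl ∷ es) (here refl) (_ , e) = here (λ i → sym (fn-≈ e i))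
restrict-∈⁺ (a ∷ as) (e ∷ es)    (there a∈)  eq      = there (restrict-∈⁺ as es a∈ eq)

theorem3p12 : ∀ (n : ℕ) → 1 ≤ n →
    Σ Poly λ f → IsDesIdesSum (H 5 n) f × IsGammaPositive (n ∸ 1) f
theorem3p12 (suc n) _ =
    total weight as
  , ( restrict as degrees
    , record
      { unique = restrict-unique as degrees (every-distinct (suc n) n)
      ; member = λ τ → mk⇔ sound (complete τ)
      }
    , restrict-total as degrees )
  , GP⇒IsGammaPositive (every-homogeneous (suc n) n)
  where
  as : List AnyPerm
  -- A tree on n + 1 points has height at most n, and level n + 1 holds exactly the trees of height
  -- at most n.
  as = every (suc n) n
  degrees : All (λ a → deg a ≡ n) as
  degrees = All.tabulate λ a∈ → every-graded (suc n) a∈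
  sound : ∀ {τ} → Any (τ ≈_) (restrict as degrees) → H 5 (suc n) τ
  sound {τ} τ∈ D closed simples = let σ , σ∈ , σ≈τ = restrict-∈⁻ as degrees {τ} τ∈ in
    resp D σ≈τ (every-mem D closed simples (suc n) n σ∈)
  complete : ∀ τ → H 5 (suc n) τ → Any (τ ≈_) (restrict as degrees)
  complete τ τ∈ = let a , a∈ , a≃τ = H5-listed τ τ∈ in restrict-∈⁺ as degrees a∈ a≃τ
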